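{- For every integer $n\ge 0$, the following two identities hold as identities of rational functions in the indeterminate $q$: \[ \sum_{(h_0,h_1,\ldots,h_{2n})\in\mathcal{D}_n}\ \prod_{i=1}^{2n}\frac{q^{h_i}}{1-q^{2h_i+1-\delta_{h_i,i}}}=\frac{E^*_{2n}(q)}{(q;q)_{2n}}, \] \[ \sum_{(h_0,h_1,\ldots,h_{2n})\in\mathcal{D}_n}\ \prod_{i=1}^{2n}\frac{q^{h_i-\delta_{h_i,i}}}{1-q^{2h_i+1-\delta_{h_i,i}}}=\frac{E_{2n}(q)}{(q;q)_{2n}}, \] where $\delta_{i,j}$ is the Kronecker delta.
   Context: $\mathcal{D}_n$ is the set of Dyck paths of length $2n$, each encoded by its sequence of heights: $\mathcal{D}_n$ consists of the integer sequences $(h_0,h_1,\ldots,h_{2n})$ with $h_0=h_{2n}=0$, $h_i\ge 0$ for all $i$, and $|h_i-h_{i+1}|=1$ for all $0\le i<2n$. $(a;q)_n=\prod_{i=0}^{n-1}(1-aq^i)$, so $(q;q)_{m}=\prod_{i=1}^{m}(1-q^i)$. For $\sigma\in\mathfrak{S}_n$ (permutations of $\{1,\ldots,n\}$), the descent set is $D(\sigma)=\{i\in\{1,\ldots,n-1\}:\sigma_i>\sigma_{i+1}\}$, and the major index is $\mathrm{maj}(\sigma)=\sum_{i\in D(\sigma)}i$. The permutation $\sigma$ is alternating if $\sigma_1>\sigma_2<\sigma_3>\cdots$ (its descent set is the set of odd elements of $\{1,\ldots,n-1\}$), and reverse alternating if $\sigma_1<\sigma_2>\sigma_3<\cdots$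 (its descent set is the set of even elements of $\{1,\ldots,n-1\}$). $\mathrm{Alt}_n$ and $\mathrm{RevAlt}_n$ denote the sets of alternating and reverse alternating permutations in $\mathfrak{S}_n$ respectively. Define \[ E_n(q)=\sum_{\sigma\in \mathrm{RevAlt}_n}q^{\mathrm{maj}(\sigma^{ -1})},\qquad E_n^*(q)=\sum_{\sigma\in \mathrm{Alt}_n}q^{\mathrm{maj}(\sigma^{ -1})}. \] For $n=0$ the unique (empty) permutation is counted in both, so $E_0(q)=E_0^*(q)=1$; empty products equal $1$. -}

module Defs where

open import Data.Bool.Base using (true; false; if_then_else_)
open import Data.Empty using (⊥-elim)
open import Data.Fin.Base as Fin using (Fin; zero; suc; toℕ; fromℕ; inject₁; punchIn)
import Data.Fin.Properties as Finₚ
open import Data.Fin.Permutation as Perm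
  using (Permutation′; _⟨$⟩ʳ_; insert; remove; flip; insert-remove; insert-punchIn)
open import Data.Integer.Base as ℤ using (ℤ; 0ℤ; 1ℤ; +_)
import Data.Integer.Properties as ℤₚ
open import Data.List.Base as List
  using (List; []; _∷_; map; foldr; filter; allFin; upTo; cartesianProductWith)
open import Data.List.Membership.Propositional using (_∈_)
open import Data.List.Membership.Propositional.Properties
  using (∈-filter⁺; ∈-filter⁻; ∈-upTo⁺; ∈-allFin; ∈-cartesianProductWith⁺)
open import Data.List.Relation.Unary.All as All using ([])
open import Data.List.Relation.Unary.AllPairs using ([]; _∷_)
open import Data.List.Relation.Unary.Any as Any using (Any; here; there)
import Data.List.Relation.Unary.Any.Properties as Anyₚ
open import Data.List.Relation.Unary.Unique.Propositional using (Unique)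
import Data.List.Relation.Unary.Unique.Propositional.Properties as Uniqueₚ
import Data.List.Relation.Unary.Unique.Setoid as UniqueS
import Data.List.Relation.Unary.Unique.Setoid.Properties as UniqueSₚ
open import Data.Nat.Base as ℕ using (ℕ; zero; suc; _+_; _*_; _∸_; pred; ∣_-_∣)
open import Data.Nat.Divisibility using (_∣_; _∣?_)
import Data.Nat.ListAction as ℕL
import Data.Nat.Properties as ℕₚ
open import Data.Product.Base using (_×_; _,_; proj₁; proj₂)
open import Data.Sum.Base using (inj₁; inj₂)
open import Data.Vec.Base as Vec using (Vec; []; _∷_; lookup)
import Data.Vec.Properties as Vecₚ
open import Function.Base using (_∘_)
open import Function.Bundles using (_⇔_; mk⇔; Equivalence)
open import Level using (0ℓ)
open import Relation.Binary.Bundles using (Setoid)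
open import Relation.Binary.PropositionalEquality
  using (_≡_; _≢_; refl; sym; trans; cong; cong₂; subst; setoid)
open import Relation.Nullary using (¬_; Dec; yes; no; does)
open import Relation.Nullary.Decidable using (map′; ¬?; _×-dec_; _→-dec_)

-- ℤ[q] as coefficient lists, constant term first.  Trailing zeros are allowed,
-- so equality is _≈_ rather than _≡_.
Poly : Set
Poly = List ℤ

coeff : Poly → ℕ → ℤ
coeff []      _       = 0ℤ
coeff (a ∷ p) zero    = a
coeff (a ∷ p) (suc k) = coeff p k

infix 4 _≈_ _≉_

_≈_ : Poly → Poly → Set
p ≈ r = ∀ k → coeff p k ≡ coeff r k

_≉_ : Poly → Poly → Set
p ≉ r = ¬ (p ≈ r)

infixl 6 _+ₚ_ _-ₚ_
infixl 7 _*ₚ_ _·ₚ_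

0ₚ 1ₚ : Poly
0ₚ = []
1ₚ = 1ℤ ∷ []

_+ₚ_ : Poly → Poly → Poly
[]      +ₚ r       = r
(a ∷ p) +ₚ []      = a ∷ p
(a ∷ p) +ₚ (b ∷ r) = (a ℤ.+ b) ∷ (p +ₚ r)

_·ₚ_ : ℤ → Poly → Poly
a ·ₚ r = map (a ℤ.*_) r

-ₚ_ : Poly → Poly
-ₚ p = map ℤ.-_ p

_-ₚ_ : Poly → Poly → Poly
p -ₚ r = p +ₚ (-ₚ r)

_*ₚ_ : Poly → Poly → Poly
[]      *ₚ r = []
(a ∷ p) *ₚ r = (a ·ₚ r) +ₚ (0ℤ ∷ (p *ₚ r))

q^_ : ℕ → Poly
q^ zero  = 1ₚ
q^ suc k = 0ℤ ∷ (q^ k)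

q : Poly
q = q^ 1

∑ₚ : List Poly → Poly
∑ₚ = foldr _+ₚ_ 0ₚ

∏ₚ : List Poly → Poly
∏ₚ = foldr _*ₚ_ 1ₚ

-- ⟨ a ⨾q⟩ n is the q-Pochhammer symbol (a;q)ₙ.
⟨_⨾q⟩_ : Poly → ℕ → Poly
⟨ a ⨾q⟩ n = ∏ₚ (map (λ i → 1ₚ -ₚ a *ₚ (q^ i)) (upTo n))

coeff-+ : ∀ p r k → coeff (p +ₚ r) k ≡ coeff p k ℤ.+ coeff r k
coeff-+ []      r       k       = sym (ℤₚ.+-identityˡ _)
coeff-+ (a ∷ p) []      k       = sym (ℤₚ.+-identityʳ _)
coeff-+ (a ∷ p) (b ∷ r) zero    = refl
coeff-+ (a ∷ p) (b ∷ r) (suc k) = coeff-+ p r k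

coeff-· : ∀ a r k → coeff (a ·ₚ r) k ≡ a ℤ.* coeff r k
coeff-· a []      k       = sym (ℤₚ.*-zeroʳ a)
coeff-· a (b ∷ r) zero    = refl
coeff-· a (b ∷ r) (suc k) = coeff-· a r k

coeff-* : ∀ a p r k →
          coeff ((a ∷ p) *ₚ r) k ≡ a ℤ.* coeff r k ℤ.+ coeff (0ℤ ∷ (p *ₚ r)) k
coeff-* a p r k =
  trans (coeff-+ (a ·ₚ r) (0ℤ ∷ (p *ₚ r)) k) (cong (ℤ._+ _) (coeff-· a r k))

*-shiftʳ : ∀ p r → p *ₚ (0ℤ ∷ r) ≈ 0ℤ ∷ (p *ₚ r)
*-shiftʳ []      r zero    = refl
*-shiftʳ []      r (suc k) = refl
*-shiftʳ (a ∷ p) r zero    =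
  trans (coeff-* a p (0ℤ ∷ r) 0) (trans (ℤₚ.+-identityʳ _) (ℤₚ.*-zeroʳ a))
*-shiftʳ (a ∷ p) r (suc k) =
  trans (coeff-* a p (0ℤ ∷ r) (suc k))
        (trans (cong (λ z → a ℤ.* coeff r k ℤ.+ z) (*-shiftʳ p r k))
               (sym (coeff-* a p r k)))

*-cancel-unless : ∀ a p r → a ≢ 0ℤ → (a ∷ p) *ₚ r ≈ 0ₚ → r ≈ 0ₚ
*-cancel-unless a p []      a≢0 ap*r≈0 k = refl
*-cancel-unless a p (b ∷ r) a≢0 ap*r≈0 k with ℤₚ.i*j≡0⇒i≡0∨j≡0 a ab≡0
  where
  ab≡0 : a ℤ.* b ≡ 0ℤ
  ab≡0 = trans (sym (ℤₚ.+-identityʳ _))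
               (trans (sym (coeff-* a p (b ∷ r) 0)) (ap*r≈0 0))
... | inj₁ a≡0 = ⊥-elim (a≢0 a≡0)
... | inj₂ refl with k
...   | zero   = refl
...   | suc k′ = *-cancel-unless a p r a≢0
                   (λ j → trans (sym (*-shiftʳ (a ∷ p) r (suc j))) (ap*r≈0 (suc j))) k′

*-domain : ∀ p r → r ≉ 0ₚ → p *ₚ r ≈ 0ₚ → p ≈ 0ₚ
*-domain []      r r≉0 pr≈0 k = refl
*-domain (a ∷ p) r r≉0 pr≈0 k with a ℤₚ.≟ 0ℤ
... | no a≢0   = ⊥-elim (r≉0 (*-cancel-unless a p r a≢0 pr≈0))
... | yes refl with k
...   | zero   = refl
...   | suc k′ = *-domain p r r≉0 (λ j → trans (step j) (pr≈0 (suc j))) k′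
  where
  step : ∀ j → coeff (p *ₚ r) j ≡ coeff ((0ℤ ∷ p) *ₚ r) (suc j)
  step j = sym (trans (coeff-* 0ℤ p r (suc j)) (ℤₚ.+-identityˡ _))

*-≉0 : ∀ p r → p ≉ 0ₚ → r ≉ 0ₚ → p *ₚ r ≉ 0ₚ
*-≉0 p r p≉0 r≉0 pr≈0 = p≉0 (*-domain p r r≉0 pr≈0)

1≉0 : 1ₚ ≉ 0ₚ
1≉0 eq with () ← eq 0

1-q^≉0 : ∀ {e} → 0 ℕ.< e → 1ₚ -ₚ (q^ e) ≉ 0ₚ
1-q^≉0 {suc e} _ eq with () ← eq 0

⟨q⨾q⟩≉0 : ∀ n → ⟨ q ⨾q⟩ n ≉ 0ₚ
⟨q⨾q⟩≉0 n = prod (upTo n)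
  where
  fac≉0 : ∀ i → 1ₚ -ₚ q *ₚ (q^ i) ≉ 0ₚ
  fac≉0 zero    eq with () ← eq 0
  fac≉0 (suc i) eq with () ← eq 0

  prod : ∀ is → ∏ₚ (map (λ i → 1ₚ -ₚ q *ₚ (q^ i)) is) ≉ 0ₚ
  prod []       = 1≉0
  prod (i ∷ is) = *-≉0 (1ₚ -ₚ q *ₚ (q^ i)) _ (fac≉0 i) (prod is)

-- Rational functions in q form the fraction field of ℤ[q], with equality
-- by cross-multiplication.
infix 8 _/_⟨_⟩

record RatFun : Set where
  constructor _/_⟨_⟩
  field
    num   : Poly
    den   : Poly
    den≉0 : den ≉ 0ₚ

open RatFun public

infix 4 _≃_

_≃_ : RatFun → RatFun → Set
f ≃ g = num f *ₚ den g ≈ num g *ₚ den f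

0ᶠ 1ᶠ : RatFun
0ᶠ = 0ₚ / 1ₚ ⟨ 1≉0 ⟩
1ᶠ = 1ₚ / 1ₚ ⟨ 1≉0 ⟩

infixl 6 _+ᶠ_
infixl 7 _*ᶠ_

_+ᶠ_ : RatFun → RatFun → RatFun
f +ᶠ g = (num f *ₚ den g +ₚ num g *ₚ den f) / (den f *ₚ den g)
         ⟨ *-≉0 (den f) (den g) (den≉0 f) (den≉0 g) ⟩

_*ᶠ_ : RatFun → RatFun → RatFun
f *ᶠ g = (num f *ₚ num g) / (den f *ₚ den g) ⟨ *-≉0 (den f) (den g) (den≉0 f) (den≉0 g) ⟩

∑ : List RatFun → RatFun
∑ = foldr _+ᶠ_ 0ᶠ

∏ : List RatFun → RatFun
∏ = foldr _*ᶠ_ 1ᶠ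

δ : ℕ → ℕ → ℕ
δ i j = if does (i ℕₚ.≟ j) then 1 else 0

δ≤1 : ∀ i j → δ i j ℕ.≤ 1
δ≤1 i j with does (i ℕₚ.≟ j)
... | true  = ℕ.s≤s ℕ.z≤n
... | false = ℕ.z≤n

-- i : Fin m stands for the index toℕ i + 1 ∈ {1,…,m}.
position : ∀ {m} → Fin m → ℕ
position i = suc (toℕ i)

-- At h = i = 0 the exponent vanishes, hence the restriction to i ≥ 1.
exponent>0 : ∀ h i .{{_ : ℕ.NonZero i}} → 0 ℕ.< 2 * h + 1 ∸ δ h i
exponent>0 zero    (suc i) = ℕ.s≤s ℕ.z≤n
exponent>0 (suc h) i       = ℕₚ.m<n⇒0<n∸m
  (ℕₚ.≤-<-trans (δ≤1 (suc h) i) (ℕₚ.m<n+m 1 {2 * suc h} (ℕ.s≤s ℕ.z≤n)))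

factor⋆ factor : ∀ h i .{{_ : ℕ.NonZero i}} → RatFun
factor⋆ h i = (q^ h)           / (1ₚ -ₚ (q^ (2 * h + 1 ∸ δ h i))) ⟨ 1-q^≉0 (exponent>0 h i) ⟩
-- δ h i ≤ h because i ≥ 1, so h ∸ δ h i is a true difference.
factor  h i = (q^ (h ∸ δ h i)) / (1ₚ -ₚ (q^ (2 * h + 1 ∸ δ h i))) ⟨ 1-q^≉0 (exponent>0 h i) ⟩

-- Heights are taken in ℕ, which builds in hᵢ ≥ 0.
IsDyck : ∀ n → Vec ℕ (suc (2 * n)) → Set
IsDyck n h =
  lookup h zero ≡ 0 ×
  lookup h (fromℕ (2 * n)) ≡ 0 ×
  (∀ (i : Fin (2 * n)) → ∣ lookup h (inject₁ i) - lookup h (suc i) ∣ ≡ 1)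

isDyck? : ∀ n h → Dec (IsDyck n h)
isDyck? n h =
  (_ ℕₚ.≟ _) ×-dec (_ ℕₚ.≟ _) ×-dec Finₚ.all? (λ i → _ ℕₚ.≟ _)

words : ∀ {A : Set} → List A → ∀ m → List (Vec A m)
words xs zero    = [] ∷ []
words xs (suc m) = cartesianProductWith _∷_ xs (words xs m)

-- Restricting the candidate heights to {0,…,2n} loses nothing; see
-- ∈-dyckPaths and dyckPaths-unique.
dyckPaths : ∀ n → List (Vec ℕ (suc (2 * n)))
dyckPaths n = filter (isDyck? n) (words (upTo (suc (2 * n))) (suc (2 * n)))

∈-words : ∀ {A : Set} (xs : List A) {m} (v : Vec A m) →
          (∀ i → lookup v i ∈ xs) → v ∈ words xs m
∈-words xs []      all∈ = here refl
∈-words xs (x ∷ v) all∈ =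
  ∈-cartesianProductWith⁺ _∷_ (all∈ zero) (∈-words xs v (all∈ ∘ suc))

words-unique : ∀ {A : Set} {xs : List A} → Unique xs → ∀ m → Unique (words xs m)
words-unique xs! zero    = [] ∷ []
words-unique xs! (suc m) =
  Uniqueₚ.cartesianProductWith⁺ _∷_ Vecₚ.∷-injective xs! (words-unique xs! m)

height≤ : ∀ {m} (v : Vec ℕ (suc m)) →
          (∀ (i : Fin m) → ∣ lookup v (inject₁ i) - lookup v (suc i) ∣ ≡ 1) →
          ∀ i → lookup v i ℕ.≤ lookup v zero + toℕ i
height≤ v steps zero = ℕₚ.m≤m+n _ _
height≤ {suc m} (x ∷ y ∷ v) steps (suc i) = ℕₚ.≤-trans
  (height≤ (y ∷ v) (steps ∘ suc) i)
  (ℕₚ.≤-trans (ℕₚ.+-monoˡ-≤ (toℕ i) y≤x+1)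
              (ℕₚ.≤-reflexive (ℕₚ.+-assoc x 1 (toℕ i))))
  where
  y≤x+1 : y ℕ.≤ x + 1
  y≤x+1 = subst (λ d → y ℕ.≤ x + d)
                (trans (ℕₚ.∣-∣-comm y x) (steps zero))
                (ℕₚ.m≤n+∣m-n∣ y x)

∈-dyckPaths : ∀ n h → h ∈ dyckPaths n ⇔ IsDyck n h
∈-dyckPaths n h = mk⇔ (λ h∈ → proj₂ (∈-filter⁻ (isDyck? n) {xs = words (upTo (suc (2 * n))) (suc (2 * n))} h∈)) from
  where
  from : IsDyck n h → h ∈ dyckPaths n
  from d@(h₀≡0 , _ , steps) = ∈-filter⁺ (isDyck? n) {xs = words (upTo (suc (2 * n))) (suc (2 * n))}
    (∈-words _ h bound) d
    where
    bound : ∀ i → lookup h i ∈ upTo (suc (2 * n))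
    bound i = ∈-upTo⁺ (ℕ.s≤s (ℕₚ.≤-trans
      (subst (λ z → lookup h i ℕ.≤ z + toℕ i) h₀≡0 (height≤ h steps i))
      (Finₚ.toℕ≤pred[n] i)))

dyckPaths-unique : ∀ n → Unique (dyckPaths n)
dyckPaths-unique n =
  Uniqueₚ.filter⁺ (isDyck? n) (words-unique (Uniqueₚ.upTo⁺ (suc (2 * n))) (suc (2 * n)))

-- Every permutation occurs exactly once up to pointwise equality; see
-- permutations-complete and permutations-unique.
permutations : ∀ n → List (Permutation′ n)
permutations zero    = Perm.id ∷ []
permutations (suc n) = cartesianProductWith (insert zero) (allFin (suc n)) (permutations n)

insert-cong : ∀ {n} i j {π ρ : Permutation′ n} →
              π Perm.≈ ρ → insert i j π Perm.≈ insert i j ρ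
insert-cong i j π≈ρ k with i Finₚ.≟ k
... | yes _  = refl
... | no i≢k = cong (punchIn j) (π≈ρ (Fin.punchOut i≢k))

permutations-complete : ∀ {n} (π : Permutation′ n) → Any (π Perm.≈_) (permutations n)
permutations-complete {zero}  π = here λ ()
permutations-complete {suc n} π = Anyₚ.cartesianProductWith⁺ (insert zero)
  (λ { refl π′≈ρ k → trans (sym (insert-remove zero π k)) (insert-cong zero _ {remove zero π} π′≈ρ k) })
  (∈-allFin (π ⟨$⟩ʳ zero)) (permutations-complete (remove zero π))

permSetoid : ℕ → Setoid 0ℓ 0ℓ
permSetoid n = record
  { Carrier       = Permutation′ n
  ; _≈_           = Perm._≈_
  ; isEquivalence = record
    { refl  = λ _ → refl
    ; sym   = λ e i → sym (e i)
    ; trans = λ e f i → trans (e i) (f i)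
    }
  }

permutations-unique : ∀ n → UniqueS.Unique (permSetoid n) (permutations n)
permutations-unique zero    = [] ∷ []
permutations-unique (suc n) = UniqueSₚ.cartesianProductWith⁺
  (setoid (Fin (suc n))) (permSetoid n) (permSetoid (suc n)) (insert zero)
  (λ {j} {k} {π} {ρ} → inj {j} {k} {π} {ρ})
  (Uniqueₚ.allFin⁺ (suc n)) (permutations-unique n)
  where
  inj : ∀ {j k π ρ} → insert zero j π Perm.≈ insert zero k ρ → j ≡ k × π Perm.≈ ρ
  inj {j} {k} {π} {ρ} e with refl ← e zero =
    refl , λ i → Finₚ.punchIn-injective j _ _ (e (suc i))

-- The second argument is a position in {1,…,n−1}.
IsDescent : ∀ {n} → Permutation′ n → Fin (pred n) → Set
IsDescent {suc n} σ i = σ ⟨$⟩ʳ inject₁ i Fin.> σ ⟨$⟩ʳ suc i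

isDescent? : ∀ {n} (σ : Permutation′ n) i → Dec (IsDescent σ i)
isDescent? {suc n} σ i = _ Finₚ.<? _

maj : ∀ {n} → Permutation′ n → ℕ
maj {n} σ = ℕL.sum (map position (filter (isDescent? σ) (allFin (pred n))))

Even Odd : ℕ → Set
Even k = 2 ∣ k
Odd k  = ¬ (2 ∣ k)

IsAlternating IsReverseAlternating : ∀ {n} → Permutation′ n → Set
IsAlternating        σ = ∀ i → IsDescent σ i ⇔ Odd (position i)
IsReverseAlternating σ = ∀ i → IsDescent σ i ⇔ Even (position i)

_⇔?_ : ∀ {A B : Set} → Dec A → Dec B → Dec (A ⇔ B)
a? ⇔? b? = map′ (λ (f , g) → mk⇔ f g) (λ e → Equivalence.to e , Equivalence.from e)
                ((a? →-dec b?) ×-dec (b? →-dec a?))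

isAlternating? : ∀ {n} (σ : Permutation′ n) → Dec (IsAlternating σ)
isAlternating? σ = Finₚ.all? λ i → isDescent? σ i ⇔? ¬? (2 ∣? position i)

isReverseAlternating? : ∀ {n} (σ : Permutation′ n) → Dec (IsReverseAlternating σ)
isReverseAlternating? σ = Finₚ.all? λ i → isDescent? σ i ⇔? (2 ∣? position i)

Alt RevAlt : ∀ n → List (Permutation′ n)
Alt    n = filter isAlternating? (permutations n)
RevAlt n = filter isReverseAlternating? (permutations n)

-- `flip σ` is σ⁻¹.
E E⋆ : ℕ → Poly
E  n = ∑ₚ (map (λ σ → q^ maj (flip σ)) (RevAlt n))
E⋆ n = ∑ₚ (map (λ σ → q^ maj (flip σ)) (Alt n))

{-# OPTIONS --safe #-}

-- All denominators are invertible modulo q^M, so it suffices to compare both sides in ℤ[q]/(q^M)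
-- for every M.
--
-- Permutations: 1/(q;q)ₙ ∑ q^maj(σ⁻¹) over the σ with a prescribed descent set enumerates, by
-- standardization, the words a₁…aₙ of natural numbers with prescribed comparisons between
-- neighbours, weighted by q^(a₁+…+aₙ).  Hence E₂ₙ/(q;q)₂ₙ enumerates the words a₁ ∼ a₂ ≁ a₃ ∼ a₄ ≁ …
-- for ∼ = ≥, and E⋆₂ₙ/(q;q)₂ₙ those for ∼ = <.  If Zₖ enumerates the words a₁ ∼ a₂ ∼ … ∼ aₖ, then
-- concatenation and a telescoping sum give ∑ⱼ (-1)ʲ Z₂ⱼ E₂₍ₙ₋ⱼ₎/(q;q)₂₍ₙ₋ⱼ₎ = 0 for n > 0, while
-- Z₂ⱼ = 1/(q;q)₂ⱼ respectively q^(j(2j-1))/(q;q)₂ⱼ.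
--
-- Paths: δ matters only on the initial ascent.  Decomposing paths by their first step, the sums
-- over the paths starting at height k, multiplied by the series ∑ⱼ (-1)ʲ Z₂ⱼ x²ʲ, satisfy the
-- three-term recurrence of q-Bessel functions of half-integral order and are given by explicit
-- hypergeometric terms; at height 0 on the initial ascent the product is 1.
module Submission where

open import Algebra.Bundles using (CommutativeRing)
import Algebra.Properties.CommutativeMonoid.Sum as MonoidSums
import Algebra.Properties.Ring as RingProperties
import Algebra.Properties.Semiring.Mult.TCOptimised as Multiples
import Algebra.Properties.Semiring.Sum as Sums
import Algebra.Solver.Ring as RingSolver
open import Algebra.Solver.Ring.AlmostCommutativeRing
  using (fromCommutativeRing; _-Raw-AlmostCommutative⟶_)
open import Algebra.Structures using (IsCommutativeRing)
open import Data.Bool.Base using (Bool; true; false; not; if_then_else_)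
import Data.Bool.Properties as Boolₚ
open import Data.Fin.Base as Fin using (Fin; zero; suc; toℕ; fromℕ; punchIn; inject₁; opposite)
open import Data.Fin.Permutation as Perm
  using (Permutation′; _⟨$⟩ʳ_; _⟨$⟩ˡ_; insert; flip; _∘ₚ_)
import Data.Fin.Properties as Finₚ
open import Data.Integer.Base as ℤ using (ℤ; 0ℤ; 1ℤ)
import Data.Integer.Properties as ℤₚ
import Data.Integer.Solver as IntegerSolver
open import Data.List.Base as List
  using (List; []; _∷_; _++_; foldr; map; filter; tabulate; allFin; upTo; applyUpTo; cartesianProductWith)
open import Data.Maybe.Base using (Maybe; just; nothing)
open import Data.Nat.Base as ℕ using (ℕ; zero; suc; z≤n; s≤s; _∸_; _⊔_; ∣_-_∣)
open import Data.Nat.Divisibility using (_∣_; _∣?_; divides; ∣m+n∣m⇒∣n; ∣m∣n⇒∣m+n; ∣-refl)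
import Data.Nat.ListAction as ℕL
import Data.Nat.Properties as ℕₚ
import Data.Nat.Solver as NatSolver
open import Data.Product.Base using (_×_; _,_)
open import Data.Sum.Base using (_⊎_; inj₁; inj₂)
open import Data.Vec.Base as Vec using (Vec; []; _∷_; lookup)
open import Data.Vec.Functional as Vector using (Vector; insertAt; tail)
import Data.Vec.Functional.Properties as Vectorₚ
open import Defs
  using (permutations; words; dyckPaths; isDyck?; position; maj; IsDescent; isDescent?;
         IsAlternating; IsReverseAlternating; _⇔?_)
open import Function.Base using (_∘_; id)
open import Function.Bundles using (_⇔_; mk⇔; Equivalence)
open import Level using (0ℓ)
open import Relation.Binary.Core using (Rel)
open import Relation.Binary.Definitions using (Transitive; tri<; tri≈; tri>)
open import Relation.Binary.PropositionalEquality as ≡ using (_≡_; _≢_; _≗_)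
import Relation.Binary.Reasoning.Setoid as SetoidReasoning
open import Relation.Binary.Structures using (IsEquivalence)
open import Relation.Nullary using (¬_; Dec; yes; no; does)
open import Relation.Nullary.Decidable
  using (_×-dec_; _→-dec_; decidable-stable; dec-true; dec-false)
open import Relation.Nullary.Negation using (contradiction)
open import Relation.Unary using (Decidable)

-- Modulo q^M a letter of size at least M contributes nothing, so enumerations of words become
-- finite sums over the alphabet 0, ..., M-1. The variable x of the Bessel recurrence is avoided
-- too: `altConv` states identities of series in x coefficient by coefficient. The alternating
-- numbers are accessible only as the inverse e of the signed series Z; hence a path sum is
-- described as e convolved with an explicit sequence, rather than by Z times the sum. The closed
-- form for general paths carries a factor 1 - q^(2k+1), which cancels the denominator of the vertex
-- weight at height k. On the initial ascent δ lowers that denominator to 1 - q^(2k), and the factor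
-- in the closed form changes alike. It vanishes at k = 0, so that every term beyond the constant
-- one disappears there: this is why the shifted weights, and not the plain ones, yield e itself.
-- The two identities share this computation and differ only in powers of q.

open Equivalence using (to; from)

-- A ring solver with integer coefficients

module IntegerCoefficients {c ℓ} (R : CommutativeRing c ℓ) where
  open CommutativeRing R
  open RingProperties ring
  open Multiples semiring renaming (_×_ to _×ⁿ_)
  open import Data.Integer.Base using (+_; -[1+_])
  open SetoidReasoning setoid

  -- The ring comes without a decision procedure for equality, so the solver normalizes with
  -- coefficients in ℤ, where cancellation can be recognized. The multiples are those for which
  -- `1 ×ⁿ 1#` reduces to `1#`, so that `con 1ℤ` denotes `1#` itself.
  fromℤ : ℤ → Carrier
  fromℤ (+ n)      = n ×ⁿ 1#
  fromℤ -[1+ n ] = - (suc n ×ⁿ 1#)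

  fromℤ-⊖ : ∀ m n → fromℤ (m ℤ.⊖ n) ≈ m ×ⁿ 1# - n ×ⁿ 1#
  fromℤ-⊖ m zero = sym (trans (+-congˡ -0#≈0#) (+-identityʳ _))
  fromℤ-⊖ zero (suc n) = sym (+-identityˡ _)
  fromℤ-⊖ (suc m) (suc n) = begin
    fromℤ (suc m ℤ.⊖ suc n)               ≡⟨ ≡.cong fromℤ (ℤₚ.[1+m]⊖[1+n]≡m⊖n m n) ⟩
    fromℤ (m ℤ.⊖ n)                       ≈⟨ fromℤ-⊖ m n ⟩
    m ×ⁿ 1# - n ×ⁿ 1#                       ≈⟨ +-congʳ (+-identityʳ _) ⟨
    m ×ⁿ 1# + 0# - n ×ⁿ 1#                  ≈⟨ +-congʳ (+-congˡ (-‿inverseʳ 1#)) ⟨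
    m ×ⁿ 1# + (1# - 1#) - n ×ⁿ 1#           ≈⟨ +-congʳ (+-assoc _ _ _) ⟨
    m ×ⁿ 1# + 1# - 1# - n ×ⁿ 1#             ≈⟨ +-assoc _ _ _ ⟩
    m ×ⁿ 1# + 1# + (- 1# - n ×ⁿ 1#)         ≈⟨ +-cong (+-comm _ _) (-‿+-comm 1# (n ×ⁿ 1#)) ⟩
    1# + m ×ⁿ 1# - (1# + n ×ⁿ 1#)           ≈⟨ +-cong (1+× m 1#) (-‿cong (1+× n 1#)) ⟨
    suc m ×ⁿ 1# - suc n ×ⁿ 1#               ∎

  fromℤ-neg : ∀ i → fromℤ (ℤ.- i) ≈ - fromℤ i
  fromℤ-neg (+ zero)   = sym -0#≈0#
  fromℤ-neg (+ suc n)  = refl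
  fromℤ-neg -[1+ n ] = sym (-‿involutive _)

  fromℤ-+ : ∀ i j → fromℤ (i ℤ.+ j) ≈ fromℤ i + fromℤ j
  fromℤ-+ (+ m)    (+ n)    = ×-homo-+ 1# m n
  fromℤ-+ (+ m)    -[1+ n ] = fromℤ-⊖ m (suc n)
  fromℤ-+ -[1+ m ] (+ n)    = trans (fromℤ-⊖ n (suc m)) (+-comm _ _)
  fromℤ-+ -[1+ m ] -[1+ n ] = begin
    - (suc (suc (m ℕ.+ n)) ×ⁿ 1#)   ≡⟨ ≡.cong (λ k → - (k ×ⁿ 1#)) (ℕₚ.+-suc (suc m) n) ⟨
    - ((suc m ℕ.+ suc n) ×ⁿ 1#)     ≈⟨ -‿cong (×-homo-+ 1# (suc m) (suc n)) ⟩
    - (suc m ×ⁿ 1# + suc n ×ⁿ 1#)    ≈⟨ -‿+-comm _ _ ⟨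
    - (suc m ×ⁿ 1#) - suc n ×ⁿ 1#    ∎

  fromℤ-*⁺ : ∀ m n → fromℤ (+ m ℤ.* + n) ≈ fromℤ (+ m) * fromℤ (+ n)
  fromℤ-*⁺ m n = begin
    fromℤ (+ m ℤ.* + n)  ≡⟨ ≡.cong fromℤ (ℤₚ.pos-* m n) ⟨
    (m ℕ.* n) ×ⁿ 1#       ≈⟨ ×1-homo-* m n ⟩
    m ×ⁿ 1# * (n ×ⁿ 1#)    ∎

  fromℤ-* : ∀ i j → fromℤ (i ℤ.* j) ≈ fromℤ i * fromℤ j
  fromℤ-* (+ m)    (+ n)    = fromℤ-*⁺ m n
  fromℤ-* (+ m)    -[1+ n ] = begin
    fromℤ (+ m ℤ.* ℤ.- + suc n)         ≡⟨ ≡.cong fromℤ (ℤₚ.neg-distribʳ-* (+ m) (+ suc n)) ⟨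
    fromℤ (ℤ.- (+ m ℤ.* + suc n))       ≈⟨ fromℤ-neg (+ m ℤ.* + suc n) ⟩
    - fromℤ (+ m ℤ.* + suc n)           ≈⟨ -‿cong (fromℤ-*⁺ m (suc n)) ⟩
    - (m ×ⁿ 1# * (suc n ×ⁿ 1#))           ≈⟨ -‿distribʳ-* _ _ ⟩
    m ×ⁿ 1# * - (suc n ×ⁿ 1#)             ∎
  fromℤ-* -[1+ m ] (+ n)    = begin
    fromℤ (ℤ.- + suc m ℤ.* + n)         ≡⟨ ≡.cong fromℤ (ℤₚ.neg-distribˡ-* (+ suc m) (+ n)) ⟨
    fromℤ (ℤ.- (+ suc m ℤ.* + n))       ≈⟨ fromℤ-neg (+ suc m ℤ.* + n) ⟩
    - fromℤ (+ suc m ℤ.* + n)           ≈⟨ -‿cong (fromℤ-*⁺ (suc m) n) ⟩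
    - (suc m ×ⁿ 1# * (n ×ⁿ 1#))           ≈⟨ -‿distribˡ-* _ _ ⟩
    - (suc m ×ⁿ 1#) * (n ×ⁿ 1#)           ∎
  fromℤ-* -[1+ m ] -[1+ n ] = begin
    fromℤ (+ suc m ℤ.* + suc n)           ≈⟨ fromℤ-*⁺ (suc m) (suc n) ⟩
    suc m ×ⁿ 1# * (suc n ×ⁿ 1#)             ≈⟨ -‿involutive _ ⟨
    - - (suc m ×ⁿ 1# * (suc n ×ⁿ 1#))       ≈⟨ -‿cong (-‿distribʳ-* _ _) ⟩
    - (suc m ×ⁿ 1# * - (suc n ×ⁿ 1#))       ≈⟨ -‿distribˡ-* _ _ ⟩
    - (suc m ×ⁿ 1#) * - (suc n ×ⁿ 1#)       ∎

  coefficientMap : ℤ.+-*-rawRing -Raw-AlmostCommutative⟶ fromCommutativeRing R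
  coefficientMap = record
    { ⟦_⟧    = fromℤ
    ; +-homo = fromℤ-+
    ; *-homo = fromℤ-*
    ; -‿homo = fromℤ-neg
    ; 0-homo = refl
    ; 1-homo = refl
    }

  _coeff≟_ : ∀ i j → Maybe (fromℤ i ≈ fromℤ j)
  i coeff≟ j with i ℤₚ.≟ j
  ... | yes i≡j = just (reflexive (≡.cong fromℤ i≡j))
  ... | no  _   = nothing

  open RingSolver ℤ.+-*-rawRing (fromCommutativeRing R) coefficientMap _coeff≟_ public
    using (Polynomial; solve; con; _:=_; _:+_; _:*_; _:-_; :-_)

-- Finite sums, indicators and sums over words

module FiniteSums {c ℓ} (R : CommutativeRing c ℓ) where
  open CommutativeRing R hiding (zero)
  open Sums semiring public
  open SetoidReasoning setoid

  ∑∈ : {A : Set} → List A → (A → Carrier) → Carrier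
  ∑∈ xs f = foldr _+_ 0# (map f xs)

  ∑∈-cong : ∀ {A : Set} (xs : List A) {f g} → (∀ x → f x ≈ g x) → ∑∈ xs f ≈ ∑∈ xs g
  ∑∈-cong []       f≈g = refl
  ∑∈-cong (x ∷ xs) f≈g = +-cong (f≈g x) (∑∈-cong xs f≈g)

  ∑∈-++ : ∀ {A : Set} (xs ys : List A) f → ∑∈ (xs ++ ys) f ≈ ∑∈ xs f + ∑∈ ys f
  ∑∈-++ []       ys f = sym (+-identityˡ _)
  ∑∈-++ (x ∷ xs) ys f = trans (+-congˡ (∑∈-++ xs ys f)) (sym (+-assoc _ _ _))

  ∑∈-map : ∀ {A B : Set} (g : A → B) xs f → ∑∈ (map g xs) f ≈ ∑∈ xs (f ∘ g)
  ∑∈-map g []       f = refl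
  ∑∈-map g (x ∷ xs) f = +-congˡ (∑∈-map g xs f)

  ∑∈-cartesianProductWith : ∀ {A B C : Set} (g : A → B → C) xs ys f →
    ∑∈ (cartesianProductWith g xs ys) f ≈ ∑∈ xs (λ x → ∑∈ ys (λ y → f (g x y)))
  ∑∈-cartesianProductWith g []       ys f = refl
  ∑∈-cartesianProductWith g (x ∷ xs) ys f = begin
    ∑∈ (map (g x) ys ++ cartesianProductWith g xs ys) f
      ≈⟨ ∑∈-++ (map (g x) ys) _ f ⟩
    ∑∈ (map (g x) ys) f + ∑∈ (cartesianProductWith g xs ys) f
      ≈⟨ +-cong (∑∈-map (g x) ys f) (∑∈-cartesianProductWith g xs ys f) ⟩
    ∑∈ (x ∷ xs) (λ x → ∑∈ ys (λ y → f (g x y))) ∎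

  ∑∈-tabulate : ∀ {A : Set} {n} (g : Fin n → A) f → ∑∈ (tabulate g) f ≈ sum (f ∘ g)
  ∑∈-tabulate {n = zero}  g f = refl
  ∑∈-tabulate {n = suc n} g f = +-congˡ (∑∈-tabulate (g ∘ suc) f)

  *-distribˡ-∑∈ : ∀ {A : Set} a (xs : List A) f → a * ∑∈ xs f ≈ ∑∈ xs (λ x → a * f x)
  *-distribˡ-∑∈ a []       f = zeroʳ a
  *-distribˡ-∑∈ a (x ∷ xs) f = trans (distribˡ a _ _) (+-congˡ (*-distribˡ-∑∈ a xs f))

  *-distribʳ-∑∈ : ∀ {A : Set} a (xs : List A) f → ∑∈ xs f * a ≈ ∑∈ xs (λ x → f x * a)
  *-distribʳ-∑∈ a xs f = begin
    ∑∈ xs f * a            ≈⟨ *-comm _ a ⟩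
    a * ∑∈ xs f            ≈⟨ *-distribˡ-∑∈ a xs f ⟩
    ∑∈ xs (λ x → a * f x)  ≈⟨ ∑∈-cong xs (λ x → *-comm a (f x)) ⟩
    ∑∈ xs (λ x → f x * a)  ∎

  ∑∈-∑-comm : ∀ {A : Set} (xs : List A) {n} (f : A → Fin n → Carrier) →
    ∑∈ xs (λ x → sum (f x)) ≈ ∑[ i < n ] ∑∈ xs (λ x → f x i)
  ∑∈-∑-comm []       {n} f = sym (sum-replicate-zero n)
  ∑∈-∑-comm (x ∷ xs) f =
    trans (+-congˡ (∑∈-∑-comm xs f)) (sym (∑-distrib-+ (f x) _))

  -- The Iverson bracket. With it a filtered sum becomes an unrestricted one, and conditions can be
  -- split into factors and moved across sums.
  ι : ∀ {P : Set} → Dec P → Carrier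
  ι p = if does p then 1# else 0#

  ι-yes : ∀ {P : Set} (p : Dec P) → P → ι p ≈ 1#
  ι-yes (yes _) _ = refl
  ι-yes (no ¬p) p = contradiction p ¬p

  ι-no : ∀ {P : Set} (p : Dec P) → ¬ P → ι p ≈ 0#
  ι-no (no _)  _  = refl
  ι-no (yes p) ¬p = contradiction p ¬p

  ι-cong : ∀ {P Q : Set} (p : Dec P) (q : Dec Q) → (P → Q) → (Q → P) → ι p ≈ ι q
  ι-cong p (yes y) to from = ι-yes p (from y)
  ι-cong p (no ¬y) to from = ι-no p (¬y ∘ to)

  ι-× : ∀ {P Q : Set} (p : Dec P) (q : Dec Q) → ι (p ×-dec q) ≈ ι p * ι q
  ι-× (yes _) q = sym (*-identityˡ _)
  ι-× (no _)  q = sym (zeroˡ _)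

  ι-split : ∀ {P Q S : Set} (p : Dec P) (q : Dec Q) (s : Dec S) →
    (P → Q × S) → (Q → S → P) → ι p ≈ ι q * ι s
  ι-split p q s to from =
    trans (ι-cong p (q ×-dec s) to (λ (x , y) → from x y)) (ι-× q s)

  ι-*-cong : ∀ {P : Set} (p : Dec P) {x y} → (P → x ≈ y) → ι p * x ≈ ι p * y
  ι-*-cong (yes p) x≈y = *-congˡ (x≈y p)
  ι-*-cong (no _)  x≈y = trans (zeroˡ _) (sym (zeroˡ _))

  ∑∈-filter : ∀ {A : Set} {P : A → Set} (P? : Decidable P) xs f →
    ∑∈ (filter P? xs) f ≈ ∑∈ xs (λ x → ι (P? x) * f x)
  ∑∈-filter P? []       f = refl
  ∑∈-filter P? (x ∷ xs) f with P? x
  ... | yes _ = +-cong (sym (*-identityˡ _)) (∑∈-filter P? xs f)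
  ... | no  _ = begin
    ∑∈ (filter P? xs) f                            ≈⟨ ∑∈-filter P? xs f ⟩
    ∑∈ xs (λ x → ι (P? x) * f x)                   ≈⟨ +-identityˡ _ ⟨
    0# + ∑∈ xs (λ x → ι (P? x) * f x)              ≈⟨ +-congʳ (zeroˡ _) ⟨
    0# * f x + ∑∈ xs (λ x → ι (P? x) * f x)        ∎

  module Words (M : ℕ) where

    ∑words : ∀ n → (Vector ℕ n → Carrier) → Carrier
    ∑words zero    Φ = Φ Vector.[]
    ∑words (suc n) Φ = ∑[ c < M ] ∑words n (λ v → Φ (toℕ c Vector.∷ v))

    ∑words-cong : ∀ n {Φ Ψ} → (∀ v → Φ v ≈ Ψ v) → ∑words n Φ ≈ ∑words n Ψ
    ∑words-cong zero    Φ≈Ψ = Φ≈Ψ _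
    ∑words-cong (suc n) Φ≈Ψ = sum-cong-≋ {M} (λ c → ∑words-cong n (λ v → Φ≈Ψ _))

    *-distribˡ-∑words : ∀ a n Φ → a * ∑words n Φ ≈ ∑words n (λ v → a * Φ v)
    *-distribˡ-∑words a zero    Φ = refl
    *-distribˡ-∑words a (suc n) Φ =
      trans (*-distribˡ-sum {M} a _) (sum-cong-≋ {M} (λ c → *-distribˡ-∑words a n _))

    ∑∈-∑words-comm : ∀ {A : Set} (xs : List A) n (Φ : A → Vector ℕ n → Carrier) →
      ∑∈ xs (λ x → ∑words n (Φ x)) ≈ ∑words n (λ v → ∑∈ xs (λ x → Φ x v))
    ∑∈-∑words-comm xs zero    Φ = refl
    ∑∈-∑words-comm xs (suc n) Φ =
      trans (∑∈-∑-comm xs {M} _) (sum-cong-≋ {M} (λ c → ∑∈-∑words-comm xs n _))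

    -- Words are functions on `Fin n`, and pointwise equal ones need not be identical; reindexing a
    -- sum over words therefore asks this of the summand.
    Extensional : ∀ {n} → (Vector ℕ n → Carrier) → Set ℓ
    Extensional Φ = ∀ {v w} → v ≗ w → Φ v ≈ Φ w

    ∷-cong : ∀ {n} c {v w : Vector ℕ n} → v ≗ w → (c Vector.∷ v) ≗ (c Vector.∷ w)
    ∷-cong c v≗w zero    = ≡.refl
    ∷-cong c v≗w (suc i) = v≗w i

    insertAt-zero : ∀ {n} (v : Vector ℕ n) c → (c Vector.∷ v) ≗ insertAt v zero c
    insertAt-zero v c zero    = ≡.refl
    insertAt-zero v c (suc i) = ≡.refl

    insertAt-suc : ∀ {n} b (v : Vector ℕ n) j c →
      (b Vector.∷ insertAt v j c) ≗ insertAt (b Vector.∷ v) (suc j) c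
    insertAt-suc b v j c zero    = ≡.refl
    insertAt-suc b v j c (suc i) = ≡.refl

    -- Exchanging sums lets any position, not only the first, carry the outermost summation.
    ∑words-insertAt : ∀ {n} (Φ : Vector ℕ (suc n) → Carrier) → Extensional Φ → ∀ j →
      ∑words (suc n) Φ ≈ ∑[ c < M ] ∑words n (λ v → Φ (insertAt v j (toℕ c)))
    ∑words-insertAt {n} Φ ext zero =
      sum-cong-≋ {M} (λ c → ∑words-cong n (λ v → ext (insertAt-zero v (toℕ c))))
    ∑words-insertAt {suc n} Φ ext (suc j) = begin
      ∑[ b < M ] ∑words (suc n) (λ w → Φ (toℕ b Vector.∷ w))
        ≈⟨ sum-cong-≋ {M} (λ b → ∑words-insertAt _ (ext ∘ ∷-cong (toℕ b)) j) ⟩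
      ∑[ b < M ] ∑[ c < M ] ∑words n (λ v → Φ (toℕ b Vector.∷ insertAt v j (toℕ c)))
        ≈⟨ ∑-comm {M} {M} _ ⟩
      ∑[ c < M ] ∑[ b < M ] ∑words n (λ v → Φ (toℕ b Vector.∷ insertAt v j (toℕ c)))
        ≈⟨ sum-cong-≋ {M} (λ c → sum-cong-≋ {M} (λ b → ∑words-cong n (λ v →
             ext (insertAt-suc (toℕ b) v j (toℕ c))))) ⟩
      ∑[ c < M ] ∑words (suc n) (λ v → Φ (insertAt v (suc j) (toℕ c))) ∎

    insertAt-permute : ∀ {n} (π : Permutation′ (suc n)) (v : Vector ℕ n) c →
      (insertAt v (π ⟨$⟩ʳ zero) c ∘ (π ⟨$⟩ʳ_)) ≗ (c Vector.∷ (v ∘ (Perm.remove zero π ⟨$⟩ʳ_)))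
    insertAt-permute π v c zero    = Vectorₚ.insertAt-lookup v (π ⟨$⟩ʳ zero) c
    insertAt-permute π v c (suc i) = ≡.trans
      (≡.cong (insertAt v (π ⟨$⟩ʳ zero) c) (Perm.punchIn-permute π zero i))
      (Vectorₚ.insertAt-punchIn v (π ⟨$⟩ʳ zero) c _)

    -- The first letter of `v ∘ π` is the letter of `v` at `π zero`. Summing over that letter first
    -- leaves a shorter word, permuted by `remove zero π`.
    ∑words-permute : ∀ {n} (Φ : Vector ℕ n → Carrier) → Extensional Φ → ∀ (π : Permutation′ n) →
      ∑words n (λ v → Φ (v ∘ (π ⟨$⟩ʳ_))) ≈ ∑words n Φ
    ∑words-permute {zero}  Φ ext π = ext (λ ())
    ∑words-permute {suc n} Φ ext π = begin
      ∑words (suc n) (λ v → Φ (v ∘ (π ⟨$⟩ʳ_)))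
        ≈⟨ ∑words-insertAt _ (λ v≗w → ext (v≗w ∘ (π ⟨$⟩ʳ_))) (π ⟨$⟩ʳ zero) ⟩
      ∑[ c < M ] ∑words n (λ v → Φ (insertAt v (π ⟨$⟩ʳ zero) (toℕ c) ∘ (π ⟨$⟩ʳ_)))
        ≈⟨ sum-cong-≋ {M} (λ c → ∑words-cong n (λ v → ext (insertAt-permute π v (toℕ c)))) ⟩
      ∑[ c < M ] ∑words n (λ v → Φ (toℕ c Vector.∷ (v ∘ (Perm.remove zero π ⟨$⟩ʳ_))))
        ≈⟨ sum-cong-≋ {M} (λ c → ∑words-permute _ (ext ∘ ∷-cong (toℕ c)) (Perm.remove zero π)) ⟩
      ∑words (suc n) Φ ∎

-- Every word has exactly one standardization

-- σ numbers the letters of a in decreasing order, equal letters from left to right.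
Standardizes : ∀ {n} → Permutation′ n → Vector ℕ n → Set
Standardizes σ a = ∀ s t → s Fin.< t → (σ ⟨$⟩ʳ s Fin.< σ ⟨$⟩ʳ t) ⇔ (a t ℕ.≤ a s)

standardizes? : ∀ {n} (σ : Permutation′ n) a → Dec (Standardizes σ a)
standardizes? σ a = Finₚ.all? λ s → Finₚ.all? λ t →
  (s Finₚ.<? t) →-dec ((_ Finₚ.<? _) ⇔? (_ ℕₚ.≤? _))

standardizes⇒≤ : ∀ {n} (σ : Permutation′ n) {a} → Standardizes σ a →
  ∀ s t → σ ⟨$⟩ʳ s Fin.< σ ⟨$⟩ʳ t → a t ℕ.≤ a s
standardizes⇒≤ σ std s t σs<σt with Finₚ.<-cmp s t
... | tri< s<t _ _    = to (std s t s<t) σs<σt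
... | tri≈ _ ≡.refl _ = contradiction σs<σt (ℕₚ.<-irrefl ≡.refl)
... | tri> _ _ t<s    = ℕₚ.<⇒≤ (ℕₚ.≰⇒> λ as≤at → ℕₚ.<-asym σs<σt (from (std t s t<s) as≤at))

standardizes⇒< : ∀ {n} (σ : Permutation′ n) {a} → Standardizes σ a →
  ∀ s t → σ ⟨$⟩ʳ s Fin.< σ ⟨$⟩ʳ t → t Fin.< s → a t ℕ.< a s
standardizes⇒< σ std s t σs<σt t<s =
  ℕₚ.≰⇒> λ as≤at → ℕₚ.<-asym σs<σt (from (std t s t<s) as≤at)

-- For an upward closed `P` exactly one such `j` exists, namely the number of elements failing `P`.
-- It can be as large as `n`, hence the type `Fin (suc n)`.
IsThreshold : ∀ {n} → (Fin n → Set) → Fin (suc n) → Set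
IsThreshold P j = ∀ x → (toℕ j ℕ.≤ toℕ x) ⇔ P x

isThreshold? : ∀ {n} {P : Fin n → Set} → Decidable P → ∀ j → Dec (IsThreshold P j)
isThreshold? P? j = Finₚ.all? λ x → (_ ℕₚ.≤? _) ⇔? P? x

j<punchIn⇔j≤ : ∀ {n} (j : Fin (suc n)) x → (j Fin.< punchIn j x) ⇔ (toℕ j ℕ.≤ toℕ x)
j<punchIn⇔j≤ zero    x       = mk⇔ (λ _ → z≤n) (λ _ → s≤s z≤n)
j<punchIn⇔j≤ (suc j) zero    = mk⇔ (λ ()) (λ ())
j<punchIn⇔j≤ (suc j) (suc x) =
  mk⇔ (λ { (s≤s p) → s≤s (to (j<punchIn⇔j≤ j x) p) })
      (λ { (s≤s p) → s≤s (from (j<punchIn⇔j≤ j x) p) })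

punchIn-<⇔< : ∀ {n} (j : Fin (suc n)) x y → (punchIn j x Fin.< punchIn j y) ⇔ (x Fin.< y)
punchIn-<⇔< j x y = mk⇔
  (λ p → ℕₚ.≰⇒> (λ y≤x → ℕₚ.<⇒≱ p (Finₚ.punchIn-mono-≤ j y x y≤x)))
  (λ p → ℕₚ.≰⇒> (λ y≤x → ℕₚ.<⇒≱ p (Finₚ.punchIn-cancel-≤ j y x y≤x)))

module _ {n} (j : Fin (suc n)) (π : Permutation′ n) (a : Vector ℕ (suc n)) where

  -- Here `x` is a label given by `π` to a letter of the tail. Larger letters get smaller labels,
  -- and the first letter precedes its equals, so its label `j` must come right before the labels of
  -- all letters that do not exceed it.
  NotExceeding : Fin n → Set
  NotExceeding x = tail a (π ⟨$⟩ˡ x) ℕ.≤ a zero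

  notExceeding? : Decidable NotExceeding
  notExceeding? x = _ ℕₚ.≤? _

  standardizes-insert⁻ : Standardizes (insert zero j π) a →
    Standardizes π (tail a) × IsThreshold NotExceeding j
  standardizes-insert⁻ std = std-tail , threshold
    where
    std-tail : Standardizes π (tail a)
    std-tail s t s<t = mk⇔
      (to (std (suc s) (suc t) (s≤s s<t)) ∘ from (punchIn-<⇔< j _ _))
      (to (punchIn-<⇔< j _ _) ∘ from (std (suc s) (suc t) (s≤s s<t)))

    at : ∀ t → (toℕ j ℕ.≤ toℕ (π ⟨$⟩ʳ t)) ⇔ (tail a t ℕ.≤ a zero)
    at t = mk⇔
      (to (std zero (suc t) (s≤s z≤n)) ∘ from (j<punchIn⇔j≤ j _))
      (to (j<punchIn⇔j≤ j _) ∘ from (std zero (suc t) (s≤s z≤n)))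

    threshold : IsThreshold NotExceeding j
    threshold x = ≡.subst (λ y → (toℕ j ℕ.≤ toℕ y) ⇔ NotExceeding x)
                          (Perm.inverseʳ π) (at (π ⟨$⟩ˡ x))

  standardizes-insert⁺ : Standardizes π (tail a) → IsThreshold NotExceeding j →
    Standardizes (insert zero j π) a
  standardizes-insert⁺ std thr zero (suc t) _ = mk⇔
    (≡.subst (λ s → tail a s ℕ.≤ a zero) (Perm.inverseˡ π) ∘ to (thr (π ⟨$⟩ʳ t)) ∘ to (j<punchIn⇔j≤ j _))
    (from (j<punchIn⇔j≤ j _) ∘ from (thr (π ⟨$⟩ʳ t)) ∘ ≡.subst (λ s → tail a s ℕ.≤ a zero) (≡.sym (Perm.inverseˡ π)))
  standardizes-insert⁺ std thr (suc s) (suc t) (s≤s s<t) = mk⇔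
    (to (std s t s<t) ∘ to (punchIn-<⇔< j _ _))
    (from (punchIn-<⇔< j _ _) ∘ from (std s t s<t))

  notExceeding-mono : Standardizes π (tail a) →
    ∀ {x y} → x Fin.< y → NotExceeding x → NotExceeding y
  notExceeding-mono std {x} {y} x<y = ℕₚ.≤-trans
    (standardizes⇒≤ π std (π ⟨$⟩ˡ x) (π ⟨$⟩ˡ y)
      (≡.subst₂ Fin._<_ (≡.sym (Perm.inverseʳ π)) (≡.sym (Perm.inverseʳ π)) x<y))

module StandardizationCount {c ℓ} (R : CommutativeRing c ℓ) where
  open CommutativeRing R hiding (zero)
  open FiniteSums R
  open SetoidReasoning setoid

  threshold-unique : ∀ {n} {P : Fin n → Set} (P? : Decidable P) →
    (∀ {x y} → x Fin.< y → P x → P y) →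
    ∑[ j < suc n ] ι (isThreshold? P? j) ≈ 1#
  threshold-unique {zero}  P? mono =
    trans (+-identityʳ _) (ι-yes (isThreshold? P? zero) (λ ()))
  threshold-unique {suc n} {P} P? mono = byCases (P? zero)
    where
    byCases : Dec (P zero) → ∑[ j < suc (suc n) ] ι (isThreshold? P? j) ≈ 1#
    byCases (yes p₀) = begin
      ι (isThreshold? P? zero) + ∑[ j < suc n ] ι (isThreshold? P? (suc j))
        ≈⟨ +-cong (ι-yes (isThreshold? P? zero) (λ x → mk⇔ (λ _ → all-P x) (λ _ → z≤n)))
                  (sum-cong-≋ {suc n} (λ j → ι-no (isThreshold? P? (suc j)) (λ thr → ℕₚ.≤⇒≯ (from (thr zero) p₀) (s≤s z≤n)))) ⟩
      1# + ∑[ j < suc n ] 0#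
        ≈⟨ +-congˡ (sum-replicate-zero (suc n)) ⟩
      1# + 0#
        ≈⟨ +-identityʳ 1# ⟩
      1# ∎
      where
      all-P : ∀ x → P x
      all-P zero    = p₀
      all-P (suc x) = mono {zero} {suc x} (s≤s z≤n) p₀
    byCases (no ¬p₀) = begin
      ι (isThreshold? P? zero) + ∑[ j < suc n ] ι (isThreshold? P? (suc j))
        ≈⟨ +-cong (ι-no (isThreshold? P? zero) (λ thr → ¬p₀ (to (thr zero) z≤n)))
                  (sum-cong-≋ {suc n} (λ j → ι-cong (isThreshold? P? (suc j)) (isThreshold? (P? ∘ suc) j) (down j) (up j))) ⟩
      0# + ∑[ j < suc n ] ι (isThreshold? (P? ∘ suc) j)
        ≈⟨ +-identityˡ _ ⟩
      ∑[ j < suc n ] ι (isThreshold? (P? ∘ suc) j)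
        ≈⟨ threshold-unique (P? ∘ suc) (λ x<y → mono (s≤s x<y)) ⟩
      1# ∎
      where
      down : ∀ j → IsThreshold P (suc j) → IsThreshold (P ∘ suc) j
      down j thr x = mk⇔ (to (thr (suc x)) ∘ s≤s) (ℕₚ.≤-pred ∘ from (thr (suc x)))

      up : ∀ j → IsThreshold (P ∘ suc) j → IsThreshold P (suc j)
      up j thr zero    = mk⇔ (λ ()) (λ p₀ → contradiction p₀ ¬p₀)
      up j thr (suc x) = mk⇔ (to (thr x) ∘ ℕₚ.≤-pred) (s≤s ∘ from (thr x))

  -- A permutation amounts to the label `j` of the first letter and the permutation `π` of the
  -- others. Standardizing `a` forces `π` to standardize the tail, and then `j` is the unique
  -- threshold. The resulting partition of unity splits sums over words by permutations.
  standardization-unique : ∀ {n} (a : Vector ℕ n) →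
    ∑∈ (permutations n) (λ σ → ι (standardizes? σ a)) ≈ 1#
  standardization-unique {zero} a = trans (+-identityʳ _) (ι-yes (standardizes? Perm.id a) (λ ()))
  standardization-unique {suc n} a = begin
    ∑∈ (permutations (suc n)) (λ σ → ι (standardizes? σ a))
      ≈⟨ ∑∈-cartesianProductWith (insert zero) (allFin (suc n)) (permutations n) _ ⟩
    ∑∈ (allFin (suc n)) (λ j → ∑∈ (permutations n) (λ π → ι (standardizes? (insert zero j π) a)))
      ≈⟨ ∑∈-tabulate {n = suc n} id _ ⟩
    ∑[ j < suc n ] ∑∈ (permutations n) (λ π → ι (standardizes? (insert zero j π) a))
      ≈⟨ ∑∈-∑-comm (permutations n) {suc n} (λ π j → ι (standardizes? (insert zero j π) a)) ⟨
    ∑∈ (permutations n) (λ π → ∑[ j < suc n ] ι (standardizes? (insert zero j π) a))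
      ≈⟨ ∑∈-cong (permutations n) (λ π → begin
         ∑[ j < suc n ] ι (standardizes? (insert zero j π) a)
           ≈⟨ sum-cong-≋ {suc n} (λ j → ι-split (standardizes? (insert zero j π) a) (standardizes? π (tail a))
                (isThreshold? (notExceeding? j π a) j)
                (standardizes-insert⁻ j π a) (standardizes-insert⁺ j π a)) ⟩
         ∑[ j < suc n ] (ι (standardizes? π (tail a)) * ι (isThreshold? (notExceeding? j π a) j))
           ≈⟨ *-distribˡ-sum {suc n} _ (λ j → ι (isThreshold? (notExceeding? j π a) j)) ⟨
         ι (standardizes? π (tail a)) * ∑[ j < suc n ] ι (isThreshold? (notExceeding? j π a) j)
           ≈⟨ ι-*-cong (standardizes? π (tail a)) (λ std → threshold-unique (notExceeding? zero π a)
                 (notExceeding-mono zero π a std)) ⟩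
         ι (standardizes? π (tail a)) * 1#
           ≈⟨ *-identityʳ _ ⟩
         ι (standardizes? π (tail a)) ∎) ⟩
    ∑∈ (permutations n) (λ π → ι (standardizes? π (tail a)))
      ≈⟨ standardization-unique (tail a) ⟩
    1# ∎

-- Standardization as a chain condition

adjacent⇒all : ∀ {m} (_∼_ : Rel (Fin (suc m)) 0ℓ) → Transitive _∼_ →
  (∀ i → inject₁ i ∼ suc i) → ∀ u v → u Fin.< v → u ∼ v
adjacent⇒all {suc m} _∼_ ∼-trans adj zero    (suc zero)    _         = adj zero
adjacent⇒all {suc m} _∼_ ∼-trans adj zero    (suc (suc v)) _         = ∼-trans (adj zero)
  (adjacent⇒all (λ x y → suc x ∼ suc y) ∼-trans (adj ∘ suc) zero (suc v) (s≤s z≤n))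
adjacent⇒all {suc m} _∼_ ∼-trans adj (suc u) (suc v)       (s≤s u<v) =
  adjacent⇒all (λ x y → suc x ∼ suc y) ∼-trans (adj ∘ suc) u v u<v

opposite-inject₁ : ∀ {m} (i : Fin m) → opposite (inject₁ i) ≡ suc (opposite i)
opposite-inject₁ zero    = ≡.refl
opposite-inject₁ (suc i) = ≡.cong inject₁ (opposite-inject₁ i)

-- Gaps `0` and `1` ask for a weak and a strict increase, so that both kinds of inequality are
-- enumerated at once.
Chain : ∀ {m} → Vector ℕ m → Vector ℕ (suc m) → Set
Chain ε c = ∀ i → c (inject₁ i) ℕ.+ ε i ℕ.≤ c (suc i)

chain? : ∀ {m} (ε : Vector ℕ m) c → Dec (Chain ε c)
chain? ε c = Finₚ.all? λ i → _ ℕₚ.≤? _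

descent : ∀ {m} → Permutation′ (suc m) → Vector ℕ m
descent ρ i = if does (isDescent? ρ i) then 1 else 0

descent-yes : ∀ {m} (ρ : Permutation′ (suc m)) {i} → IsDescent ρ i → descent ρ i ≡ 1
descent-yes ρ {i} d = ≡.cong (if_then 1 else 0) (dec-true (isDescent? ρ i) d)

descent-no : ∀ {m} (ρ : Permutation′ (suc m)) {i} → ¬ IsDescent ρ i → descent ρ i ≡ 0
descent-no ρ {i} ¬d = ≡.cong (if_then 1 else 0) (dec-false (isDescent? ρ i) ¬d)

-- Position i holds the letter with number n − 1 − i, so that the letters appear in increasing order.
decreasingLabels : ∀ {n} → Permutation′ n → Permutation′ n
decreasingLabels σ = Perm.reverse ∘ₚ flip σ

module _ {m} (σ : Permutation′ (suc m)) (a : Vector ℕ (suc m)) where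

  private
    σ⁻¹ : Fin (suc m) → Fin (suc m)
    σ⁻¹ u = σ ⟨$⟩ˡ u

    GapAt : Fin m → Set
    GapAt u = a (σ⁻¹ (suc u)) ℕ.+ descent (flip σ) u ℕ.≤ a (σ⁻¹ (inject₁ u))

    -- The order in which labels are given out: larger letters first, equal letters from left to
    -- right. Being transitive, it passes from consecutive labels to all pairs.
    _≺_ : Rel (Fin (suc m)) 0ℓ
    u ≺ v = a (σ⁻¹ v) ℕ.< a (σ⁻¹ u) ⊎ (a (σ⁻¹ v) ≡ a (σ⁻¹ u) × σ⁻¹ u Fin.< σ⁻¹ v)

    ≺-trans : Transitive _≺_
    ≺-trans (inj₁ p)       (inj₁ r)       = inj₁ (ℕₚ.<-trans r p)
    ≺-trans (inj₁ p)       (inj₂ (e , _)) = inj₁ (ℕₚ.≤-<-trans (ℕₚ.≤-reflexive e) p)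
    ≺-trans (inj₂ (e , _)) (inj₁ r)       = inj₁ (ℕₚ.<-≤-trans r (ℕₚ.≤-reflexive e))
    ≺-trans (inj₂ (e , p)) (inj₂ (f , r)) = inj₂ (≡.trans f e , ℕₚ.<-trans p r)

  private
    labels< : ∀ u → σ ⟨$⟩ʳ σ⁻¹ (inject₁ u) Fin.< σ ⟨$⟩ʳ σ⁻¹ (suc u)
    labels< u = ≡.subst₂ Fin._<_ (≡.sym (Perm.inverseʳ σ)) (≡.sym (Perm.inverseʳ σ))
                         (s≤s (ℕₚ.≤-reflexive (Finₚ.toℕ-inject₁ u)))

    -- A descent of σ⁻¹ at `u` says that the letter with the next label stands further left. Equal
    -- letters are labelled from left to right, so the inequality is strict exactly there. This is
    -- how the descents of the inverse enter.
    standardizes⇒gap : Standardizes σ a → ∀ u → GapAt u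
    standardizes⇒gap std u with isDescent? (flip σ) u
    ... | yes d rewrite descent-yes (flip σ) d | ℕₚ.+-comm (a (σ⁻¹ (suc u))) 1 =
      standardizes⇒< σ std _ _ (labels< u) d
    ... | no ¬d rewrite descent-no (flip σ) ¬d | ℕₚ.+-identityʳ (a (σ⁻¹ (suc u))) =
      standardizes⇒≤ σ std _ _ (labels< u)

    gap⇒≺ : ∀ u → GapAt u → inject₁ u ≺ suc u
    gap⇒≺ u gap with isDescent? (flip σ) u
    ... | yes d rewrite descent-yes (flip σ) d | ℕₚ.+-comm (a (σ⁻¹ (suc u))) 1 = inj₁ gap
    ... | no ¬d rewrite descent-no (flip σ) ¬d | ℕₚ.+-identityʳ (a (σ⁻¹ (suc u)))
          with ℕₚ.m≤n⇒m<n∨m≡n gap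
    ...   | inj₁ lt = inj₁ lt
    -- The absence of a descent orders the positions only weakly; the order is strict because
    -- different labels sit at different positions.
    ...   | inj₂ eq = inj₂ (eq , ℕₚ.≤∧≢⇒< (ℕₚ.≮⇒≥ ¬d) λ e →
              ℕₚ.<-irrefl (≡.cong (λ s → toℕ (σ ⟨$⟩ʳ s)) (Finₚ.toℕ-injective e)) (labels< u))

    ≺⇒standardizes : (∀ u v → u Fin.< v → u ≺ v) → Standardizes σ a
    ≺⇒standardizes ordered s t s<t with Finₚ.<-cmp (σ ⟨$⟩ʳ s) (σ ⟨$⟩ʳ t)
    ... | tri< lt _ _ = mk⇔ (λ _ → weakly (ordered _ _ lt)) (λ _ → lt)
      where
      weakly : (σ ⟨$⟩ʳ s) ≺ (σ ⟨$⟩ʳ t) → a t ℕ.≤ a s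
      weakly (inj₁ p)       = ≡.subst₂ (λ x y → a x ℕ.≤ a y) (Perm.inverseˡ σ) (Perm.inverseˡ σ) (ℕₚ.<⇒≤ p)
      weakly (inj₂ (e , _)) = ≡.subst₂ (λ x y → a x ℕ.≤ a y) (Perm.inverseˡ σ) (Perm.inverseˡ σ) (ℕₚ.≤-reflexive e)
    ... | tri≈ _ e _ = contradiction s<t (ℕₚ.<-irrefl (≡.cong toℕ
            (≡.trans (≡.sym (Perm.inverseˡ σ)) (≡.trans (≡.cong σ⁻¹ e) (Perm.inverseˡ σ)))))
    ... | tri> ≮ _ gt = mk⇔ (λ lt → contradiction lt ≮) (λ at≤as → contradiction at≤as (strictly (ordered _ _ gt)))
      where
      strictly : (σ ⟨$⟩ʳ t) ≺ (σ ⟨$⟩ʳ s) → ¬ (a t ℕ.≤ a s)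
      strictly (inj₁ p)       = ℕₚ.<⇒≱ (≡.subst₂ (λ x y → a x ℕ.< a y) (Perm.inverseˡ σ) (Perm.inverseˡ σ) p)
      strictly (inj₂ (_ , p)) = contradiction
        (≡.subst₂ Fin._<_ (Perm.inverseˡ σ) (Perm.inverseˡ σ) p) (ℕₚ.<-asym s<t)

  standardizes⇒chain : Standardizes σ a →
    Chain (descent (flip σ) ∘ opposite) (a ∘ (decreasingLabels σ ⟨$⟩ʳ_))
  standardizes⇒chain std i =
    ≡.subst (λ u → a (σ⁻¹ u) ℕ.+ descent (flip σ) (opposite i) ℕ.≤ a (σ⁻¹ (inject₁ (opposite i))))
          (≡.sym (opposite-inject₁ i)) (standardizes⇒gap std (opposite i))

  chain⇒standardizes :
    Chain (descent (flip σ) ∘ opposite) (a ∘ (decreasingLabels σ ⟨$⟩ʳ_)) → Standardizes σ a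
  chain⇒standardizes chain = ≺⇒standardizes (adjacent⇒all _≺_ ≺-trans λ u → gap⇒≺ u
    (≡.subst GapAt (Finₚ.opposite-involutive u)
      (≡.subst (λ v → a (σ⁻¹ v) ℕ.+ descent (flip σ) (opposite (opposite u))
                      ℕ.≤ a (σ⁻¹ (inject₁ (opposite (opposite u)))))
             (opposite-inject₁ (opposite u)) (chain (opposite u)))))

-- Major index, descents and alternation read off from words

module ℕSum = MonoidSums ℕₚ.+-0-commutativeMonoid

total : ∀ {n} → Vector ℕ n → ℕ
total = ℕSum.sum

-- The total of the least chain starting at 0: the gap `ε i` lifts each of the `m ∸ toℕ i` letters
-- after it.
chainWeight : ∀ {m} → Vector ℕ m → ℕ
chainWeight {m} ε = total λ i → ε i ℕ.* (m ∸ toℕ i)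

sum-filter-tabulate : ∀ {A : Set} {n} {P : A → Set} (P? : Decidable P) (f : A → ℕ) (g : Fin n → A) →
  ℕL.sum (map f (filter P? (tabulate g))) ≡
  total λ i → (if does (P? (g i)) then 1 else 0) ℕ.* f (g i)
sum-filter-tabulate {n = zero}  P? f g = ≡.refl
sum-filter-tabulate {n = suc n} P? f g with P? (g zero)
... | yes _ = ≡.cong₂ ℕ._+_ (≡.sym (ℕₚ.+-identityʳ _)) (sum-filter-tabulate P? f (g ∘ suc))
... | no  _ = sum-filter-tabulate P? f (g ∘ suc)

-- Reversing the index turns the number of letters lifted by a gap into the position of the descent,
-- counted from 1.
chainWeight-descent : ∀ {m} (ρ : Permutation′ (suc m)) → chainWeight (descent ρ ∘ opposite) ≡ maj ρ
chainWeight-descent {m} ρ = begin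
  total (λ i → descent ρ (opposite i) ℕ.* (m ∸ toℕ i))
    ≡⟨ ℕSum.sum-permute (λ i → descent ρ (opposite i) ℕ.* (m ∸ toℕ i)) Perm.reverse ⟩
  total (λ i → descent ρ (opposite (opposite i)) ℕ.* (m ∸ toℕ (opposite i)))
    ≡⟨ ℕSum.sum-cong-≗ {m} (λ i → ≡.cong₂ ℕ._*_ (≡.cong (descent ρ) (Finₚ.opposite-involutive i))
         (≡.trans (≡.cong (m ∸_) (Finₚ.opposite-prop i)) (ℕₚ.m∸[m∸n]≡n (Finₚ.toℕ<n i)))) ⟩
  total (λ i → descent ρ i ℕ.* position i)
    ≡⟨ sum-filter-tabulate (isDescent? ρ) position id ⟨
  maj ρ ∎
  where open ≡.≡-Reasoning

module _ {m} (σ : Permutation′ (suc m)) (a : Vector ℕ (suc m)) (std : Standardizes σ a) where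

  -- Labels run against the size of the letters. Hence alternating permutations, which begin with a
  -- descent, belong to words that begin with a strict rise.
  descent⇔rise : ∀ i → IsDescent σ i ⇔ (a (inject₁ i) ℕ.< a (suc i))
  descent⇔rise i = mk⇔
    (λ d → ℕₚ.≰⇒> λ le → ℕₚ.<-asym d (from (std _ _ i<i+1) le))
    (λ r → rise⇒descent r (Finₚ.<-cmp (σ ⟨$⟩ʳ inject₁ i) (σ ⟨$⟩ʳ suc i)))
    where
    i<i+1 : inject₁ i Fin.< suc i
    i<i+1 = s≤s (ℕₚ.≤-reflexive (Finₚ.toℕ-inject₁ i))

    rise⇒descent : a (inject₁ i) ℕ.< a (suc i) → _ → IsDescent σ i
    rise⇒descent r (tri< lt _ _) = contradiction (to (std _ _ i<i+1) lt) (ℕₚ.<⇒≱ r)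
    rise⇒descent r (tri≈ _ e _)  = contradiction i<i+1 (ℕₚ.<-irrefl (≡.cong toℕ
      (≡.trans (≡.sym (Perm.inverseˡ σ)) (≡.trans (≡.cong (σ ⟨$⟩ˡ_) e) (Perm.inverseˡ σ)))))
    rise⇒descent r (tri> _ _ gt) = gt

turn : Bool → ℕ → Bool
turn b zero    = b
turn b (suc k) = turn (not b) k

turn⇔odd : ∀ k → (turn true k ≡ true) ⇔ (¬ 2 ∣ suc k)
turn⇔odd zero          = mk⇔ (λ { _ (divides zero ()) ; _ (divides (suc _) ()) }) (λ _ → ≡.refl)
turn⇔odd (suc zero)    = mk⇔ (λ ()) (λ ¬2∣2 → contradiction ∣-refl ¬2∣2)
turn⇔odd (suc (suc k)) = mk⇔
  (λ t 2∣ → to (turn⇔odd k) t (∣m+n∣m⇒∣n 2∣ ∣-refl))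
  (λ ¬2∣ → from (turn⇔odd k) (λ 2∣ → ¬2∣ (∣m∣n⇒∣m+n ∣-refl 2∣)))

-- As an equivalence this prescribes either `∼` or its failure at each position. The start `b` is a
-- parameter because the tail of such a word starts with the opposite demand.
Alternates : ∀ {m} → Rel ℕ 0ℓ → Bool → Vector ℕ (suc m) → Set
Alternates _∼_ b a = ∀ i → (a (inject₁ i) ∼ a (suc i)) ⇔ (turn b (toℕ i) ≡ true)

alternates? : ∀ {m} {_∼_ : Rel ℕ 0ℓ} → (∀ x y → Dec (x ∼ y)) → ∀ b (a : Vector ℕ (suc m)) →
  Dec (Alternates _∼_ b a)
alternates? ∼? b a = Finₚ.all? λ i → ∼? _ _ ⇔? (_ Boolₚ.≟ _)

module _ {m} (σ : Permutation′ (suc m)) (a : Vector ℕ (suc m)) (std : Standardizes σ a) where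

  isAlternating⇔ : IsAlternating σ ⇔ Alternates ℕ._<_ true a
  isAlternating⇔ = mk⇔
    (λ alt i → mk⇔ (from (turn⇔odd (toℕ i)) ∘ to (alt i) ∘ from (descent⇔rise σ a std i))
                   (to (descent⇔rise σ a std i) ∘ from (alt i) ∘ to (turn⇔odd (toℕ i))))
    (λ alt i → mk⇔ (to (turn⇔odd (toℕ i)) ∘ to (alt i) ∘ to (descent⇔rise σ a std i))
                   (from (descent⇔rise σ a std i) ∘ from (alt i) ∘ from (turn⇔odd (toℕ i))))

  -- Descents at exactly the even positions mean strict rises there and `≥` at the odd positions,
  -- the first of which is position 1.
  isReverseAlternating⇔ : IsReverseAlternating σ ⇔ Alternates ℕ._≥_ true a
  isReverseAlternating⇔ = mk⇔
    (λ alt i → mk⇔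
      (λ ge → from (turn⇔odd (toℕ i)) λ even → ℕₚ.<⇒≱ (to (descent⇔rise σ a std i) (from (alt i) even)) ge)
      (λ t → ℕₚ.≮⇒≥ λ lt → to (turn⇔odd (toℕ i)) t (to (alt i) (from (descent⇔rise σ a std i) lt))))
    (λ alt i → mk⇔
      (λ d → decidable-stable (2 ∣? position i) λ odd →
         ℕₚ.<⇒≱ (to (descent⇔rise σ a std i) d) (from (alt i) (from (turn⇔odd (toℕ i)) odd)))
      (λ even → from (descent⇔rise σ a std i) (ℕₚ.≰⇒> λ ge →
         to (turn⇔odd (toℕ i)) (to (alt i) ge) even)))

-- Geometric series and the enumeration of chains modulo q^M

module ℕSolver = NatSolver.+-*-Solver

-- The triangular number k(k-1)/2, the least total of a strictly increasing word of length k.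
tri : ℕ → ℕ
tri zero    = 0
tri (suc k) = k ℕ.+ tri k

-- Doubling by two successors, so that one step in n unfolds to two letters of a word or two steps
-- of a path.
double : ℕ → ℕ
double zero    = 0
double (suc n) = suc (suc (double n))

-- The properties of ℤ[q]/(q^M) on which all enumerations rest, with `pw n` in the role of q^n. The
-- vanishing from `M` on turns finite geometric sums into true inverses.
record TruncatedPowers : Set₁ where
  field
    commutativeRing : CommutativeRing 0ℓ 0ℓ

  open CommutativeRing commutativeRing public hiding (zero)

  field
    M    : ℕ
    pw   : ℕ → Carrier
    pw-0 : pw 0 ≈ 1#
    pw-+ : ∀ m n → pw (m ℕ.+ n) ≈ pw m * pw n
    pw-M : ∀ n → M ℕ.≤ n → pw n ≈ 0#

module Powers (T : TruncatedPowers) where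
  open TruncatedPowers T public
  open FiniteSums commutativeRing public
  open Words M public
  open IntegerCoefficients commutativeRing public using (solve; con; _:=_; _:+_; _:*_; _:-_; :-_)
  open SetoidReasoning setoid

  -- The truncated geometric series, which is 1/(1 - q^e) for e > 0.
  inv : ℕ → Carrier
  inv e = ∑[ c < M ] pw (toℕ c ℕ.* e)

  -- The maximum accounts for the empty range: for N ≤ L the two powers coincide and cancel.
  telescope : ∀ e L N →
    (1# - pw e) * ∑[ c < N ] (ι (L ℕₚ.≤? toℕ c) * pw (toℕ c ℕ.* e)) ≈ pw (L ℕ.* e) - pw ((L ⊔ N) ℕ.* e)
  telescope e L zero = begin
    (1# - pw e) * 0#                          ≈⟨ zeroʳ _ ⟩
    0#                                        ≈⟨ -‿inverseʳ _ ⟨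
    pw (L ℕ.* e) - pw (L ℕ.* e)               ≡⟨ ≡.cong (λ K → pw (L ℕ.* e) - pw (K ℕ.* e)) (ℕₚ.⊔-identityʳ L) ⟨
    pw (L ℕ.* e) - pw ((L ⊔ 0) ℕ.* e)         ∎
  telescope e L (suc N) = begin
    (1# - pw e) * ∑[ c < suc N ] term (toℕ c)
      ≈⟨ *-congˡ (sum-init-last {N} (λ c → term (toℕ c))) ⟩
    (1# - pw e) * (∑[ c < N ] term (toℕ (inject₁ c)) + term (toℕ (Fin.fromℕ N)))
      ≡⟨ ≡.cong₂ (λ x y → (1# - pw e) * (x + y)) (sum-cong-≗ {N} (λ c → ≡.cong term (Finₚ.toℕ-inject₁ c)))
                 (≡.cong term (Finₚ.toℕ-fromℕ N)) ⟩
    (1# - pw e) * (∑[ c < N ] term (toℕ c) + term N)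
      ≈⟨ distribˡ _ _ _ ⟩
    (1# - pw e) * ∑[ c < N ] term (toℕ c) + (1# - pw e) * term N
      ≈⟨ +-cong (telescope e L N) (last-term (L ℕₚ.≤? N)) ⟩
    (pw (L ℕ.* e) - pw ((L ⊔ N) ℕ.* e)) + (pw ((L ⊔ N) ℕ.* e) - pw ((L ⊔ suc N) ℕ.* e))
      ≈⟨ solve 3 (λ x y z → (x :- y) :+ (y :- z) := x :- z) refl _ _ _ ⟩
    pw (L ℕ.* e) - pw ((L ⊔ suc N) ℕ.* e) ∎
    where
    term : ℕ → Carrier
    term c = ι (L ℕₚ.≤? c) * pw (c ℕ.* e)

    last-term : Dec (L ℕ.≤ N) →
      (1# - pw e) * term N ≈ pw ((L ⊔ N) ℕ.* e) - pw ((L ⊔ suc N) ℕ.* e)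
    last-term (yes L≤N) = begin
      (1# - pw e) * (ι (L ℕₚ.≤? N) * pw (N ℕ.* e))
        ≈⟨ *-congˡ (trans (*-congʳ (ι-yes (L ℕₚ.≤? N) L≤N)) (*-identityˡ _)) ⟩
      (1# - pw e) * pw (N ℕ.* e)
        ≈⟨ solve 2 (λ x y → (con 1ℤ :- x) :* y := y :- x :* y) refl (pw e) _ ⟩
      pw (N ℕ.* e) - pw e * pw (N ℕ.* e)
        ≈⟨ +-congˡ (-‿cong (pw-+ e (N ℕ.* e))) ⟨
      pw (N ℕ.* e) - pw (suc N ℕ.* e)
        ≡⟨ ≡.cong₂ (λ x y → pw (x ℕ.* e) - pw (y ℕ.* e)) (ℕₚ.m≤n⇒m⊔n≡n L≤N) (ℕₚ.m≤n⇒m⊔n≡n (ℕₚ.m≤n⇒m≤1+n L≤N)) ⟨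
      pw ((L ⊔ N) ℕ.* e) - pw ((L ⊔ suc N) ℕ.* e) ∎
    last-term (no L≰N) = begin
      (1# - pw e) * (ι (L ℕₚ.≤? N) * pw (N ℕ.* e))
        ≈⟨ *-congˡ (trans (*-congʳ (ι-no (L ℕₚ.≤? N) L≰N)) (zeroˡ _)) ⟩
      (1# - pw e) * 0#
        ≈⟨ zeroʳ _ ⟩
      0#
        ≈⟨ -‿inverseʳ _ ⟨
      pw (L ℕ.* e) - pw (L ℕ.* e)
        ≡⟨ ≡.cong₂ (λ x y → pw (x ℕ.* e) - pw (y ℕ.* e)) (ℕₚ.m≥n⇒m⊔n≡m (ℕₚ.<⇒≤ (ℕₚ.≰⇒> L≰N))) (ℕₚ.m≥n⇒m⊔n≡m (ℕₚ.≰⇒> L≰N)) ⟨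
      pw ((L ⊔ N) ℕ.* e) - pw ((L ⊔ suc N) ℕ.* e) ∎

  telescope-M : ∀ e L →
    (1# - pw (suc e)) * ∑[ c < M ] (ι (L ℕₚ.≤? toℕ c) * pw (toℕ c ℕ.* suc e)) ≈ pw (L ℕ.* suc e)
  telescope-M e L = begin
    _ ≈⟨ telescope (suc e) L M ⟩
    pw (L ℕ.* suc e) - pw ((L ⊔ M) ℕ.* suc e)
      ≈⟨ +-congˡ (-‿cong (pw-M _ (ℕₚ.≤-trans (ℕₚ.m≤n⊔m L M) (ℕₚ.m≤m*n (L ⊔ M) (suc e))))) ⟩
    pw (L ℕ.* suc e) - 0#
      ≈⟨ solve 1 (λ x → x :- con 0ℤ := x) refl _ ⟩
    pw (L ℕ.* suc e) ∎

  inv-inverse : ∀ e → (1# - pw (suc e)) * inv (suc e) ≈ 1#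
  inv-inverse e = begin
    (1# - pw (suc e)) * inv (suc e)
      ≈⟨ *-congˡ (sum-cong-≋ {M} (λ c → sym (trans (*-congʳ (ι-yes (0 ℕₚ.≤? toℕ c) z≤n)) (*-identityˡ _)))) ⟩
    (1# - pw (suc e)) * ∑[ c < M ] (ι (0 ℕₚ.≤? toℕ c) * pw (toℕ c ℕ.* suc e))
      ≈⟨ telescope-M e 0 ⟩
    pw 0
      ≈⟨ pw-0 ⟩
    1# ∎

  geometric : ∀ e L →
    ∑[ c < M ] (ι (L ℕₚ.≤? toℕ c) * pw (toℕ c ℕ.* suc e)) ≈ pw (L ℕ.* suc e) * inv (suc e)
  geometric e L = begin
    s                                              ≈⟨ *-identityˡ s ⟨
    1# * s                                         ≈⟨ *-congʳ (inv-inverse e) ⟨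
    (1# - pw (suc e)) * inv (suc e) * s            ≈⟨ solve 3 (λ x y z → x :* y :* z := x :* z :* y) refl _ _ _ ⟩
    (1# - pw (suc e)) * s * inv (suc e)            ≈⟨ *-congʳ (telescope-M e L) ⟩
    pw (L ℕ.* suc e) * inv (suc e)                 ∎
    where
    s = ∑[ c < M ] (ι (L ℕₚ.≤? toℕ c) * pw (toℕ c ℕ.* suc e))

  -- The inverse of (q;q)ₙ.
  invPoch : ℕ → Carrier
  invPoch zero    = 1#
  invPoch (suc n) = invPoch n * inv (suc n)

  chainTerm : ∀ {m} → Vector ℕ m → Vector ℕ (suc m) → Carrier
  chainTerm ε c = ι (chain? ε c) * pw (total c)

  -- The lower bound `L` on the first letter makes the induction go through: behind a first letter
  -- `c` stands a chain bounded below by `c + ε zero`. Raising the first letter raises all of them,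
  -- so the sum over it is geometric with the number of letters as exponent.
  chain-sum-from : ∀ {m} (ε : Vector ℕ m) L →
    ∑words (suc m) (λ c → ι (L ℕₚ.≤? c zero) * chainTerm ε c) ≈
    pw (L ℕ.* suc m ℕ.+ chainWeight ε) * invPoch (suc m)
  chain-sum-from {zero} ε L = begin
    ∑[ c < M ] (ι (L ℕₚ.≤? toℕ c) * (ι (chain? ε (toℕ c Vector.∷ Vector.[])) * pw (toℕ c ℕ.+ 0)))
      ≈⟨ sum-cong-≋ {M} (λ c → *-congˡ (trans (*-congʳ (ι-yes (chain? ε (toℕ c Vector.∷ Vector.[])) (λ ()))) (trans (*-identityˡ _)
           (reflexive (≡.cong pw (≡.trans (ℕₚ.+-identityʳ _) (≡.sym (ℕₚ.*-identityʳ _)))))))) ⟩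
    ∑[ c < M ] (ι (L ℕₚ.≤? toℕ c) * pw (toℕ c ℕ.* 1))
      ≈⟨ geometric 0 L ⟩
    pw (L ℕ.* 1) * inv 1
      ≈⟨ *-cong (reflexive (≡.cong pw (≡.sym (ℕₚ.+-identityʳ _)))) (sym (*-identityˡ _)) ⟩
    pw (L ℕ.* 1 ℕ.+ 0) * invPoch 1 ∎
  chain-sum-from {suc m} ε L = begin
    ∑[ c < M ] ∑words (suc m) (λ v → ι (L ℕₚ.≤? toℕ c) * chainTerm ε (toℕ c Vector.∷ v))
      ≈⟨ sum-cong-≋ {M} (λ c → ∑words-cong (suc m) {Ψ = λ v → ι (L ℕₚ.≤? toℕ c) * pw (toℕ c) * rest (toℕ c) v}
           (λ v → peel (toℕ c) v)) ⟩
    ∑[ c < M ] ∑words (suc m) (λ v → ι (L ℕₚ.≤? toℕ c) * pw (toℕ c) * rest (toℕ c) v)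
      ≈⟨ sum-cong-≋ {M} (λ c → trans (sym (*-distribˡ-∑words (ι (L ℕₚ.≤? toℕ c) * pw (toℕ c)) (suc m) (rest (toℕ c))))
           (*-congˡ (chain-sum-from (ε ∘ suc) (toℕ c ℕ.+ ε zero)))) ⟩
    ∑[ c < M ] (ι (L ℕₚ.≤? toℕ c) * pw (toℕ c) *
        (pw ((toℕ c ℕ.+ ε zero) ℕ.* suc m ℕ.+ chainWeight (ε ∘ suc)) * invPoch (suc m)))
      ≈⟨ sum-cong-≋ {M} (λ c → collect (toℕ c)) ⟩
    ∑[ c < M ] (ι (L ℕₚ.≤? toℕ c) * pw (toℕ c ℕ.* suc (suc m)) * (pw (chainWeight ε) * invPoch (suc m)))
      ≈⟨ *-distribʳ-sum {M} _ _ ⟨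
    ∑[ c < M ] (ι (L ℕₚ.≤? toℕ c) * pw (toℕ c ℕ.* suc (suc m))) * (pw (chainWeight ε) * invPoch (suc m))
      ≈⟨ *-congʳ (geometric (suc m) L) ⟩
    pw (L ℕ.* suc (suc m)) * inv (suc (suc m)) * (pw (chainWeight ε) * invPoch (suc m))
      ≈⟨ solve 4 (λ x y z t → x :* y :* (z :* t) := x :* z :* (t :* y)) refl _ _ _ _ ⟩
    pw (L ℕ.* suc (suc m)) * pw (chainWeight ε) * invPoch (suc (suc m))
      ≈⟨ *-congʳ (pw-+ _ _) ⟨
    pw (L ℕ.* suc (suc m) ℕ.+ chainWeight ε) * invPoch (suc (suc m)) ∎
    where
    rest : ℕ → Vector ℕ (suc m) → Carrier
    rest c v = ι (c ℕ.+ ε zero ℕₚ.≤? v zero) * chainTerm (ε ∘ suc) v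

    peel : ∀ c v → ι (L ℕₚ.≤? c) * chainTerm ε (c Vector.∷ v) ≈ ι (L ℕₚ.≤? c) * pw c * rest c v
    peel c v = trans
      (*-congˡ (*-cong (ι-split (chain? ε (c Vector.∷ v)) (c ℕ.+ ε zero ℕₚ.≤? v zero) (chain? (ε ∘ suc) v)
                         (λ ch → ch zero , ch ∘ suc) (λ { p r zero → p ; p r (suc i) → r i }))
                       (pw-+ c (total v))))
      (solve 5 (λ a x y z t → a :* (x :* y :* (z :* t)) := a :* z :* (x :* (y :* t))) refl _ _ _ _ _)

    exponent : ∀ c → c ℕ.+ ((c ℕ.+ ε zero) ℕ.* suc m ℕ.+ chainWeight (ε ∘ suc)) ≡ c ℕ.* suc (suc m) ℕ.+ chainWeight ε
    exponent c = ℕSolver.solve 4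
      (λ c e m w → c ℕSolver.:+ ((c ℕSolver.:+ e) ℕSolver.:* m ℕSolver.:+ w)
         ℕSolver.:= c ℕSolver.:* (ℕSolver.con 1 ℕSolver.:+ m) ℕSolver.:+ (e ℕSolver.:* m ℕSolver.:+ w))
      ≡.refl c (ε zero) (suc m) (chainWeight (ε ∘ suc))

    collect : ∀ c → ι (L ℕₚ.≤? c) * pw c * (pw ((c ℕ.+ ε zero) ℕ.* suc m ℕ.+ chainWeight (ε ∘ suc)) * invPoch (suc m)) ≈
      ι (L ℕₚ.≤? c) * pw (c ℕ.* suc (suc m)) * (pw (chainWeight ε) * invPoch (suc m))
    collect c = begin
      ι (L ℕₚ.≤? c) * pw c * (pw _ * invPoch (suc m))
        ≈⟨ solve 4 (λ a x y z → a :* x :* (y :* z) := a :* (x :* y) :* z) refl _ _ _ _ ⟩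
      ι (L ℕₚ.≤? c) * (pw c * pw _) * invPoch (suc m)
        ≈⟨ *-congʳ (*-congˡ (trans (sym (pw-+ c _)) (trans (reflexive (≡.cong pw (exponent c))) (pw-+ (c ℕ.* suc (suc m)) (chainWeight ε))))) ⟩
      ι (L ℕₚ.≤? c) * (pw (c ℕ.* suc (suc m)) * pw (chainWeight ε)) * invPoch (suc m)
        ≈⟨ solve 4 (λ a x y z → a :* (x :* y) :* z := a :* x :* (y :* z)) refl _ _ _ _ ⟩
      ι (L ℕₚ.≤? c) * pw (c ℕ.* suc (suc m)) * (pw (chainWeight ε) * invPoch (suc m)) ∎

  chain-sum : ∀ {m} (ε : Vector ℕ m) →
    ∑words (suc m) (chainTerm ε) ≈ pw (chainWeight ε) * invPoch (suc m)
  chain-sum {m} ε = trans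
    (∑words-cong (suc m) {chainTerm ε} (λ c → sym (trans (*-congʳ (ι-yes (0 ℕₚ.≤? c zero) z≤n)) (*-identityˡ _))))
    (chain-sum-from ε 0)

  chainTerm-ext : ∀ {m} (ε : Vector ℕ m) → Extensional (chainTerm ε)
  chainTerm-ext {m} ε {v} {w} v≗w = *-cong
    (ι-cong (chain? ε v) (chain? ε w)
      (λ ch i → ≡.subst₂ (λ x y → x ℕ.+ ε i ℕ.≤ y) (v≗w (inject₁ i)) (v≗w (suc i)) (ch i))
      (λ ch i → ≡.subst₂ (λ x y → x ℕ.+ ε i ℕ.≤ y) (≡.sym (v≗w (inject₁ i))) (≡.sym (v≗w (suc i))) (ch i)))
    (reflexive (≡.cong pw (ℕSum.sum-cong-≗ {suc m} v≗w)))

  permuted-chain-sum : ∀ {m} (ε : Vector ℕ m) (τ : Permutation′ (suc m)) {P : Vector ℕ (suc m) → Set}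
    (P? : Decidable P) → (∀ a → P a ⇔ Chain ε (a ∘ (τ ⟨$⟩ʳ_))) →
    ∑words (suc m) (λ a → ι (P? a) * pw (total a)) ≈ pw (chainWeight ε) * invPoch (suc m)
  permuted-chain-sum {m} ε τ P? P⇔ = begin
    ∑words (suc m) (λ a → ι (P? a) * pw (total a))
      ≈⟨ ∑words-cong (suc m) {λ a → ι (P? a) * pw (total a)} {λ a → chainTerm ε (a ∘ (τ ⟨$⟩ʳ_))}
           (λ a → *-cong (ι-cong (P? a) (chain? ε (a ∘ (τ ⟨$⟩ʳ_))) (to (P⇔ a)) (from (P⇔ a)))
           (reflexive (≡.cong pw (ℕSum.sum-permute a τ)))) ⟩
    ∑words (suc m) (λ a → chainTerm ε (a ∘ (τ ⟨$⟩ʳ_)))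
      ≈⟨ ∑words-permute (chainTerm ε) (chainTerm-ext ε) τ ⟩
    ∑words (suc m) (chainTerm ε)
      ≈⟨ chain-sum ε ⟩
    pw (chainWeight ε) * invPoch (suc m) ∎

  standardization-sum : ∀ {m} (σ : Permutation′ (suc m)) →
    ∑words (suc m) (λ a → ι (standardizes? σ a) * pw (total a)) ≈ pw (maj (flip σ)) * invPoch (suc m)
  standardization-sum {m} σ = trans
    (permuted-chain-sum (descent (flip σ) ∘ opposite) (decreasingLabels σ) (standardizes? σ)
      (λ a → mk⇔ (standardizes⇒chain σ a) (chain⇒standardizes σ a)))
    (*-congʳ (reflexive (≡.cong pw (chainWeight-descent (flip σ)))))

-- Alternating words, linked words and their convolution

Linked : ∀ {m} → Rel ℕ 0ℓ → Vector ℕ (suc m) → Set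
Linked _∼_ a = ∀ i → a (inject₁ i) ∼ a (suc i)

linked? : ∀ {m} {_∼_ : Rel ℕ 0ℓ} → (∀ x y → Dec (x ∼ y)) → (a : Vector ℕ (suc m)) → Dec (Linked _∼_ a)
linked? ∼? a = Finₚ.all? λ i → ∼? _ _

module AlternatingConvolution (T : TruncatedPowers) where
  open Powers T
  open SetoidReasoning setoid

  -- altConv e d k n = Σⱼ (-1)ʲ eₙ₋ⱼ dₖ₊ⱼ
  altConv : (ℕ → Carrier) → (ℕ → Carrier) → ℕ → ℕ → Carrier
  altConv e d k zero    = e 0 * d k
  altConv e d k (suc n) = e (suc n) * d k - altConv e d (suc k) n

  altConv-linear : ∀ e {x y z} β → (∀ j → x (suc j) ≈ y (suc j) - β * z j) → ∀ k n →
    altConv e x (suc k) n ≈ altConv e y (suc k) n - β * altConv e z k n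
  altConv-linear e {x} {y} {z} β rec k zero = begin
    e 0 * x (suc k)                       ≈⟨ *-congˡ (rec k) ⟩
    e 0 * (y (suc k) - β * z k)           ≈⟨ solve 4 (λ e y β z → e :* (y :- β :* z) := e :* y :- β :* (e :* z)) refl _ _ _ _ ⟩
    e 0 * y (suc k) - β * (e 0 * z k)     ∎
  altConv-linear e {x} {y} {z} β rec k (suc n) = begin
    e (suc n) * x (suc k) - altConv e x (suc (suc k)) n
      ≈⟨ +-cong (*-congˡ (rec k)) (-‿cong (altConv-linear e β rec (suc k) n)) ⟩
    e (suc n) * (y (suc k) - β * z k) - (altConv e y (suc (suc k)) n - β * altConv e z (suc k) n)
      ≈⟨ solve 6 (λ e y β z u v → e :* (y :- β :* z) :- (u :- β :* v) := e :* y :- u :- β :* (e :* z :- v)) refl _ _ _ _ _ _ ⟩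
    e (suc n) * y (suc k) - altConv e y (suc (suc k)) n - β * (e (suc n) * z k - altConv e z (suc k) n) ∎

  -- The hypotheses say X = Y - βuZ for the generating series in u. The alternating signs of
  -- `altConv` replace u by -u, so β comes out with a plus sign, just as a step up enters a path
  -- sum.
  altConv-recurrence : ∀ e {x y z} β → x 0 ≈ y 0 → (∀ j → x (suc j) ≈ y (suc j) - β * z j) → ∀ n →
    altConv e x 0 (suc n) ≈ altConv e y 0 (suc n) + β * altConv e z 0 n
  altConv-recurrence e {x} {y} {z} β x₀ rec n = begin
    e (suc n) * x 0 - altConv e x 1 n
      ≈⟨ +-cong (*-congˡ x₀) (-‿cong (altConv-linear e β rec 0 n)) ⟩
    e (suc n) * y 0 - (altConv e y 1 n - β * altConv e z 0 n)
      ≈⟨ solve 3 (λ a b c → a :- (b :- c) := a :- b :+ c) refl _ _ _ ⟩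
    e (suc n) * y 0 - altConv e y 1 n + β * altConv e z 0 n ∎

  altConv-scale : ∀ e {x y} α → (∀ j → x j ≈ α * y j) → ∀ k n →
    altConv e x k n ≈ α * altConv e y k n
  altConv-scale e {x} {y} α x≈αy k zero = begin
    e 0 * x k          ≈⟨ *-congˡ (x≈αy k) ⟩
    e 0 * (α * y k)    ≈⟨ solve 3 (λ e a y → e :* (a :* y) := a :* (e :* y)) refl _ _ _ ⟩
    α * (e 0 * y k)    ∎
  altConv-scale e {x} {y} α x≈αy k (suc n) = begin
    e (suc n) * x k - altConv e x (suc k) n              ≈⟨ +-cong (*-congˡ (x≈αy k)) (-‿cong (altConv-scale e α x≈αy (suc k) n)) ⟩
    e (suc n) * (α * y k) - α * altConv e y (suc k) n    ≈⟨ solve 4 (λ e a y z → e :* (a :* y) :- a :* z := a :* (e :* y :- z)) refl _ _ _ _ ⟩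
    α * (e (suc n) * y k - altConv e y (suc k) n)        ∎

  altConv-cong : ∀ e {x y} → (∀ j → x j ≈ y j) → ∀ k n → altConv e x k n ≈ altConv e y k n
  altConv-cong e x≈y k n =
    trans (altConv-scale e 1# (λ j → trans (x≈y j) (sym (*-identityˡ _))) k n) (*-identityˡ _)

module AlternatingWords (T : TruncatedPowers) {_∼_ : Rel ℕ 0ℓ} (∼? : ∀ x y → Dec (x ∼ y)) where
  open Powers T
  open AlternatingConvolution T
  open SetoidReasoning setoid

  link : Bool → ℕ → ℕ → Carrier
  link b x y = ι (∼? x y ⇔? (b Boolₚ.≟ true))

  rel : ℕ → ℕ → Carrier
  rel x y = ι (∼? x y)

  link-true : ∀ x y → link true x y ≈ rel x y
  link-true x y = ι-cong (∼? x y ⇔? (true Boolₚ.≟ true)) (∼? x y)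
    (λ e → from e ≡.refl) (λ r → mk⇔ (λ _ → ≡.refl) (λ _ → r))

  link-false : ∀ x y → link false x y + rel x y ≈ 1#
  link-false x y with ∼? x y
  ... | yes _ = +-identityˡ 1#
  ... | no  _ = +-identityʳ 1#

  altAfter : Bool → ℕ → ℕ → Carrier
  altAfter b zero    c = 1#
  altAfter b (suc n) c = ∑[ x < M ] (link b c (toℕ x) * (pw (toℕ x) * altAfter (not b) n (toℕ x)))

  alt : ℕ → Carrier
  alt zero    = 1#
  alt (suc n) = ∑[ c < M ] (pw (toℕ c) * altAfter true n (toℕ c))

  -- The `k`-th power of the transfer operator of `∼`, applied to `F`. The constant `1#` for `F`
  -- ends the word; an alternating continuation for `F` glues a tail to its last letter.
  linkedThen : (ℕ → Carrier) → ℕ → ℕ → Carrier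
  linkedThen F zero    c = F c
  linkedThen F (suc k) c = ∑[ x < M ] (rel c (toℕ x) * (pw (toℕ x) * linkedThen F k (toℕ x)))

  linked : ℕ → Carrier
  linked zero    = 1#
  linked (suc k) = ∑[ c < M ] (pw (toℕ c) * linkedThen (λ _ → 1#) k (toℕ c))

  -- The words of `suc k` letters linked by `∼`, followed by `n` letters that alternate and whose
  -- first comparison violates `∼`.
  linkedAlt : ℕ → ℕ → Carrier
  linkedAlt k n = ∑[ c < M ] (pw (toℕ c) * linkedThen (altAfter false n) k (toℕ c))

  altAfter-words : ∀ b n c →
    ∑words n (λ v → ι (alternates? ∼? b (c Vector.∷ v)) * pw (total v)) ≈ altAfter b n c
  altAfter-words b zero    c = trans (*-cong (ι-yes (alternates? ∼? b (c Vector.∷ Vector.[])) (λ ())) pw-0) (*-identityˡ 1#)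
  altAfter-words b (suc n) c = sum-cong-≋ {M} λ x → begin
    ∑words n (λ v → ι (alternates? ∼? b (c Vector.∷ toℕ x Vector.∷ v)) * pw (toℕ x ℕ.+ total v))
      ≈⟨ ∑words-cong n {Ψ = λ v → link b c (toℕ x) * pw (toℕ x) * term (toℕ x) v} (peel (toℕ x)) ⟩
    ∑words n (λ v → link b c (toℕ x) * pw (toℕ x) * term (toℕ x) v)
      ≈⟨ *-distribˡ-∑words _ n (term (toℕ x)) ⟨
    link b c (toℕ x) * pw (toℕ x) * ∑words n (term (toℕ x))
      ≈⟨ trans (*-congˡ (altAfter-words (not b) n (toℕ x))) (*-assoc _ _ _) ⟩
    link b c (toℕ x) * (pw (toℕ x) * altAfter (not b) n (toℕ x)) ∎
    where
    term : ℕ → Vector ℕ n → Carrier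
    term x v = ι (alternates? ∼? (not b) (x Vector.∷ v)) * pw (total v)

    peel : ∀ x v → ι (alternates? ∼? b (c Vector.∷ x Vector.∷ v)) * pw (x ℕ.+ total v) ≈ link b c x * pw x * term x v
    peel x v = trans
      (*-cong (ι-split (alternates? ∼? b (c Vector.∷ x Vector.∷ v)) (∼? c x ⇔? (b Boolₚ.≟ true)) (alternates? ∼? (not b) (x Vector.∷ v))
                (λ p → p zero , p ∘ suc) (λ { p r zero → p ; p r (suc i) → r i }))
              (pw-+ x (total v)))
      (solve 4 (λ x y z t → x :* y :* (z :* t) := x :* z :* (y :* t)) refl _ _ _ _)

  linkedThen-words : ∀ n c →
    ∑words n (λ v → ι (linked? ∼? (c Vector.∷ v)) * pw (total v)) ≈ linkedThen (λ _ → 1#) n c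
  linkedThen-words zero    c = trans (*-cong (ι-yes (linked? ∼? (c Vector.∷ Vector.[])) (λ ())) pw-0) (*-identityˡ 1#)
  linkedThen-words (suc n) c = sum-cong-≋ {M} λ x → begin
    ∑words n (λ v → ι (linked? ∼? (c Vector.∷ toℕ x Vector.∷ v)) * pw (toℕ x ℕ.+ total v))
      ≈⟨ ∑words-cong n {Ψ = λ v → rel c (toℕ x) * pw (toℕ x) * term (toℕ x) v} (peel (toℕ x)) ⟩
    ∑words n (λ v → rel c (toℕ x) * pw (toℕ x) * term (toℕ x) v)
      ≈⟨ *-distribˡ-∑words _ n (term (toℕ x)) ⟨
    rel c (toℕ x) * pw (toℕ x) * ∑words n (term (toℕ x))
      ≈⟨ trans (*-congˡ (linkedThen-words n (toℕ x))) (*-assoc _ _ _) ⟩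
    rel c (toℕ x) * (pw (toℕ x) * linkedThen (λ _ → 1#) n (toℕ x)) ∎
    where
    term : ℕ → Vector ℕ n → Carrier
    term x v = ι (linked? ∼? (x Vector.∷ v)) * pw (total v)

    peel : ∀ x v → ι (linked? ∼? (c Vector.∷ x Vector.∷ v)) * pw (x ℕ.+ total v) ≈ rel c x * pw x * term x v
    peel x v = trans
      (*-cong (ι-split (linked? ∼? (c Vector.∷ x Vector.∷ v)) (∼? c x) (linked? ∼? (x Vector.∷ v))
                (λ p → p zero , p ∘ suc) (λ { p r zero → p ; p r (suc i) → r i }))
              (pw-+ x (total v)))
      (solve 4 (λ x y z t → x :* y :* (z :* t) := x :* z :* (y :* t)) refl _ _ _ _)

  pull-letter : ∀ n c (f : Vector ℕ (suc n) → Carrier) →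
    ∑words n (λ v → f (c Vector.∷ v) * pw (c ℕ.+ total v)) ≈ pw c * ∑words n (λ v → f (c Vector.∷ v) * pw (total v))
  pull-letter n c f = trans
    (∑words-cong n {Ψ = λ v → pw c * (f (c Vector.∷ v) * pw (total v))} (λ v → trans (*-congˡ (pw-+ c (total v)))
      (solve 3 (λ x y z → x :* (y :* z) := y :* (x :* z)) refl _ _ _)))
    (sym (*-distribˡ-∑words (pw c) n (λ v → f (c Vector.∷ v) * pw (total v))))

  alt-words : ∀ m → ∑words (suc m) (λ a → ι (alternates? ∼? true a) * pw (total a)) ≈ alt (suc m)
  alt-words m = sum-cong-≋ {M} λ c → trans (pull-letter m (toℕ c) (λ a → ι (alternates? ∼? true a))) (*-congˡ (altAfter-words true m (toℕ c)))

  linked-words : ∀ m → ∑words (suc m) (λ a → ι (linked? ∼? a) * pw (total a)) ≈ linked (suc m)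
  linked-words m = sum-cong-≋ {M} λ c → trans (pull-letter m (toℕ c) (λ a → ι (linked? ∼? a))) (*-congˡ (linkedThen-words m (toℕ c)))

  linkedThen-cong : ∀ {F G} → (∀ c → F c ≈ G c) → ∀ k c → linkedThen F k c ≈ linkedThen G k c
  linkedThen-cong F≈G zero    c = F≈G c
  linkedThen-cong F≈G (suc k) c = sum-cong-≋ {M} λ x → *-congˡ (*-congˡ (linkedThen-cong F≈G k (toℕ x)))

  linkedThen-+ : ∀ F G k c → linkedThen (λ x → F x + G x) k c ≈ linkedThen F k c + linkedThen G k c
  linkedThen-+ F G zero    c = refl
  linkedThen-+ F G (suc k) c = trans
    (sum-cong-≋ {M} λ x → trans (*-congˡ (*-congˡ (linkedThen-+ F G k (toℕ x))))
      (solve 4 (λ r p f g → r :* (p :* (f :+ g)) := r :* (p :* f) :+ r :* (p :* g)) refl _ _ _ _))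
    (∑-distrib-+ {M} _ _)

  linkedThen-* : ∀ F a k c → linkedThen F k c * a ≈ linkedThen (λ x → F x * a) k c
  linkedThen-* F a zero    c = refl
  linkedThen-* F a (suc k) c = trans (*-distribʳ-sum {M} a _)
    (sum-cong-≋ {M} λ x → trans
      (solve 4 (λ r p f a → r :* (p :* f) :* a := r :* (p :* (f :* a))) refl _ _ _ _)
      (*-congˡ (*-congˡ (linkedThen-* F a k (toℕ x)))))

  linkedThen-∘ : ∀ F k l c → linkedThen (linkedThen F l) k c ≈ linkedThen F (k ℕ.+ l) c
  linkedThen-∘ F zero    l c = refl
  linkedThen-∘ F (suc k) l c = sum-cong-≋ {M} λ x → *-congˡ (*-congˡ (linkedThen-∘ F k l (toℕ x)))

  alt-unfold : ∀ n x → altAfter true (suc n) x ≈ linkedThen (altAfter false n) 1 x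
  alt-unfold n x = sum-cong-≋ {M} λ y → *-congʳ (link-true x (toℕ y))

  -- Prepending a letter c to an alternating word either violates or satisfies c ∼ x.
  alt-split : ∀ n c → alt (suc (suc n)) ≈ altAfter false (suc (suc n)) c + linkedThen (altAfter false n) 2 c
  alt-split n c = begin
    ∑[ x < M ] (pw (toℕ x) * altAfter true (suc n) (toℕ x))
      ≈⟨ sum-cong-≋ {M} (λ x → split (toℕ x)) ⟩
    ∑[ x < M ] (link false c (toℕ x) * (pw (toℕ x) * altAfter true (suc n) (toℕ x))
              + rel c (toℕ x) * (pw (toℕ x) * linkedThen (altAfter false n) 1 (toℕ x)))
      ≈⟨ ∑-distrib-+ {M} _ _ ⟩
    altAfter false (suc (suc n)) c + linkedThen (altAfter false n) 2 c ∎
    where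
    split : ∀ x → pw x * altAfter true (suc n) x ≈
      link false c x * (pw x * altAfter true (suc n) x) + rel c x * (pw x * linkedThen (altAfter false n) 1 x)
    split x = begin
      pw x * altAfter true (suc n) x
        ≈⟨ *-identityˡ _ ⟨
      1# * (pw x * altAfter true (suc n) x)
        ≈⟨ *-congʳ (link-false c x) ⟨
      (link false c x + rel c x) * (pw x * altAfter true (suc n) x)
        ≈⟨ distribʳ _ _ _ ⟩
      link false c x * (pw x * altAfter true (suc n) x) + rel c x * (pw x * altAfter true (suc n) x)
        ≈⟨ +-congˡ (*-congˡ (*-congˡ (alt-unfold n x))) ⟩
      link false c x * (pw x * altAfter true (suc n) x) + rel c x * (pw x * linkedThen (altAfter false n) 1 x) ∎

  -- Concatenate a linked and an alternating word. If `∼` fails at the junction, the result already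
  -- has the first form. If it holds, the linked part absorbs the first two letters of the
  -- alternating word, which are themselves related by `∼`; this is why indices move by two.
  linked-*-alt : ∀ k n →
    linked (suc k) * alt (suc (suc n)) ≈ linkedAlt k (suc (suc n)) + linkedAlt (suc (suc k)) n
  linked-*-alt k n = begin
    linked (suc k) * alt (suc (suc n))
      ≈⟨ *-distribʳ-sum {M} _ _ ⟩
    ∑[ c < M ] (pw (toℕ c) * linkedThen (λ _ → 1#) k (toℕ c) * alt (suc (suc n)))
      ≈⟨ sum-cong-≋ {M} (λ c → step (toℕ c)) ⟩
    ∑[ c < M ] (pw (toℕ c) * linkedThen (altAfter false (suc (suc n))) k (toℕ c)
              + pw (toℕ c) * linkedThen (altAfter false n) (suc (suc k)) (toℕ c))
      ≈⟨ ∑-distrib-+ {M} _ _ ⟩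
    linkedAlt k (suc (suc n)) + linkedAlt (suc (suc k)) n ∎
    where
    step : ∀ c → pw c * linkedThen (λ _ → 1#) k c * alt (suc (suc n)) ≈
      pw c * linkedThen (altAfter false (suc (suc n))) k c + pw c * linkedThen (altAfter false n) (suc (suc k)) c
    step c = begin
      pw c * linkedThen (λ _ → 1#) k c * alt (suc (suc n))
        ≈⟨ *-assoc _ _ _ ⟩
      pw c * (linkedThen (λ _ → 1#) k c * alt (suc (suc n)))
        ≈⟨ *-congˡ (trans (linkedThen-* (λ _ → 1#) _ k c) (linkedThen-cong (λ x → trans (*-identityˡ _) (alt-split n x)) k c)) ⟩
      pw c * linkedThen (λ x → altAfter false (suc (suc n)) x + linkedThen (altAfter false n) 2 x) k c
        ≈⟨ *-congˡ (linkedThen-+ (altAfter false (suc (suc n))) (linkedThen (altAfter false n) 2) k c) ⟩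
      pw c * (linkedThen (altAfter false (suc (suc n))) k c + linkedThen (linkedThen (altAfter false n) 2) k c)
        ≈⟨ *-congˡ (+-congˡ (linkedThen-∘ (altAfter false n) k 2 c)) ⟩
      pw c * (linkedThen (altAfter false (suc (suc n))) k c + linkedThen (altAfter false n) (k ℕ.+ 2) c)
        ≈⟨ distribˡ _ _ _ ⟩
      pw c * linkedThen (altAfter false (suc (suc n))) k c + pw c * linkedThen (altAfter false n) (k ℕ.+ 2) c
        ≡⟨ ≡.cong (λ l → pw c * linkedThen (altAfter false (suc (suc n))) k c + pw c * linkedThen (altAfter false n) l c) (ℕₚ.+-comm k 2) ⟩
      pw c * linkedThen (altAfter false (suc (suc n))) k c + pw c * linkedThen (altAfter false n) (suc (suc k)) c ∎

  -- The words in which `∼` holds at the junction for one length of the linked part are those in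
  -- which it fails for the next length, so the alternating sum telescopes. It stops at n = 0, where
  -- the words are entirely linked.
  altConv-linkedAlt : ∀ k n →
    altConv (alt ∘ double) (linked ∘ double) (suc k) n ≈ linkedAlt (suc (double k)) (double n)
  altConv-linkedAlt k zero = *-identityˡ _
  altConv-linkedAlt k (suc n) = begin
    alt (double (suc n)) * linked (double (suc k)) - altConv (alt ∘ double) (linked ∘ double) (suc (suc k)) n
      ≈⟨ +-cong (trans (*-comm _ _) (linked-*-alt (suc (double k)) (double n))) (-‿cong (altConv-linkedAlt (suc k) n)) ⟩
    linkedAlt (suc (double k)) (double (suc n)) + linkedAlt (suc (double (suc k))) (double n) - linkedAlt (suc (double (suc k))) (double n)
      ≈⟨ solve 2 (λ x y → x :+ y :- y := x) refl _ _ ⟩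
    linkedAlt (suc (double k)) (double (suc n)) ∎

  -- The leading term pairs the alternating words with the empty linked word. Their first two
  -- letters are linked, so it equals the telescoped remainder.
  altConv-alt-linked : ∀ n → altConv (alt ∘ double) (linked ∘ double) 0 (suc n) ≈ 0#
  altConv-alt-linked n = begin
    alt (double (suc n)) * 1# - altConv (alt ∘ double) (linked ∘ double) 1 n
      ≈⟨ +-cong (trans (*-identityʳ _) (sum-cong-≋ {M} (λ c → *-congˡ (alt-unfold (double n) (toℕ c)))))
                (-‿cong (altConv-linkedAlt 0 n)) ⟩
    linkedAlt 1 (double n) - linkedAlt 1 (double n)
      ≈⟨ -‿inverseʳ _ ⟩
    0# ∎

  -- Each word is multiplied by the sum 1 over its standardizations. For a word standardized by `σ`,
  -- alternation is a property of `σ` alone, so the sum over its words is a chain enumeration.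
  alt-permutations : ∀ {m} {Q : Permutation′ (suc m) → Set} (Q? : Decidable Q) →
    (∀ σ a → Standardizes σ a → Q σ ⇔ Alternates _∼_ true a) →
    alt (suc m) ≈ ∑∈ (filter Q? (permutations (suc m))) (λ σ → pw (maj (flip σ))) * invPoch (suc m)
  alt-permutations {m} Q? Q⇔ = begin
    alt (suc m)
      ≈⟨ alt-words m ⟨
    ∑words (suc m) w
      ≈⟨ ∑words-cong (suc m) {Ψ = λ a → ∑∈ perms (λ σ → ι (Q? σ) * stdTerm σ a)} refine ⟩
    ∑words (suc m) (λ a → ∑∈ perms (λ σ → ι (Q? σ) * stdTerm σ a))
      ≈⟨ ∑∈-∑words-comm perms (suc m) (λ σ a → ι (Q? σ) * stdTerm σ a) ⟨
    ∑∈ perms (λ σ → ∑words (suc m) (λ a → ι (Q? σ) * stdTerm σ a))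
      ≈⟨ ∑∈-cong perms (λ σ → begin
           ∑words (suc m) (λ a → ι (Q? σ) * stdTerm σ a)    ≈⟨ *-distribˡ-∑words _ (suc m) (stdTerm σ) ⟨
           ι (Q? σ) * ∑words (suc m) (stdTerm σ)            ≈⟨ *-congˡ (standardization-sum σ) ⟩
           ι (Q? σ) * (pw (maj (flip σ)) * invPoch (suc m)) ≈⟨ *-assoc _ _ _ ⟨
           ι (Q? σ) * pw (maj (flip σ)) * invPoch (suc m)   ∎) ⟩
    ∑∈ perms (λ σ → ι (Q? σ) * pw (maj (flip σ)) * invPoch (suc m))
      ≈⟨ *-distribʳ-∑∈ (invPoch (suc m)) perms (λ σ → ι (Q? σ) * pw (maj (flip σ))) ⟨
    ∑∈ perms (λ σ → ι (Q? σ) * pw (maj (flip σ))) * invPoch (suc m)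
      ≈⟨ *-congʳ (∑∈-filter Q? perms _) ⟨
    ∑∈ (filter Q? perms) (λ σ → pw (maj (flip σ))) * invPoch (suc m) ∎
    where
    perms = permutations (suc m)

    w : Vector ℕ (suc m) → Carrier
    w a = ι (alternates? ∼? true a) * pw (total a)

    stdTerm : Permutation′ (suc m) → Vector ℕ (suc m) → Carrier
    stdTerm σ a = ι (standardizes? σ a) * pw (total a)

    refine : ∀ a → w a ≈ ∑∈ perms (λ σ → ι (Q? σ) * stdTerm σ a)
    refine a = begin
      w a
        ≈⟨ *-identityˡ _ ⟨
      1# * w a
        ≈⟨ *-congʳ (StandardizationCount.standardization-unique commutativeRing a) ⟨
      ∑∈ perms (λ σ → ι (standardizes? σ a)) * w a
        ≈⟨ *-distribʳ-∑∈ (w a) perms _ ⟩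
      ∑∈ perms (λ σ → ι (standardizes? σ a) * w a)
        ≈⟨ ∑∈-cong perms (λ σ → trans
             (ι-*-cong (standardizes? σ a) (λ std → *-congʳ
               (ι-cong (alternates? ∼? true a) (Q? σ) (from (Q⇔ σ a std)) (to (Q⇔ σ a std)))))
             (solve 3 (λ x y z → x :* (y :* z) := y :* (x :* z)) refl _ _ _)) ⟩
      ∑∈ perms (λ σ → ι (Q? σ) * stdTerm σ a) ∎

module LinkedSums (T : TruncatedPowers) where
  open Powers T
  open AlternatingWords T using (linked; linked-words)
  open SetoidReasoning setoid

  total-zero : ∀ {m} (f : Fin m → ℕ) → total (λ i → 0 ℕ.* f i) ≡ 0
  total-zero {zero}  f = ≡.refl
  total-zero {suc m} f = total-zero (f ∘ suc)

  chainWeight-one : ∀ m → chainWeight {m} (λ _ → 1) ≡ tri (suc m)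
  chainWeight-one zero    = ≡.refl
  chainWeight-one (suc m) = ≡.cong₂ ℕ._+_ (ℕₚ.*-identityˡ (suc m)) (chainWeight-one m)

  linked-< : ∀ n → linked ℕₚ._<?_ n ≈ pw (tri n) * invPoch n
  linked-< zero    = sym (trans (*-identityʳ _) pw-0)
  linked-< (suc m) = begin
    linked ℕₚ._<?_ (suc m)
      ≈⟨ linked-words ℕₚ._<?_ m ⟨
    ∑words (suc m) (λ a → ι (linked? ℕₚ._<?_ a) * pw (total a))
      ≈⟨ permuted-chain-sum (λ _ → 1) Perm.id (linked? ℕₚ._<?_) (λ a → mk⇔
           (λ l i → ≡.subst (ℕ._≤ a (suc i)) (ℕₚ.+-comm 1 _) (l i))
           (λ l i → ≡.subst (ℕ._≤ a (suc i)) (ℕₚ.+-comm _ 1) (l i))) ⟩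
    pw (chainWeight {m} (λ _ → 1)) * invPoch (suc m)
      ≡⟨ ≡.cong (λ k → pw k * invPoch (suc m)) (chainWeight-one m) ⟩
    pw (tri (suc m)) * invPoch (suc m) ∎

  linked-≥ : ∀ n → linked ℕₚ._≥?_ n ≈ invPoch n
  linked-≥ zero    = refl
  linked-≥ (suc m) = begin
    linked ℕₚ._≥?_ (suc m)
      ≈⟨ linked-words ℕₚ._≥?_ m ⟨
    ∑words (suc m) (λ a → ι (linked? ℕₚ._≥?_ a) * pw (total a))
      -- Read backwards, a weakly decreasing word is a chain with all gaps zero.
      ≈⟨ permuted-chain-sum (λ _ → 0) Perm.reverse (linked? ℕₚ._≥?_) (λ a → mk⇔
           (λ l i → ≡.subst₂ ℕ._≤_ (≡.sym (≡.trans (ℕₚ.+-identityʳ _) (≡.cong a (opposite-inject₁ i)))) ≡.refl (l (opposite i)))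
           (λ ch i → ≡.subst₂ (λ u v → a u ℕ.≤ a v)
              (≡.trans (opposite-inject₁ (opposite i)) (≡.cong suc (Finₚ.opposite-involutive i)))
              (≡.cong inject₁ (Finₚ.opposite-involutive i))
              (≡.subst (ℕ._≤ a (opposite (suc (opposite i)))) (ℕₚ.+-identityʳ _) (ch (opposite i))))) ⟩
    pw (chainWeight {m} (λ _ → 0)) * invPoch (suc m)
      ≡⟨ ≡.cong (λ k → pw k * invPoch (suc m)) (total-zero {m} (λ i → m ℕ.∸ toℕ i)) ⟩
    pw 0 * invPoch (suc m)
      ≈⟨ trans (*-congʳ pw-0) (*-identityˡ _) ⟩
    invPoch (suc m) ∎

-- Path sums by first step and their closed forms

module DyckRecurrence (T : TruncatedPowers) where
  open Powers T
  open AlternatingConvolution T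
  open SetoidReasoning setoid

  weight : ℕ → Carrier
  weight h = pw h * inv (suc (double h))

  -- Sums over the paths from height k to 0 in N steps, weighted by their vertices but the first.
  after : ℕ → ℕ → Carrier
  fromBelow : ℕ → ℕ → Carrier

  after zero    zero    = 1#
  after zero    (suc k) = 0#
  after (suc N) k       = fromBelow N k + weight (suc k) * after N (suc k)

  -- The contribution of a step down is kept apart because it is the same on and off the initial
  -- ascent.
  fromBelow N zero    = 0#
  fromBelow N (suc k) = weight k * after N k

  after-vanishes : ∀ N k → N ℕ.< k → after N k ≈ 0#
  after-vanishes zero    (suc k) _         = refl
  after-vanishes (suc N) (suc k) (s≤s N<k) = begin
    weight k * after N k + weight (suc (suc k)) * after N (suc (suc k))
      ≈⟨ +-cong (*-congˡ (after-vanishes N k N<k)) (*-congˡ (after-vanishes N (suc (suc k)) (ℕₚ.m<n⇒m<1+n (ℕₚ.m<n⇒m<1+n N<k)))) ⟩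
    weight k * 0# + weight (suc (suc k)) * 0#
      ≈⟨ solve 2 (λ x y → x :* con 0ℤ :+ y :* con 0ℤ := con 0ℤ) refl _ _ ⟩
    0# ∎

  module _ (firstWeight : ℕ → Carrier) where

    -- Sum over the completions, in N steps, of the initial ascent to height k.
    ascending : ℕ → ℕ → Carrier
    ascending zero    zero    = 1#
    ascending zero    (suc k) = 0#
    ascending (suc N) k       = fromBelow N k + firstWeight (suc k) * ascending N (suc k)

    ascending-vanishes : ∀ N k → N ℕ.< k → ascending N k ≈ 0#
    ascending-vanishes zero    (suc k) _         = refl
    ascending-vanishes (suc N) (suc k) (s≤s N<k) = begin
      weight k * after N k + firstWeight (suc (suc k)) * ascending N (suc (suc k))
        ≈⟨ +-cong (*-congˡ (after-vanishes N k N<k)) (*-congˡ (ascending-vanishes N (suc (suc k)) (ℕₚ.m<n⇒m<1+n (ℕₚ.m<n⇒m<1+n N<k)))) ⟩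
      weight k * 0# + firstWeight (suc (suc k)) * 0#
        ≈⟨ solve 2 (λ x y → x :* con 0ℤ :+ y :* con 0ℤ := con 0ℤ) refl _ _ ⟩
      0# ∎

    module _ (e : ℕ → Carrier) (y d p : ℕ → ℕ → Carrier)
      (e₀ : e 0 ≈ 1#)
      (y₀₀ : y 0 0 ≈ 1#)
      (y₀-inverse : ∀ n → altConv e (y 0) 0 (suc n) ≈ 0#)
      (y-suc : ∀ k j → y (suc k) j ≈ weight k * d k j)
      (d-zero : ∀ k → d k 0 ≈ y k 0)
      (d-suc : ∀ k j → d k (suc j) ≈ y k (suc j) - weight (suc k) * d (suc k) j)
      (p-zero : ∀ k → p (suc k) 0 ≈ y (suc k) 0)
      (p-suc : ∀ k j → p k (suc j) ≈ y k (suc j) - firstWeight (suc k) * p (suc k) j)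
      (p₀ : ∀ j → p 0 (suc j) ≈ 0#)
      where

      -- Lexicographic induction on n and k: a step down lowers k, a step up lowers n. The step down
      -- contributes the convolution of `e` with `y k`. At height 0 no such step exists, and the
      -- convolution vanishes because `y 0` inverts `e`.
      after-closed : ∀ n k → after (k ℕ.+ double n) k ≈ altConv e (d k) 0 n
      after-closed zero    zero    = sym (trans (*-cong e₀ (trans (d-zero 0) y₀₀)) (*-identityˡ 1#))
      after-closed zero    (suc k) = begin
        weight k * after (k ℕ.+ 0) k + weight (suc (suc k)) * after (k ℕ.+ 0) (suc (suc k))
          ≈⟨ +-cong (*-congˡ (after-closed zero k)) (*-congˡ (after-vanishes (k ℕ.+ 0) (suc (suc k)) k+0<)) ⟩
        weight k * (e 0 * d k 0) + weight (suc (suc k)) * 0#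
          ≈⟨ solve 4 (λ w e d v → w :* (e :* d) :+ v :* con 0ℤ := e :* (w :* d)) refl _ _ _ _ ⟩
        e 0 * (weight k * d k 0)
          ≈⟨ *-congˡ (trans (d-zero (suc k)) (y-suc k 0)) ⟨
        e 0 * d (suc k) 0 ∎
        where
        k+0< : k ℕ.+ 0 ℕ.< suc (suc k)
        k+0< = s≤s (ℕₚ.m≤n⇒m≤1+n (ℕₚ.≤-reflexive (ℕₚ.+-identityʳ k)))
      after-closed (suc n) zero    = begin
        0# + weight 1 * after (suc (double n)) 1
          ≈⟨ +-cong (sym (y₀-inverse n)) (*-congˡ (after-closed n 1)) ⟩
        altConv e (y 0) 0 (suc n) + weight 1 * altConv e (d 1) 0 n
          ≈⟨ altConv-recurrence e (weight 1) (d-zero 0) (d-suc 0) n ⟨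
        altConv e (d 0) 0 (suc n) ∎
      after-closed (suc n) (suc k) = begin
        weight k * after (k ℕ.+ double (suc n)) k + weight (suc (suc k)) * after (k ℕ.+ double (suc n)) (suc (suc k))
          ≡⟨ ≡.cong (λ N → weight k * after (k ℕ.+ double (suc n)) k + weight (suc (suc k)) * after N (suc (suc k))) shift ⟩
        weight k * after (k ℕ.+ double (suc n)) k + weight (suc (suc k)) * after (suc (suc k) ℕ.+ double n) (suc (suc k))
          ≈⟨ +-cong (*-congˡ (after-closed (suc n) k)) (*-congˡ (after-closed n (suc (suc k)))) ⟩
        weight k * altConv e (d k) 0 (suc n) + weight (suc (suc k)) * altConv e (d (suc (suc k))) 0 n
          ≈⟨ +-congʳ (altConv-scale e (weight k) (y-suc k) 0 (suc n)) ⟨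
        altConv e (y (suc k)) 0 (suc n) + weight (suc (suc k)) * altConv e (d (suc (suc k))) 0 n
          ≈⟨ altConv-recurrence e (weight (suc (suc k))) (d-zero (suc k)) (d-suc (suc k)) n ⟨
        altConv e (d (suc k)) 0 (suc n) ∎
        where
        shift : k ℕ.+ double (suc n) ≡ suc (suc k) ℕ.+ double n
        shift = ≡.trans (ℕₚ.+-suc k _) (≡.cong suc (ℕₚ.+-suc k _))

      -- A step up continues the initial ascent with smaller n; after a step down the plain closed
      -- form takes over.
      ascending-closed : ∀ n k → ascending (suc k ℕ.+ double n) (suc k) ≈ altConv e (p (suc k)) 0 n
      ascending-closed zero k = begin
        weight k * after (k ℕ.+ 0) k + firstWeight (suc (suc k)) * ascending (k ℕ.+ 0) (suc (suc k))
          ≈⟨ +-cong (*-congˡ (after-closed zero k)) (*-congˡ (ascending-vanishes (k ℕ.+ 0) (suc (suc k)) k+0<)) ⟩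
        weight k * (e 0 * d k 0) + firstWeight (suc (suc k)) * 0#
          ≈⟨ solve 4 (λ w e d v → w :* (e :* d) :+ v :* con 0ℤ := e :* (w :* d)) refl _ _ _ _ ⟩
        e 0 * (weight k * d k 0)
          ≈⟨ *-congˡ (trans (p-zero k) (y-suc k 0)) ⟨
        e 0 * p (suc k) 0 ∎
        where
        k+0< : k ℕ.+ 0 ℕ.< suc (suc k)
        k+0< = s≤s (ℕₚ.m≤n⇒m≤1+n (ℕₚ.≤-reflexive (ℕₚ.+-identityʳ k)))
      ascending-closed (suc n) k = begin
        weight k * after (k ℕ.+ double (suc n)) k + firstWeight (suc (suc k)) * ascending (k ℕ.+ double (suc n)) (suc (suc k))
          ≡⟨ ≡.cong (λ N → weight k * after (k ℕ.+ double (suc n)) k + firstWeight (suc (suc k)) * ascending N (suc (suc k))) shift ⟩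
        weight k * after (k ℕ.+ double (suc n)) k + firstWeight (suc (suc k)) * ascending (suc (suc k) ℕ.+ double n) (suc (suc k))
          ≈⟨ +-cong (*-congˡ (after-closed (suc n) k)) (*-congˡ (ascending-closed n (suc k))) ⟩
        weight k * altConv e (d k) 0 (suc n) + firstWeight (suc (suc k)) * altConv e (p (suc (suc k))) 0 n
          ≈⟨ +-congʳ (altConv-scale e (weight k) (y-suc k) 0 (suc n)) ⟨
        altConv e (y (suc k)) 0 (suc n) + firstWeight (suc (suc k)) * altConv e (p (suc (suc k))) 0 n
          ≈⟨ altConv-recurrence e (firstWeight (suc (suc k))) (p-zero k) (p-suc (suc k)) n ⟨
        altConv e (p (suc k)) 0 (suc n) ∎
        where
        shift : k ℕ.+ double (suc n) ≡ suc (suc k) ℕ.+ double n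
        shift = ≡.trans (ℕₚ.+-suc k _) (≡.cong suc (ℕₚ.+-suc k _))

      -- Since `p 0` vanishes beyond its constant term, the tail of `y 0` is `firstWeight 1` times
      -- `p 1`. So the path sum is, up to sign, the convolution of `e` with `y 0` without its
      -- leading term `e (suc n)`, and the full convolution is zero.
      ascending≈e : ∀ n → ascending (double n) 0 ≈ e n
      ascending≈e zero    = sym e₀
      ascending≈e (suc n) = begin
        0# + firstWeight 1 * ascending (suc (double n)) 1
          ≈⟨ trans (+-identityˡ _) (*-congˡ (ascending-closed n 0)) ⟩
        firstWeight 1 * altConv e (p 1) 0 n
          ≈⟨ altConv-scale e (firstWeight 1) (λ j → refl) 0 n ⟨
        altConv e (λ j → firstWeight 1 * p 1 j) 0 n
          ≈⟨ altConv-shift n 0 ⟨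
        altConv e (y 0) 1 n
          ≈⟨ solve 2 (λ a b → b := a :- (a :- b)) refl _ _ ⟩
        e (suc n) * y 0 0 - altConv e (y 0) 0 (suc n)
          ≈⟨ +-cong (trans (*-congˡ y₀₀) (*-identityʳ _)) (-‿cong (y₀-inverse n)) ⟩
        e (suc n) - 0#
          ≈⟨ solve 1 (λ x → x :- con 0ℤ := x) refl _ ⟩
        e (suc n) ∎
        where
        y₀-suc : ∀ j → y 0 (suc j) ≈ firstWeight 1 * p 1 j
        y₀-suc j = begin
          y 0 (suc j)
            ≈⟨ solve 2 (λ a b → a := a :- b :+ b) refl _ _ ⟩
          y 0 (suc j) - firstWeight 1 * p 1 j + firstWeight 1 * p 1 j
            ≈⟨ +-congʳ (trans (sym (p-suc 0 j)) (p₀ j)) ⟩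
          0# + firstWeight 1 * p 1 j
            ≈⟨ +-identityˡ _ ⟩
          firstWeight 1 * p 1 j ∎

        altConv-shift : ∀ n k → altConv e (y 0) (suc k) n ≈ altConv e (λ j → firstWeight 1 * p 1 j) k n
        altConv-shift zero    k = *-congˡ (y₀-suc k)
        altConv-shift (suc n) k = +-cong (*-congˡ (y₀-suc k)) (-‿cong (altConv-shift n (suc k)))

  -- The inverse of (q²;q²)ⱼ.
  evens : ℕ → Carrier
  evens zero    = 1#
  evens (suc j) = evens j * inv (double (suc j))

  -- The inverse of (q;q²)ₙ.
  odds : ℕ → Carrier
  odds zero    = 1#
  odds (suc n) = odds n * inv (suc (double n))

  invPoch-double : ∀ j → invPoch (double j) ≈ evens j * odds j
  invPoch-double zero    = sym (*-identityˡ 1#)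
  invPoch-double (suc j) = begin
    invPoch (double j) * inv (suc (double j)) * inv (suc (suc (double j)))
      ≈⟨ *-congʳ (*-congʳ (invPoch-double j)) ⟩
    evens j * odds j * inv (suc (double j)) * inv (suc (suc (double j)))
      ≈⟨ solve 4 (λ a b c d → a :* b :* c :* d := a :* d :* (b :* c)) refl _ _ _ _ ⟩
    evens (suc j) * odds (suc j) ∎

  -- Division of `P = S y - X z` by `y z`, with `N` the remaining common factor: each term on the
  -- right loses one of the two denominators.
  cancel-two : ∀ {P S X y z t v} N → P ≈ S * y - X * z → y * t ≈ 1# → z * v ≈ 1# →
    P * (N * v * t) ≈ S * (N * v) - X * (N * t)
  cancel-two {P} {S} {X} {y} {z} {t} {v} N P≈ yt zv = begin
    P * (N * v * t)
      ≈⟨ *-congʳ P≈ ⟩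
    (S * y - X * z) * (N * v * t)
      ≈⟨ solve 7 (λ S y X z N v t → (S :* y :- X :* z) :* (N :* v :* t) := S :* (N :* v) :* (y :* t) :- X :* (N :* t) :* (z :* v)) refl _ _ _ _ _ _ _ ⟩
    S * (N * v) * (y * t) - X * (N * t) * (z * v)
      ≈⟨ +-cong (*-congˡ yt) (-‿cong (*-congˡ zv)) ⟩
    S * (N * v) * 1# - X * (N * t) * 1#
      ≈⟨ +-cong (*-identityʳ _) (-‿cong (*-identityʳ _)) ⟩
    S * (N * v) - X * (N * t) ∎

  -- The families y, d and p play the role of q-Bessel coefficients: d k j and p k j are (up to
  -- sign) the coefficients of x^(2j+k) in the product of the (co)sine series y 0 with the
  -- generating functions of after N k and ascending N k.
  module ClosedForms (firstExponent : ℕ → ℕ) (s t : ℕ → ℕ → ℕ)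
    (s₀ : s 0 0 ≡ 0)
    (s-suc : ∀ k j → s (suc k) j ≡ k ℕ.+ t k j)
    (t-zero : ∀ k → t k 0 ≡ s k 0)
    (d-identity : ∀ k j → (1# - pw (suc (double k))) * pw (t k (suc j)) ≈
       pw (s k (suc j)) * (1# - pw (suc (double (k ℕ.+ suc j)))) - pw (suc k) * pw (t (suc k) j) * (1# - pw (double (suc j))))
    (p-identity : ∀ k j → (1# - pw (double k)) * pw (t k (suc j)) ≈
       pw (s k (suc j)) * (1# - pw (double (k ℕ.+ suc j))) - pw (firstExponent (suc k)) * pw (t (suc k) j) * (1# - pw (double (suc j))))
    where

    firstWeight : ℕ → Carrier
    firstWeight h = pw (firstExponent h) * inv (double h)

    y d p : ℕ → ℕ → Carrier
    y k j = pw (s k j) * (evens j * odds (k ℕ.+ j))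
    d k j = (1# - pw (suc (double k))) * pw (t k j) * (evens j * odds (suc (k ℕ.+ j)))
    -- The first factor cancels the denominator of `firstWeight k` for k > 0 and vanishes at k = 0.
    -- The recurrences use the formula for k + j > 0, where the last `inv` is a true inverse.
    p k j = (1# - pw (double k)) * pw (t k j) * (evens j * odds (k ℕ.+ j) * inv (double (k ℕ.+ j)))

    weight-d : ∀ k j → weight k * d k j ≈ pw k * pw (t k j) * (evens j * odds (suc (k ℕ.+ j)))
    weight-d k j = begin
      pw k * inv (suc (double k)) * ((1# - pw (suc (double k))) * pw (t k j) * (evens j * odds (suc (k ℕ.+ j))))
        ≈⟨ solve 5 (λ a b c x z → a :* b :* (c :* x :* z) := c :* b :* (a :* x :* z)) refl _ _ _ _ _ ⟩
      (1# - pw (suc (double k))) * inv (suc (double k)) * (pw k * pw (t k j) * (evens j * odds (suc (k ℕ.+ j))))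
        ≈⟨ trans (*-congʳ (inv-inverse _)) (*-identityˡ _) ⟩
      pw k * pw (t k j) * (evens j * odds (suc (k ℕ.+ j))) ∎

    firstWeight-p : ∀ k j → firstWeight (suc k) * p (suc k) j ≈
      pw (firstExponent (suc k)) * pw (t (suc k) j) * (evens j * odds (suc k ℕ.+ j) * inv (double (suc k ℕ.+ j)))
    firstWeight-p k j = begin
      _ ≈⟨ solve 5 (λ a b c x z → a :* b :* (c :* x :* z) := c :* b :* (a :* x :* z)) refl _ _ _ _ _ ⟩
      (1# - pw (double (suc k))) * inv (double (suc k)) * _
        ≈⟨ trans (*-congʳ (inv-inverse _)) (*-identityˡ _) ⟩
      _ ∎

    y-suc : ∀ k j → y (suc k) j ≈ weight k * d k j
    y-suc k j = begin
      pw (s (suc k) j) * (evens j * odds (suc (k ℕ.+ j)))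
        ≈⟨ *-congʳ (trans (reflexive (≡.cong pw (s-suc k j))) (pw-+ k (t k j))) ⟩
      pw k * pw (t k j) * (evens j * odds (suc (k ℕ.+ j)))
        ≈⟨ weight-d k j ⟨
      weight k * d k j ∎

    d-zero : ∀ k → d k 0 ≈ y k 0
    d-zero k = begin
      (1# - pw (suc (double k))) * pw (t k 0) * (1# * (odds (k ℕ.+ 0) * inv (suc (double (k ℕ.+ 0)))))
        ≡⟨ ≡.cong₂ (λ a b → (1# - pw (suc (double k))) * pw a * (1# * (odds (k ℕ.+ 0) * inv (suc (double b))))) (t-zero k) (ℕₚ.+-identityʳ k) ⟩
      (1# - pw (suc (double k))) * pw (s k 0) * (1# * (odds (k ℕ.+ 0) * inv (suc (double k))))
        ≈⟨ solve 5 (λ a b i o v → a :* b :* (i :* (o :* v)) := b :* (i :* o) :* (a :* v)) refl _ _ _ _ _ ⟩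
      y k 0 * ((1# - pw (suc (double k))) * inv (suc (double k)))
        ≈⟨ trans (*-congˡ (inv-inverse _)) (*-identityʳ _) ⟩
      y k 0 ∎

    p-zero : ∀ k → p (suc k) 0 ≈ y (suc k) 0
    p-zero k = begin
      (1# - pw (double (suc k))) * pw (t (suc k) 0) * (1# * odds (suc k ℕ.+ 0) * inv (double (suc k ℕ.+ 0)))
        ≡⟨ ≡.cong₂ (λ a b → (1# - pw (double (suc k))) * pw a * (1# * odds (suc k ℕ.+ 0) * inv (double (suc b)))) (t-zero (suc k)) (ℕₚ.+-identityʳ k) ⟩
      (1# - pw (double (suc k))) * pw (s (suc k) 0) * (1# * odds (suc k ℕ.+ 0) * inv (double (suc k)))
        ≈⟨ solve 4 (λ a b o v → a :* b :* (o :* v) := b :* o :* (a :* v)) refl _ _ _ _ ⟩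
      y (suc k) 0 * ((1# - pw (double (suc k))) * inv (double (suc k)))
        ≈⟨ trans (*-congˡ (inv-inverse _)) (*-identityʳ _) ⟩
      y (suc k) 0 ∎

    -- Over the common denominator, `y k (suc j)` lacks the last odd factor and the other term lacks
    -- the last even one. Clearing these two denominators leaves `d-identity`.
    d-suc : ∀ k j → d k (suc j) ≈ y k (suc j) - weight (suc k) * d (suc k) j
    d-suc k j = begin
      (1# - pw (suc (double k))) * pw (t k (suc j)) * (evens j * inv (double (suc j)) * (odds (k ℕ.+ suc j) * inv (suc (double (k ℕ.+ suc j)))))
        ≈⟨ *-congˡ (solve 4 (λ e v o t → e :* v :* (o :* t) := e :* o :* v :* t) refl _ _ _ _) ⟩
      (1# - pw (suc (double k))) * pw (t k (suc j)) * (N * inv (double (suc j)) * inv (suc (double (k ℕ.+ suc j))))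
        ≈⟨ cancel-two N (d-identity k j) (inv-inverse _) (inv-inverse _) ⟩
      pw (s k (suc j)) * (N * inv (double (suc j))) - pw (suc k) * pw (t (suc k) j) * (N * inv (suc (double (k ℕ.+ suc j))))
        ≈⟨ +-cong (*-congˡ (solve 3 (λ e o v → e :* o :* v := e :* v :* o) refl _ _ _)) (-‿cong (*-congˡ (*-assoc _ _ _))) ⟩
      y k (suc j) - pw (suc k) * pw (t (suc k) j) * (evens j * odds (suc (k ℕ.+ suc j)))
        ≡⟨ ≡.cong (λ l → y k (suc j) - pw (suc k) * pw (t (suc k) j) * (evens j * odds (suc l))) (ℕₚ.+-suc k j) ⟩
      y k (suc j) - pw (suc k) * pw (t (suc k) j) * (evens j * odds (suc (suc k ℕ.+ j)))
        ≈⟨ +-congˡ (-‿cong (weight-d (suc k) j)) ⟨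
      y k (suc j) - weight (suc k) * d (suc k) j ∎
      where
      N = evens j * odds (k ℕ.+ suc j)

    p-suc : ∀ k j → p k (suc j) ≈ y k (suc j) - firstWeight (suc k) * p (suc k) j
    p-suc k j = begin
      (1# - pw (double k)) * pw (t k (suc j)) * (evens j * inv (double (suc j)) * odds (k ℕ.+ suc j) * inv (double (k ℕ.+ suc j)))
        ≈⟨ *-congˡ (solve 4 (λ e v o t → e :* v :* o :* t := e :* o :* v :* t) refl _ _ _ _) ⟩
      (1# - pw (double k)) * pw (t k (suc j)) * (N * inv (double (suc j)) * inv (double (k ℕ.+ suc j)))
        ≈⟨ cancel-two N (p-identity k j) inverse (inv-inverse _) ⟩
      pw (s k (suc j)) * (N * inv (double (suc j))) - pw (firstExponent (suc k)) * pw (t (suc k) j) * (N * inv (double (k ℕ.+ suc j)))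
        ≈⟨ +-congʳ (*-congˡ (solve 3 (λ e o v → e :* o :* v := e :* v :* o) refl _ _ _)) ⟩
      y k (suc j) - pw (firstExponent (suc k)) * pw (t (suc k) j) * (N * inv (double (k ℕ.+ suc j)))
        ≡⟨ ≡.cong (λ l → y k (suc j) - pw (firstExponent (suc k)) * pw (t (suc k) j) * (evens j * odds l * inv (double l))) (ℕₚ.+-suc k j) ⟩
      y k (suc j) - pw (firstExponent (suc k)) * pw (t (suc k) j) * (evens j * odds (suc k ℕ.+ j) * inv (double (suc k ℕ.+ j)))
        ≈⟨ +-congˡ (-‿cong (firstWeight-p k j)) ⟨
      y k (suc j) - firstWeight (suc k) * p (suc k) j ∎
      where
      N = evens j * odds (k ℕ.+ suc j)

      inverse : (1# - pw (double (k ℕ.+ suc j))) * inv (double (k ℕ.+ suc j)) ≈ 1#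
      inverse = ≡.subst (λ l → (1# - pw (double l)) * inv (double l) ≈ 1#) (≡.sym (ℕₚ.+-suc k j)) (inv-inverse _)

    p₀ : ∀ j → p 0 (suc j) ≈ 0#
    p₀ j = begin
      (1# - pw 0) * pw (t 0 (suc j)) * _   ≈⟨ *-congʳ (*-congʳ (trans (+-congˡ (-‿cong pw-0)) (-‿inverseʳ 1#))) ⟩
      0# * pw (t 0 (suc j)) * _            ≈⟨ solve 2 (λ a b → con 0ℤ :* a :* b := con 0ℤ) refl _ _ ⟩
      0#                                   ∎

    y₀₀ : y 0 0 ≈ 1#
    y₀₀ = begin
      pw (s 0 0) * (1# * 1#)  ≈⟨ *-cong (trans (reflexive (≡.cong pw s₀)) pw-0) (*-identityˡ 1#) ⟩
      1# * 1#                 ≈⟨ *-identityˡ 1# ⟩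
      1#                      ∎

    ascending-sum : (e z : ℕ → Carrier) → e 0 ≈ 1# →
      (∀ j → z j ≈ pw (s 0 j) * invPoch (double j)) → (∀ n → altConv e z 0 (suc n) ≈ 0#) →
      ∀ n → ascending firstWeight (double n) 0 ≈ e n
    ascending-sum e z e₀ z≈ inverse = ascending≈e firstWeight e y d p e₀ y₀₀
      (λ n → trans (sym (altConv-cong e (λ j → trans (z≈ j) (*-congˡ (invPoch-double j))) 0 (suc n))) (inverse n))
      y-suc d-zero d-suc p-zero p-suc p₀

  +-double : ∀ k → k ℕ.+ k ≡ double k
  +-double zero    = ≡.refl
  +-double (suc k) = ≡.cong suc (≡.trans (ℕₚ.+-suc k k) (≡.cong suc (+-double k)))

  double-+ : ∀ m n → double (m ℕ.+ n) ≡ double m ℕ.+ double n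
  double-+ zero    n = ≡.refl
  double-+ (suc m) n = ≡.cong (λ k → ℕ.suc (ℕ.suc k)) (double-+ m n)

  pw-double-+ : ∀ m n → pw (double (m ℕ.+ n)) ≈ pw (double m) * pw (double n)
  pw-double-+ m n = trans (reflexive (≡.cong pw (double-+ m n))) (pw-+ _ _)

  pw-suc-double-+ : ∀ m n → pw (suc (double (m ℕ.+ n))) ≈ pw (suc (double m)) * pw (double n)
  pw-suc-double-+ m n = trans (reflexive (≡.cong (pw ∘ suc) (double-+ m n))) (pw-+ _ _)

  -- Here Z₂ⱼ carries no power of q, and the exponents depend on k alone: `tri k` adds up the
  -- heights k-1, ..., 0 met on a direct descent from k.
  ascending-sum-≥ : (e z : ℕ → Carrier) → e 0 ≈ 1# →
    (∀ j → z j ≈ invPoch (double j)) → (∀ n → altConv e z 0 (suc n) ≈ 0#) →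
    ∀ n → ascending (λ h → pw (ℕ.pred h) * inv (double h)) (double n) 0 ≈ e n
  ascending-sum-≥ e z e₀ z≈ = ClosedForms.ascending-sum ℕ.pred (λ k j → tri k) (λ k j → tri k)
    ≡.refl (λ k j → ≡.refl) (λ k → ≡.refl)
    (λ k j → identity k j (pw-suc-double-+ k (suc j)) (split (suc k) k (suc (double k)) (≡.cong suc (+-double k))))
    (λ k j → identity k j (pw-double-+ k (suc j)) (split k k (double k) (+-double k)))
    e z e₀ (λ j → trans (z≈ j) (sym (trans (*-congʳ pw-0) (*-identityˡ _))))
    where
    split : ∀ a k b → a ℕ.+ k ≡ b → pw a * pw (k ℕ.+ tri k) ≈ pw b * pw (tri k)
    split a k b a+k≡b = begin
      pw a * pw (k ℕ.+ tri k)    ≈⟨ pw-+ a _ ⟨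
      pw (a ℕ.+ (k ℕ.+ tri k))   ≡⟨ ≡.cong pw (≡.trans (≡.sym (ℕₚ.+-assoc a k _)) (≡.cong (ℕ._+ tri k) a+k≡b)) ⟩
      pw (b ℕ.+ tri k)           ≈⟨ pw-+ b _ ⟩
      pw b * pw (tri k)          ∎

    -- With b = q^(2j+2), and a = q^(2k+1) for `d` or q^(2k) for `p`, both recurrences rest on 1 - a
    -- = (1 - ab) - a(1 - b).
    identity : ∀ k j {a ab X} → ab ≈ a * pw (double (suc j)) → X ≈ a * pw (tri k) →
      (1# - a) * pw (tri k) ≈ pw (tri k) * (1# - ab) - X * (1# - pw (double (suc j)))
    identity k j {a} {ab} {X} ab≈ X≈ = begin
      (1# - a) * pw (tri k)
        ≈⟨ solve 3 (λ a b t → (con 1ℤ :- a) :* t := t :* (con 1ℤ :- a :* b) :- a :* t :* (con 1ℤ :- b)) refl _ _ _ ⟩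
      pw (tri k) * (1# - a * pw (double (suc j))) - a * pw (tri k) * (1# - pw (double (suc j)))
        ≈⟨ +-cong (*-congˡ (+-congˡ (-‿cong ab≈))) (-‿cong (*-congʳ X≈)) ⟨
      pw (tri k) * (1# - ab) - X * (1# - pw (double (suc j))) ∎

  -- Here Z₂ⱼ carries the power `tri (double j)`. The exponent `s k j` extends it to height k by
  -- depending only on the degree k + 2j in x.
  ascending-sum-< : (e z : ℕ → Carrier) → e 0 ≈ 1# →
    (∀ j → z j ≈ pw (tri (double j)) * invPoch (double j)) → (∀ n → altConv e z 0 (suc n) ≈ 0#) →
    ∀ n → ascending (λ h → pw h * inv (double h)) (double n) 0 ≈ e n
  ascending-sum-< e z e₀ z≈ = ClosedForms.ascending-sum (λ h → h) s (λ k j → double j ℕ.+ s k j)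
    ≡.refl s-suc (λ k → ≡.refl)
    (λ k j → identity k j (pw-suc-double-+ k (suc j)))
    (λ k j → identity k j (pw-double-+ k (suc j)))
    e z e₀ z≈
    where
    s : ℕ → ℕ → ℕ
    s k j = tri (k ℕ.+ double j)

    s-suc : ∀ k j → s (suc k) j ≡ k ℕ.+ (double j ℕ.+ s k j)
    s-suc k j = ℕₚ.+-assoc k (double j) (s k j)

    raise : ∀ k j → suc k ℕ.+ (double j ℕ.+ s (suc k) j) ≡ s k (suc j)
    raise k j = ≡.trans (≡.sym (ℕₚ.+-assoc (suc k) (double j) _))
      (≡.cong tri (≡.sym (≡.trans (ℕₚ.+-suc k _) (≡.cong suc (ℕₚ.+-suc k _)))))

    -- The extra power in `t` moves a factor to the other side: both recurrences now rest on (1 -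
    -- a)b = (1 - ab) - (1 - b).
    identity : ∀ k j {a ab} → ab ≈ a * pw (double (suc j)) →
      (1# - a) * pw (double (suc j) ℕ.+ s k (suc j)) ≈
      pw (s k (suc j)) * (1# - ab) - pw (suc k) * pw (double j ℕ.+ s (suc k) j) * (1# - pw (double (suc j)))
    identity k j {a} {ab} ab≈ = begin
      (1# - a) * pw (double (suc j) ℕ.+ s k (suc j))
        ≈⟨ *-congˡ (pw-+ (double (suc j)) _) ⟩
      (1# - a) * (pw (double (suc j)) * pw (s k (suc j)))
        ≈⟨ solve 3 (λ a b t → (con 1ℤ :- a) :* (b :* t) := t :* (con 1ℤ :- a :* b) :- t :* (con 1ℤ :- b)) refl _ _ _ ⟩
      pw (s k (suc j)) * (1# - a * pw (double (suc j))) - pw (s k (suc j)) * (1# - pw (double (suc j)))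
        ≈⟨ +-cong (*-congˡ (+-congˡ (-‿cong ab≈)))
             (-‿cong (*-congʳ (trans (sym (pw-+ (suc k) _)) (reflexive (≡.cong pw (raise k j)))))) ⟨
      pw (s k (suc j)) * (1# - ab) - pw (suc k) * pw (double j ℕ.+ s (suc k) j) * (1# - pw (double (suc j))) ∎

-- From lists of Dyck paths to the first-step recurrence

EndsAtZero : ∀ {N} → Vec ℕ (suc N) → Set
EndsAtZero {N} h = lookup h (fromℕ N) ≡ 0 × (∀ (i : Fin N) → ∣ lookup h (inject₁ i) - lookup h (suc i) ∣ ≡ 1)

endsAtZero? : ∀ {N} (h : Vec ℕ (suc N)) → Dec (EndsAtZero h)
endsAtZero? h = (_ ℕₚ.≟ _) ×-dec Finₚ.all? (λ i → _ ℕₚ.≟ _)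

∣1+k-k∣≡1 : ∀ k → ∣ suc k - k ∣ ≡ 1
∣1+k-k∣≡1 zero    = ≡.refl
∣1+k-k∣≡1 (suc k) = ∣1+k-k∣≡1 k

∣1+k-2+k∣≡1 : ∀ k → ∣ suc k - suc (suc k) ∣ ≡ 1
∣1+k-2+k∣≡1 zero    = ≡.refl
∣1+k-2+k∣≡1 (suc k) = ∣1+k-2+k∣≡1 k

∣1+k-x∣≡1⇒x≡k : ∀ k x → x ≢ suc (suc k) → ∣ suc k - x ∣ ≡ 1 → x ≡ k
∣1+k-x∣≡1⇒x≡k zero    zero                x≢ eq = ≡.refl
∣1+k-x∣≡1⇒x≡k zero    (suc (suc zero))    x≢ eq = contradiction ≡.refl x≢
∣1+k-x∣≡1⇒x≡k (suc k) (suc x)             x≢ eq = ≡.cong suc (∣1+k-x∣≡1⇒x≡k k x (x≢ ∘ ≡.cong suc) eq)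

module PathSums (T : TruncatedPowers) (K : ℕ) where
  open Powers T
  open DyckRecurrence T
  open SetoidReasoning setoid

  ∑∈-applyUpTo : ∀ (g : ℕ → ℕ) n f → ∑∈ (applyUpTo g n) f ≈ ∑[ x < n ] f (g (toℕ x))
  ∑∈-applyUpTo g zero    f = refl
  ∑∈-applyUpTo g (suc n) f = +-congˡ (∑∈-applyUpTo (g ∘ suc) n f)

  ∑-point : ∀ n (f : ℕ → Carrier) {k} → k ℕ.< n → ∑[ x < n ] (ι (toℕ x ℕₚ.≟ k) * f (toℕ x)) ≈ f k
  ∑-point (suc n) f {zero} _ = begin
    1# * f 0 + ∑[ x < n ] (0# * f (suc (toℕ x)))   ≈⟨ +-cong (*-identityˡ _) (sum-cong-≋ {n} (λ x → zeroˡ _)) ⟩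
    f 0 + ∑[ x < n ] 0#                            ≈⟨ +-congˡ (sum-replicate-zero n) ⟩
    f 0 + 0#                                       ≈⟨ +-identityʳ _ ⟩
    f 0                                            ∎
  ∑-point (suc n) f {suc k} (s≤s k<n) = begin
    0# * f 0 + ∑[ x < n ] (ι (suc (toℕ x) ℕₚ.≟ suc k) * f (suc (toℕ x)))
      ≈⟨ +-cong (zeroˡ _) (sum-cong-≋ {n} (λ x → *-congʳ (ι-cong (suc (toℕ x) ℕₚ.≟ suc k) (toℕ x ℕₚ.≟ k) ℕₚ.suc-injective (≡.cong suc)))) ⟩
    0# + ∑[ x < n ] (ι (toℕ x ℕₚ.≟ k) * f (suc (toℕ x)))
      ≈⟨ +-identityˡ _ ⟩
    ∑[ x < n ] (ι (toℕ x ℕₚ.≟ k) * f (suc (toℕ x)))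
      ≈⟨ ∑-point n (f ∘ suc) k<n ⟩
    f (suc k) ∎

  heights : List ℕ
  heights = upTo K

  ∑-height : ∀ f {k} → k ℕ.< K → ∑∈ heights (λ x → ι (x ℕₚ.≟ k) * f x) ≈ f k
  ∑-height f k<K = trans (∑∈-applyUpTo id K _) (∑-point K f k<K)

  neighbour : ℕ → ℕ → Carrier
  neighbour k x = ι (∣ k - x ∣ ℕₚ.≟ 1)

  neighbour-suc : ∀ k x → neighbour (suc k) x ≈ ι (x ℕₚ.≟ k) + ι (x ℕₚ.≟ suc (suc k))
  neighbour-suc k x = byCases (x ℕₚ.≟ k) (x ℕₚ.≟ suc (suc k))
    where
    d = ∣ suc k - x ∣ ℕₚ.≟ 1

    byCases : Dec (x ≡ k) → Dec (x ≡ suc (suc k)) → neighbour (suc k) x ≈ ι (x ℕₚ.≟ k) + ι (x ℕₚ.≟ suc (suc k))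
    byCases (yes ≡.refl) _ = trans (ι-yes d (∣1+k-k∣≡1 k)) (sym (trans
      (+-cong (ι-yes (x ℕₚ.≟ k) ≡.refl) (ι-no (x ℕₚ.≟ suc (suc k)) (ℕₚ.<⇒≢ (ℕₚ.m<n⇒m<1+n (ℕₚ.n<1+n k))))) (+-identityʳ 1#)))
    byCases (no x≢k) (yes ≡.refl) = trans (ι-yes d (∣1+k-2+k∣≡1 k)) (sym (trans
      (+-cong (ι-no (x ℕₚ.≟ k) x≢k) (ι-yes (x ℕₚ.≟ suc (suc k)) ≡.refl)) (+-identityˡ 1#)))
    byCases (no x≢k) (no x≢2+k) = trans (ι-no d (x≢k ∘ ∣1+k-x∣≡1⇒x≡k k x x≢2+k)) (sym (trans
      (+-cong (ι-no (x ℕₚ.≟ k) x≢k) (ι-no (x ℕₚ.≟ suc (suc k)) x≢2+k)) (+-identityˡ 0#)))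

  below : (ℕ → Carrier) → ℕ → Carrier
  below f zero    = 0#
  below f (suc k) = f k

  -- The bound keeps the upper neighbour among the candidate heights.
  ∑-neighbours : ∀ f k → suc k ℕ.< K → ∑∈ heights (λ x → neighbour k x * f x) ≈ below f k + f (suc k)
  ∑-neighbours f zero 1<K = trans
    (trans (∑∈-cong heights (λ x → *-congʳ (ι-cong (x ℕₚ.≟ 1) (x ℕₚ.≟ 1) id id))) (∑-height f 1<K))
    (sym (+-identityˡ _))
  ∑-neighbours f (suc k) 2+k<K = begin
    ∑∈ heights (λ x → neighbour (suc k) x * f x)
      ≈⟨ ∑∈-cong heights (λ x → trans (*-congʳ (neighbour-suc k x)) (distribʳ _ _ _)) ⟩
    ∑∈ heights (λ x → ι (x ℕₚ.≟ k) * f x + ι (x ℕₚ.≟ suc (suc k)) * f x)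
      ≈⟨ ∑∈-applyUpTo id K _ ⟩
    ∑[ x < K ] (ι (toℕ x ℕₚ.≟ k) * f (toℕ x) + ι (toℕ x ℕₚ.≟ suc (suc k)) * f (toℕ x))
      ≈⟨ ∑-distrib-+ {K} _ _ ⟩
    ∑[ x < K ] (ι (toℕ x ℕₚ.≟ k) * f (toℕ x)) + ∑[ x < K ] (ι (toℕ x ℕₚ.≟ suc (suc k)) * f (toℕ x))
      ≈⟨ +-cong (∑-point K f (ℕₚ.<-trans (ℕₚ.n<1+n k) (ℕₚ.<-trans (ℕₚ.n<1+n (suc k)) 2+k<K))) (∑-point K f 2+k<K) ⟩
    f k + f (suc (suc k)) ∎

  module _ (firstWeight : ℕ → Carrier) (stepWeight : ℕ → ℕ → Carrier)
    (stepWeight-first : ∀ i → stepWeight (suc i) i ≈ firstWeight (suc i))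
    (stepWeight-after : ∀ h i → h ≢ suc i → stepWeight h i ≈ weight h)
    where

    -- The index `i` counts the steps already made, so the next vertex has position `suc i`, and δ
    -- applies to it exactly if its height is `suc i`.
    pathWeight : ∀ {N} → ℕ → Vec ℕ N → Carrier
    pathWeight i []      = 1#
    pathWeight i (x ∷ v) = stepWeight x i * pathWeight (suc i) v

    pathSum : ℕ → ℕ → ℕ → Carrier
    pathSum i N k = ∑∈ (words heights N) (λ v → ι (endsAtZero? (k ∷ v)) * pathWeight i v)

    pathSum-suc : ∀ i N k → suc k ℕ.< K →
      pathSum i (suc N) k ≈ below (λ x → stepWeight x i * pathSum (suc i) N x) k + stepWeight (suc k) i * pathSum (suc i) N (suc k)
    pathSum-suc i N k 1+k<K = begin
      pathSum i (suc N) k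
        ≈⟨ ∑∈-cartesianProductWith _∷_ heights (words heights N) _ ⟩
      ∑∈ heights (λ x → ∑∈ (words heights N) (λ v → ι (endsAtZero? (k ∷ x ∷ v)) * (stepWeight x i * pathWeight (suc i) v)))
        ≈⟨ ∑∈-cong heights first-step ⟩
      ∑∈ heights (λ x → neighbour k x * (stepWeight x i * pathSum (suc i) N x))
        ≈⟨ ∑-neighbours _ k 1+k<K ⟩
      below (λ x → stepWeight x i * pathSum (suc i) N x) k + stepWeight (suc k) i * pathSum (suc i) N (suc k) ∎
      where
      first-step : ∀ x → ∑∈ (words heights N) (λ v → ι (endsAtZero? (k ∷ x ∷ v)) * (stepWeight x i * pathWeight (suc i) v)) ≈
        neighbour k x * (stepWeight x i * pathSum (suc i) N x)
      first-step x = begin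
        ∑∈ (words heights N) (λ v → ι (endsAtZero? (k ∷ x ∷ v)) * (stepWeight x i * pathWeight (suc i) v))
          ≈⟨ ∑∈-cong (words heights N) (λ v → trans
               (*-congʳ (ι-split (endsAtZero? (k ∷ x ∷ v)) (∣ k - x ∣ ℕₚ.≟ 1) (endsAtZero? (x ∷ v))
                 (λ (end , steps) → steps zero , end , steps ∘ suc)
                 (λ { s (end , steps) → end , λ { zero → s ; (suc j) → steps j } })))
               (solve 4 (λ a b c d → a :* b :* (c :* d) := a :* c :* (b :* d)) refl _ _ _ _)) ⟩
        ∑∈ (words heights N) (λ v → neighbour k x * stepWeight x i * (ι (endsAtZero? (x ∷ v)) * pathWeight (suc i) v))
          ≈⟨ *-distribˡ-∑∈ _ (words heights N) _ ⟨
        neighbour k x * stepWeight x i * pathSum (suc i) N x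
          ≈⟨ *-assoc _ _ _ ⟩
        neighbour k x * (stepWeight x i * pathSum (suc i) N x) ∎

    pathSum-zero : ∀ i k → pathSum i 0 k ≈ after 0 k
    pathSum-zero i zero    = trans (+-identityʳ _) (trans (*-identityʳ _) (ι-yes (endsAtZero? (0 ∷ [])) (≡.refl , λ ())))
    pathSum-zero i (suc k) = trans (+-identityʳ _) (trans (*-identityʳ _) (ι-no (endsAtZero? (suc k ∷ [])) (λ ())))

    -- Once the height is below the number of steps made it stays so, whichever step follows; δ
    -- never applies again.
    pathSum-after : ∀ N i k → k ℕ.< i → k ℕ.+ N ℕ.< K → pathSum i N k ≈ after N k
    from-below : ∀ N i k → k ℕ.≤ i → k ℕ.+ suc N ℕ.< K →
      below (λ x → stepWeight x i * pathSum (suc i) N x) k ≈ fromBelow N k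

    pathSum-after zero    i k k<i _ = pathSum-zero i k
    pathSum-after (suc N) i k k<i k+N<K = begin
      pathSum i (suc N) k
        ≈⟨ pathSum-suc i N k (ℕₚ.≤-<-trans (s≤s (ℕₚ.m≤m+n k N)) 1+k+N<K) ⟩
      below (λ x → stepWeight x i * pathSum (suc i) N x) k + stepWeight (suc k) i * pathSum (suc i) N (suc k)
        ≈⟨ +-cong (from-below N i k (ℕₚ.<⇒≤ k<i) k+N<K)
                  (*-cong (stepWeight-after (suc k) i (λ e → ℕₚ.<⇒≢ k<i (ℕₚ.suc-injective e)))
                          (pathSum-after N (suc i) (suc k) (s≤s k<i) 1+k+N<K)) ⟩
      after (suc N) k ∎
      where
      1+k+N<K : suc (k ℕ.+ N) ℕ.< K
      1+k+N<K = ≡.subst (ℕ._< K) (ℕₚ.+-suc k N) k+N<K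

    from-below N i zero    _   _ = refl
    from-below N i (suc k) k<i b = *-cong
      (stepWeight-after k i (λ e → ℕₚ.<⇒≢ (ℕₚ.m<n⇒m<1+n k<i) e))
      (pathSum-after N (suc i) k (ℕₚ.m<n⇒m<1+n k<i)
        (ℕₚ.≤-<-trans (ℕₚ.≤-trans (ℕₚ.m≤n⇒m≤1+n (ℕₚ.+-monoʳ-≤ k (ℕₚ.n≤1+n N))) ℕₚ.≤-refl) b))

    -- Height and number of steps agree only on the initial ascent: a step up preserves the
    -- equality, a step down ends it for good.
    pathSum-ascending : ∀ N k → k ℕ.+ N ℕ.< K → pathSum k N k ≈ ascending firstWeight N k
    pathSum-ascending zero    zero    _ = pathSum-zero 0 0
    pathSum-ascending zero    (suc k) _ = pathSum-zero (suc k) (suc k)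
    pathSum-ascending (suc N) k k+N<K = begin
      pathSum k (suc N) k
        ≈⟨ pathSum-suc k N k (ℕₚ.≤-<-trans (s≤s (ℕₚ.m≤m+n k N)) 1+k+N<K) ⟩
      below (λ x → stepWeight x k * pathSum (suc k) N x) k + stepWeight (suc k) k * pathSum (suc k) N (suc k)
        ≈⟨ +-cong (from-below N k k ℕₚ.≤-refl k+N<K)
                  (*-cong (stepWeight-first k) (pathSum-ascending N (suc k) 1+k+N<K)) ⟩
      ascending firstWeight (suc N) k ∎
      where
      1+k+N<K : suc (k ℕ.+ N) ℕ.< K
      1+k+N<K = ≡.subst (ℕ._< K) (ℕₚ.+-suc k N) k+N<K

    ∏∈ : ∀ {A : Set} → List A → (A → Carrier) → Carrier
    ∏∈ xs f = foldr _*_ 1# (map f xs)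

    ∏∈-pathWeight : ∀ {N M} (g : Fin N → Fin M) i (v : Vec ℕ N) (w : Fin M → Carrier) →
      (∀ j → w (g j) ≡ stepWeight (lookup v j) (i ℕ.+ toℕ j)) → ∏∈ (tabulate g) w ≈ pathWeight i v
    ∏∈-pathWeight g i []      w w≡ = refl
    ∏∈-pathWeight g i (x ∷ v) w w≡ = *-cong
      (reflexive (≡.trans (w≡ zero) (≡.cong (stepWeight x) (ℕₚ.+-identityʳ i))))
      (∏∈-pathWeight (g ∘ suc) (suc i) v w (λ j → ≡.trans (w≡ (suc j)) (≡.cong (stepWeight (lookup v j)) (ℕₚ.+-suc i (toℕ j)))))

dyckPaths-sum : ∀ (T : TruncatedPowers) n → let open Powers T; open DyckRecurrence T in
  (firstWeight : ℕ → Carrier) (stepWeight : ℕ → ℕ → Carrier) →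
  (∀ i → stepWeight (suc i) i ≈ firstWeight (suc i)) →
  (∀ h i → h ≢ suc i → stepWeight h i ≈ weight h) →
  ∑∈ (dyckPaths n) (λ h → foldr _*_ 1# (map (λ i → stepWeight (lookup h (suc i)) (toℕ i)) (allFin (2 ℕ.* n)))) ≈
  ascending firstWeight (2 ℕ.* n) 0
dyckPaths-sum T n firstWeight stepWeight first afterwards = begin
  ∑∈ (dyckPaths n) w
    ≈⟨ ∑∈-filter (isDyck? n) (words heights (suc N)) w ⟩
  ∑∈ (words heights (suc N)) (λ h → ι (isDyck? n h) * w h)
    ≈⟨ ∑∈-cartesianProductWith _∷_ heights (words heights N) _ ⟩
  ∑∈ heights (λ k → ∑∈ (words heights N) (λ v → ι (isDyck? n (k ∷ v)) * w (k ∷ v)))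
    ≈⟨ ∑∈-cong heights from-height ⟩
  ∑∈ heights (λ k → ι (k ℕₚ.≟ 0) * pathSum′ 0 N k)
    ≈⟨ ∑-height (pathSum′ 0 N) (s≤s z≤n) ⟩
  pathSum′ 0 N 0
    -- The candidate heights 0, ..., N suffice for N steps from height 0.
    ≈⟨ pathSum-ascending firstWeight stepWeight first afterwards N 0 (ℕₚ.n<1+n N) ⟩
  ascending firstWeight N 0 ∎
  where
  N = 2 ℕ.* n
  open Powers T
  open DyckRecurrence T
  open PathSums T (suc N)
  open SetoidReasoning setoid

  pathSum′ : ℕ → ℕ → ℕ → Carrier
  pathSum′ = pathSum firstWeight stepWeight first afterwards

  w : Vec ℕ (suc N) → Carrier
  w h = foldr _*_ 1# (map (λ i → stepWeight (lookup h (suc i)) (toℕ i)) (allFin N))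

  from-height : ∀ k → ∑∈ (words heights N) (λ v → ι (isDyck? n (k ∷ v)) * w (k ∷ v)) ≈ ι (k ℕₚ.≟ 0) * pathSum′ 0 N k
  from-height k = begin
    ∑∈ (words heights N) (λ v → ι (isDyck? n (k ∷ v)) * w (k ∷ v))
      ≈⟨ ∑∈-cong (words heights N) (λ v → trans
           (*-cong (ι-× (k ℕₚ.≟ 0) (endsAtZero? (k ∷ v))) (∏∈-pathWeight firstWeight stepWeight first afterwards id 0 v _ (λ j → ≡.refl)))
           (*-assoc _ _ _)) ⟩
    ∑∈ (words heights N) (λ v → ι (k ℕₚ.≟ 0) * (ι (endsAtZero? (k ∷ v)) * pathWeight firstWeight stepWeight first afterwards 0 v))
      ≈⟨ *-distribˡ-∑∈ _ (words heights N) _ ⟨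
    ι (k ℕₚ.≟ 0) * pathSum′ 0 N k ∎

-- Polynomials as a commutative ring

open import Defs
open import Data.Nat.Base using (_*_)
open ≡ using (cong; cong₂)

module ℤSolver = IntegerSolver.+-*-Solver

coeff-neg : ∀ p k → coeff (-ₚ p) k ≡ ℤ.- coeff p k
coeff-neg []      k       = ≡.refl
coeff-neg (a ∷ p) zero    = ≡.refl
coeff-neg (a ∷ p) (suc k) = coeff-neg p k

shift-cong : ∀ p r → p ≈ r → (0ℤ ∷ p) ≈ (0ℤ ∷ r)
shift-cong p r p≈r zero    = ≡.refl
shift-cong p r p≈r (suc k) = p≈r k

shift-+ : ∀ p r → (0ℤ ∷ (p +ₚ r)) ≈ (0ℤ ∷ p) +ₚ (0ℤ ∷ r)
shift-+ p r zero    = ≡.refl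
shift-+ p r (suc k) = ≡.refl

*ₚ-distribʳ : ∀ p p′ r → (p +ₚ p′) *ₚ r ≈ p *ₚ r +ₚ p′ *ₚ r
*ₚ-distribʳ []      p′       r k = ≡.refl
*ₚ-distribʳ (a ∷ p) []       r k = ≡.sym (≡.trans (coeff-+ ((a ∷ p) *ₚ r) [] k) (ℤₚ.+-identityʳ _))
*ₚ-distribʳ (a ∷ p) (b ∷ p′) r k = begin
  coeff ((a ℤ.+ b ∷ p +ₚ p′) *ₚ r) k
    ≡⟨ coeff-* (a ℤ.+ b) (p +ₚ p′) r k ⟩
  (a ℤ.+ b) ℤ.* coeff r k ℤ.+ coeff (0ℤ ∷ ((p +ₚ p′) *ₚ r)) k
    ≡⟨ cong (ℤ._+_ ((a ℤ.+ b) ℤ.* coeff r k)) (≡.trans (shift-cong ((p +ₚ p′) *ₚ r) (p *ₚ r +ₚ p′ *ₚ r) (*ₚ-distribʳ p p′ r) k) (≡.trans (shift-+ (p *ₚ r) (p′ *ₚ r) k) (coeff-+ (0ℤ ∷ (p *ₚ r)) (0ℤ ∷ (p′ *ₚ r)) k))) ⟩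
  (a ℤ.+ b) ℤ.* coeff r k ℤ.+ (coeff (0ℤ ∷ (p *ₚ r)) k ℤ.+ coeff (0ℤ ∷ (p′ *ₚ r)) k)
    ≡⟨ ℤSolver.solve 5 (λ a b r x y → (a ℤSolver.:+ b) ℤSolver.:* r ℤSolver.:+ (x ℤSolver.:+ y)
         ℤSolver.:= (a ℤSolver.:* r ℤSolver.:+ x) ℤSolver.:+ (b ℤSolver.:* r ℤSolver.:+ y)) ≡.refl a b (coeff r k) (coeff (0ℤ ∷ (p *ₚ r)) k) (coeff (0ℤ ∷ (p′ *ₚ r)) k) ⟩
  (a ℤ.* coeff r k ℤ.+ coeff (0ℤ ∷ (p *ₚ r)) k) ℤ.+ (b ℤ.* coeff r k ℤ.+ coeff (0ℤ ∷ (p′ *ₚ r)) k)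
    ≡⟨ cong₂ ℤ._+_ (coeff-* a p r k) (coeff-* b p′ r k) ⟨
  coeff ((a ∷ p) *ₚ r) k ℤ.+ coeff ((b ∷ p′) *ₚ r) k
    ≡⟨ coeff-+ ((a ∷ p) *ₚ r) ((b ∷ p′) *ₚ r) k ⟨
  coeff ((a ∷ p) *ₚ r +ₚ (b ∷ p′) *ₚ r) k ∎
  where open ≡.≡-Reasoning

*ₚ-zeroʳ : ∀ p → p *ₚ [] ≈ []
*ₚ-zeroʳ []      k       = ≡.refl
*ₚ-zeroʳ (a ∷ p) zero    = ≡.refl
*ₚ-zeroʳ (a ∷ p) (suc k) = *ₚ-zeroʳ p k

-- The defining recursion of the product transferred to its second factor, as commutativity
-- requires.
*ₚ-∷ʳ : ∀ p b r → p *ₚ (b ∷ r) ≈ b ·ₚ p +ₚ (0ℤ ∷ (p *ₚ r))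
*ₚ-∷ʳ []      b r zero    = ≡.refl
*ₚ-∷ʳ []      b r (suc k) = ≡.refl
*ₚ-∷ʳ (a ∷ p) b r zero    = cong (ℤ._+ 0ℤ) (ℤₚ.*-comm a b)
*ₚ-∷ʳ (a ∷ p) b r (suc k) = begin
  coeff (a ·ₚ r +ₚ p *ₚ (b ∷ r)) k
    ≡⟨ coeff-+ (a ·ₚ r) (p *ₚ (b ∷ r)) k ⟩
  coeff (a ·ₚ r) k ℤ.+ coeff (p *ₚ (b ∷ r)) k
    ≡⟨ cong (ℤ._+_ (coeff (a ·ₚ r) k)) (≡.trans (*ₚ-∷ʳ p b r k) (coeff-+ (b ·ₚ p) (0ℤ ∷ (p *ₚ r)) k)) ⟩
  coeff (a ·ₚ r) k ℤ.+ (coeff (b ·ₚ p) k ℤ.+ coeff (0ℤ ∷ (p *ₚ r)) k)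
    ≡⟨ ℤSolver.solve 3 (λ x y z → x ℤSolver.:+ (y ℤSolver.:+ z) ℤSolver.:= y ℤSolver.:+ (x ℤSolver.:+ z)) ≡.refl (coeff (a ·ₚ r) k) (coeff (b ·ₚ p) k) (coeff (0ℤ ∷ (p *ₚ r)) k) ⟩
  coeff (b ·ₚ p) k ℤ.+ (coeff (a ·ₚ r) k ℤ.+ coeff (0ℤ ∷ (p *ₚ r)) k)
    ≡⟨ cong (ℤ._+_ (coeff (b ·ₚ p) k)) (coeff-+ (a ·ₚ r) (0ℤ ∷ (p *ₚ r)) k) ⟨
  coeff (b ·ₚ p) k ℤ.+ coeff ((a ∷ p) *ₚ r) k
    ≡⟨ coeff-+ (b ·ₚ p) ((a ∷ p) *ₚ r) k ⟨
  coeff (b ·ₚ p +ₚ (a ∷ p) *ₚ r) k ∎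
  where open ≡.≡-Reasoning

+ₚ-congˡ : ∀ p {r r′} → r ≈ r′ → p +ₚ r ≈ p +ₚ r′
+ₚ-congˡ p {r} {r′} r≈r′ k =
  ≡.trans (coeff-+ p r k) (≡.trans (cong (ℤ._+_ (coeff p k)) (r≈r′ k)) (≡.sym (coeff-+ p r′ k)))

*ₚ-comm : ∀ p r → p *ₚ r ≈ r *ₚ p
*ₚ-comm []      r k = ≡.sym (*ₚ-zeroʳ r k)
*ₚ-comm (a ∷ p) r k = ≡.trans (+ₚ-congˡ (a ·ₚ r) (shift-cong (p *ₚ r) (r *ₚ p) (*ₚ-comm p r)) k) (≡.sym (*ₚ-∷ʳ r a p k))

·ₚ-*ₚ : ∀ a p r → (a ·ₚ p) *ₚ r ≈ a ·ₚ (p *ₚ r)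
·ₚ-*ₚ a []      r k = ≡.refl
·ₚ-*ₚ a (b ∷ p) r k = begin
  coeff ((a ℤ.* b ∷ a ·ₚ p) *ₚ r) k
    ≡⟨ coeff-* (a ℤ.* b) (a ·ₚ p) r k ⟩
  a ℤ.* b ℤ.* coeff r k ℤ.+ coeff (0ℤ ∷ ((a ·ₚ p) *ₚ r)) k
    ≡⟨ cong (ℤ._+_ (a ℤ.* b ℤ.* coeff r k)) (≡.trans (shift-cong ((a ·ₚ p) *ₚ r) (a ·ₚ (p *ₚ r)) (·ₚ-*ₚ a p r) k) (shift-· k)) ⟩
  a ℤ.* b ℤ.* coeff r k ℤ.+ a ℤ.* coeff (0ℤ ∷ (p *ₚ r)) k
    ≡⟨ ℤSolver.solve 4 (λ a b r x → a ℤSolver.:* b ℤSolver.:* r ℤSolver.:+ a ℤSolver.:* x ℤSolver.:= a ℤSolver.:* (b ℤSolver.:* r ℤSolver.:+ x)) ≡.refl a b (coeff r k) (coeff (0ℤ ∷ (p *ₚ r)) k) ⟩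
  a ℤ.* (b ℤ.* coeff r k ℤ.+ coeff (0ℤ ∷ (p *ₚ r)) k)
    ≡⟨ cong (a ℤ.*_) (coeff-* b p r k) ⟨
  a ℤ.* coeff ((b ∷ p) *ₚ r) k
    ≡⟨ coeff-· a ((b ∷ p) *ₚ r) k ⟨
  coeff (a ·ₚ ((b ∷ p) *ₚ r)) k ∎
  where
  open ≡.≡-Reasoning
  shift-· : ∀ k → coeff (0ℤ ∷ (a ·ₚ (p *ₚ r))) k ≡ a ℤ.* coeff (0ℤ ∷ (p *ₚ r)) k
  shift-· zero    = ≡.sym (ℤₚ.*-zeroʳ a)
  shift-· (suc k) = coeff-· a (p *ₚ r) k

shift-*ₚ : ∀ p r → (0ℤ ∷ p) *ₚ r ≈ 0ℤ ∷ (p *ₚ r)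
shift-*ₚ p r k = ≡.trans (coeff-* 0ℤ p r k) (ℤₚ.+-identityˡ _)

*ₚ-assoc : ∀ p r t → (p *ₚ r) *ₚ t ≈ p *ₚ (r *ₚ t)
*ₚ-assoc []      r t k = ≡.refl
*ₚ-assoc (a ∷ p) r t k = begin
  coeff ((a ·ₚ r +ₚ (0ℤ ∷ (p *ₚ r))) *ₚ t) k
    ≡⟨ ≡.trans (*ₚ-distribʳ (a ·ₚ r) (0ℤ ∷ (p *ₚ r)) t k) (coeff-+ ((a ·ₚ r) *ₚ t) _ k) ⟩
  coeff ((a ·ₚ r) *ₚ t) k ℤ.+ coeff ((0ℤ ∷ (p *ₚ r)) *ₚ t) k
    ≡⟨ cong₂ ℤ._+_ (·ₚ-*ₚ a r t k) (≡.trans (shift-*ₚ (p *ₚ r) t k) (shift-cong ((p *ₚ r) *ₚ t) (p *ₚ (r *ₚ t)) (*ₚ-assoc p r t) k)) ⟩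
  coeff (a ·ₚ (r *ₚ t)) k ℤ.+ coeff (0ℤ ∷ (p *ₚ (r *ₚ t))) k
    ≡⟨ coeff-+ (a ·ₚ (r *ₚ t)) _ k ⟨
  coeff ((a ∷ p) *ₚ (r *ₚ t)) k ∎
  where open ≡.≡-Reasoning

*ₚ-identityˡ : ∀ r → 1ₚ *ₚ r ≈ r
*ₚ-identityˡ r k = ≡.trans (coeff-* 1ℤ [] r k) (≡.trans (cong₂ ℤ._+_ (ℤₚ.*-identityˡ (coeff r k)) (shift-[] k)) (ℤₚ.+-identityʳ _))
  where
  shift-[] : ∀ k → coeff (0ℤ ∷ []) k ≡ 0ℤ
  shift-[] zero    = ≡.refl
  shift-[] (suc k) = ≡.refl

+ₚ-assoc : ∀ p r t → (p +ₚ r) +ₚ t ≈ p +ₚ (r +ₚ t)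
+ₚ-assoc p r t k = begin
  coeff ((p +ₚ r) +ₚ t) k                           ≡⟨ ≡.trans (coeff-+ (p +ₚ r) t k) (cong (ℤ._+ coeff t k) (coeff-+ p r k)) ⟩
  coeff p k ℤ.+ coeff r k ℤ.+ coeff t k             ≡⟨ ℤₚ.+-assoc (coeff p k) _ _ ⟩
  coeff p k ℤ.+ (coeff r k ℤ.+ coeff t k)           ≡⟨ ≡.trans (coeff-+ p (r +ₚ t) k) (cong (ℤ._+_ (coeff p k)) (coeff-+ r t k)) ⟨
  coeff (p +ₚ (r +ₚ t)) k                           ∎
  where open ≡.≡-Reasoning

+ₚ-comm : ∀ p r → p +ₚ r ≈ r +ₚ p
+ₚ-comm p r k = ≡.trans (coeff-+ p r k) (≡.trans (ℤₚ.+-comm (coeff p k) _) (≡.sym (coeff-+ r p k)))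

+ₚ-identityʳ : ∀ p → p +ₚ 0ₚ ≈ p
+ₚ-identityʳ p k = ≡.trans (coeff-+ p 0ₚ k) (ℤₚ.+-identityʳ _)

+ₚ-inverseʳ : ∀ p → p +ₚ (-ₚ p) ≈ 0ₚ
+ₚ-inverseʳ p k = ≡.trans (coeff-+ p (-ₚ p) k) (≡.trans (cong (ℤ._+_ (coeff p k)) (coeff-neg p k)) (ℤₚ.+-inverseʳ (coeff p k)))

*ₚ-distribˡ : ∀ p r t → p *ₚ (r +ₚ t) ≈ p *ₚ r +ₚ p *ₚ t
*ₚ-distribˡ p r t k = begin
  coeff (p *ₚ (r +ₚ t)) k                       ≡⟨ *ₚ-comm p (r +ₚ t) k ⟩
  coeff ((r +ₚ t) *ₚ p) k                       ≡⟨ ≡.trans (*ₚ-distribʳ r t p k) (coeff-+ (r *ₚ p) (t *ₚ p) k) ⟩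
  coeff (r *ₚ p) k ℤ.+ coeff (t *ₚ p) k         ≡⟨ cong₂ ℤ._+_ (*ₚ-comm r p k) (*ₚ-comm t p k) ⟩
  coeff (p *ₚ r) k ℤ.+ coeff (p *ₚ t) k         ≡⟨ coeff-+ (p *ₚ r) (p *ₚ t) k ⟨
  coeff (p *ₚ r +ₚ p *ₚ t) k                    ∎
  where open ≡.≡-Reasoning

q^-+ : ∀ m n → q^ (m ℕ.+ n) ≈ (q^ m) *ₚ (q^ n)
q^-+ zero    n k = ≡.sym (*ₚ-identityˡ (q^ n) k)
q^-+ (suc m) n k = ≡.trans (shift-cong (q^ (m ℕ.+ n)) ((q^ m) *ₚ (q^ n)) (q^-+ m n) k) (≡.sym (shift-*ₚ (q^ m) (q^ n) k))

coeff-q^ : ∀ n k → k ℕ.< n → coeff (q^ n) k ≡ 0ℤ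
coeff-q^ (suc n) zero    _         = ≡.refl
coeff-q^ (suc n) (suc k) (s≤s k<n) = coeff-q^ n k k<n

δ-refl : ∀ h → δ h h ≡ 1
δ-refl h = cong (if_then 1 else 0) (dec-true (h ℕₚ.≟ h) ≡.refl)

δ-≢ : ∀ {h i} → h ≢ i → δ h i ≡ 0
δ-≢ {h} {i} h≢i = cong (if_then 1 else 0) (dec-false (h ℕₚ.≟ i) h≢i)

2*≡double : ∀ n → 2 ℕ.* n ≡ double n
2*≡double zero    = ≡.refl
2*≡double (suc n) = cong suc (≡.trans (ℕₚ.+-suc n (n ℕ.+ 0)) (cong suc (2*≡double n)))

2*+1≡suc-double : ∀ n → 2 ℕ.* n ℕ.+ 1 ≡ suc (double n)
2*+1≡suc-double n = ≡.trans (ℕₚ.+-comm (2 ℕ.* n) 1) (cong suc (2*≡double n))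

-- Truncated expansions of rational functions and the conclusion

module Truncation (M : ℕ) where

  infix 4 _≈ᴹ_
  -- A record rather than a function type, so that p and r can be inferred from p ≈ᴹ r.
  record _≈ᴹ_ (p r : Poly) : Set where
    constructor truncated
    field agree : ∀ k → k ℕ.< M → coeff p k ≡ coeff r k
  open _≈ᴹ_ public

  weaken : ∀ {p r} → p ≈ r → p ≈ᴹ r
  weaken p≈r = truncated λ k _ → p≈r k

  ≈ᴹ-isEquivalence : IsEquivalence _≈ᴹ_
  ≈ᴹ-isEquivalence = record
    { refl  = truncated λ _ _ → ≡.refl
    ; sym   = λ e → truncated λ k k<M → ≡.sym (agree e k k<M)
    ; trans = λ e f → truncated λ k k<M → ≡.trans (agree e k k<M) (agree f k k<M)
    }

  +ₚ-cong : ∀ {p p′ r r′} → p ≈ᴹ p′ → r ≈ᴹ r′ → p +ₚ r ≈ᴹ p′ +ₚ r′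
  +ₚ-cong {p} {p′} {r} {r′} e f = truncated λ k k<M →
    ≡.trans (coeff-+ p r k) (≡.trans (cong₂ ℤ._+_ (agree e k k<M) (agree f k k<M)) (≡.sym (coeff-+ p′ r′ k)))

  *ₚ-congʳ : ∀ p {r r′} → r ≈ᴹ r′ → p *ₚ r ≈ᴹ p *ₚ r′
  *ₚ-congʳ []      e = truncated λ _ _ → ≡.refl
  *ₚ-congʳ (a ∷ p) {r} {r′} e = truncated λ k k<M →
    ≡.trans (coeff-* a p r k) (≡.trans (cong₂ (λ x y → a ℤ.* x ℤ.+ y) (agree e k k<M) (shifted k k<M)) (≡.sym (coeff-* a p r′ k)))
    where
    shifted : ∀ k → k ℕ.< M → coeff (0ℤ ∷ (p *ₚ r)) k ≡ coeff (0ℤ ∷ (p *ₚ r′)) k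
    shifted zero    _   = ≡.refl
    shifted (suc k) k<M = agree (*ₚ-congʳ p e) k (ℕₚ.<-trans (ℕₚ.n<1+n k) k<M)

  *ₚ-cong : ∀ {p p′ r r′} → p ≈ᴹ p′ → r ≈ᴹ r′ → p *ₚ r ≈ᴹ p′ *ₚ r′
  *ₚ-cong {p} {p′} {r} {r′} e f = truncated λ k k<M →
    ≡.trans (agree (*ₚ-congʳ p f) k k<M) (≡.trans (*ₚ-comm p r′ k) (≡.trans (agree (*ₚ-congʳ r′ e) k k<M) (*ₚ-comm r′ p′ k)))

  -ₚ-cong : ∀ {p r} → p ≈ᴹ r → -ₚ p ≈ᴹ -ₚ r
  -ₚ-cong {p} {r} e = truncated λ k k<M → ≡.trans (coeff-neg p k) (≡.trans (cong ℤ.-_ (agree e k k<M)) (≡.sym (coeff-neg r k)))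

  isCommutativeRing : IsCommutativeRing _≈ᴹ_ _+ₚ_ _*ₚ_ -ₚ_ 0ₚ 1ₚ
  isCommutativeRing = record
    { isRing = record
      { +-isAbelianGroup = record
        { isGroup = record
          { isMonoid = record
            { isSemigroup = record
              { isMagma = record { isEquivalence = ≈ᴹ-isEquivalence ; ∙-cong = +ₚ-cong }
              ; assoc   = λ p r t → weaken (+ₚ-assoc p r t)
              }
            ; identity = (λ p → weaken {p} {p} (λ _ → ≡.refl)) , (λ p → weaken (+ₚ-identityʳ p))
            }
          ; inverse = (λ p → weaken (λ k → ≡.trans (+ₚ-comm (-ₚ p) p k) (+ₚ-inverseʳ p k))) , (λ p → weaken (+ₚ-inverseʳ p))
          ; ⁻¹-cong = -ₚ-cong
          }
        ; comm = λ p r → weaken (+ₚ-comm p r)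
        }
      ; *-cong     = *ₚ-cong
      ; *-assoc    = λ p r t → weaken (*ₚ-assoc p r t)
      ; *-identity = (λ p → weaken (*ₚ-identityˡ p)) , (λ p → weaken (λ k → ≡.trans (*ₚ-comm p 1ₚ k) (*ₚ-identityˡ p k)))
      ; distrib    = (λ p r t → weaken (*ₚ-distribˡ p r t)) , (λ p r t → weaken (*ₚ-distribʳ r t p))
      }
    ; *-comm = λ p r → weaken (*ₚ-comm p r)
    }

  truncatedPowers : TruncatedPowers
  truncatedPowers = record
    { commutativeRing = record { isCommutativeRing = isCommutativeRing }
    ; M    = M
    ; pw   = q^_
    ; pw-0 = weaken λ _ → ≡.refl
    ; pw-+ = λ m n → weaken (q^-+ m n)
    ; pw-M = λ n M≤n → truncated λ k k<M → coeff-q^ n k (ℕₚ.<-≤-trans k<M M≤n)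
    }

  open Powers truncatedPowers hiding (M) renaming (_≈_ to _≈ₜ_; _*_ to _*ₜ_)
  open SetoidReasoning setoid

  -- As power series, f expands to s modulo q^M.
  record Expands (f : RatFun) (s : Poly) : Set where
    constructor expands
    field numerator : num f ≈ᴹ s *ₚ den f
  open Expands

  expands-+ : ∀ f g s t → Expands f s → Expands g t → Expands (f +ᶠ g) (s +ₚ t)
  expands-+ f g s t f∼s g∼t = expands (begin
    num f *ₚ den g +ₚ num g *ₚ den f
      ≈⟨ +-cong (*-congʳ (numerator f∼s)) (*-congʳ (numerator g∼t)) ⟩
    s *ₚ den f *ₚ den g +ₚ t *ₚ den g *ₚ den f
      ≈⟨ solve 4 (λ s a t b → s :* a :* b :+ t :* b :* a := (s :+ t) :* (a :* b)) refl s (den f) t (den g) ⟩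
    (s +ₚ t) *ₚ (den f *ₚ den g) ∎)

  expands-* : ∀ f g s t → Expands f s → Expands g t → Expands (f *ᶠ g) (s *ₚ t)
  expands-* f g s t f∼s g∼t = expands (begin
    num f *ₚ num g
      ≈⟨ *-cong (numerator f∼s) (numerator g∼t) ⟩
    s *ₚ den f *ₚ (t *ₚ den g)
      ≈⟨ solve 4 (λ s a t b → s :* a :* (t :* b) := s :* t :* (a :* b)) refl s (den f) t (den g) ⟩
    s *ₚ t *ₚ (den f *ₚ den g) ∎)

  expands-∑ : ∀ {A : Set} (xs : List A) (f : A → RatFun) (s : A → Poly) → (∀ x → Expands (f x) (s x)) →
    Expands (∑ (map f xs)) (∑∈ xs s)
  expands-∑ []       f s f∼s = expands refl
  expands-∑ (x ∷ xs) f s f∼s = expands-+ (f x) (∑ (map f xs)) (s x) (∑∈ xs s) (f∼s x) (expands-∑ xs f s f∼s)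

  expands-∏ : ∀ {A : Set} (xs : List A) (f : A → RatFun) (s : A → Poly) → (∀ x → Expands (f x) (s x)) →
    Expands (∏ (map f xs)) (foldr _*ₚ_ 1ₚ (map s xs))
  expands-∏ []       f s f∼s = expands (sym (*-identityˡ 1ₚ))
  expands-∏ (x ∷ xs) f s f∼s = expands-* (f x) (∏ (map f xs)) (s x) (foldr _*ₚ_ 1ₚ (map s xs)) (f∼s x) (expands-∏ xs f s f∼s)

  -- Each numerator is replaced by its expansion times its denominator, so the cross products agree
  -- without cancelling anything.
  expands-unique : ∀ f g s t → s ≈ᴹ t → Expands f s → Expands g t → num f *ₚ den g ≈ᴹ num g *ₚ den f
  expands-unique f g s t s≈t f∼s g∼t = begin
    num f *ₚ den g            ≈⟨ *-congʳ (numerator f∼s) ⟩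
    s *ₚ den f *ₚ den g       ≈⟨ *-congʳ (*-congʳ s≈t) ⟩
    t *ₚ den f *ₚ den g       ≈⟨ solve 3 (λ t a b → t :* a :* b := t :* b :* a) refl t (den f) (den g) ⟩
    t *ₚ den g *ₚ den f       ≈⟨ *-congʳ (numerator g∼t) ⟨
    num g *ₚ den f            ∎

  expands-quotient : ∀ a e (e>0 : 0 ℕ.< e) → Expands (a / (1ₚ -ₚ (q^ e)) ⟨ 1-q^≉0 e>0 ⟩) (a *ₚ inv e)
  expands-quotient a (suc e) _ = expands (begin
    a                                              ≈⟨ *-identityʳ a ⟨
    a *ₚ 1ₚ                                        ≈⟨ *-congˡ {a} (inv-inverse e) ⟨
    a *ₚ ((1ₚ -ₚ (q^ suc e)) *ₚ inv (suc e))       ≈⟨ solve 3 (λ a b c → a :* (b :* c) := a :* c :* b) refl a _ _ ⟩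
    a *ₚ inv (suc e) *ₚ (1ₚ -ₚ (q^ suc e))         ∎)

  -- The product unfolds at its first factor, whereas `invPoch` grows at its last; this reconciles
  -- the two recursions.
  ∏-applyUpTo : ∀ (f : ℕ → Poly) (g : ℕ → ℕ) n →
    ∏ₚ (map f (applyUpTo g (suc n))) ≈ᴹ ∏ₚ (map f (applyUpTo g n)) *ₚ f (g n)
  ∏-applyUpTo f g zero    = *-comm (f (g 0)) 1ₚ
  ∏-applyUpTo f g (suc n) = trans (*-congˡ {f (g 0)} (∏-applyUpTo f (g ∘ suc) n)) (sym (*-assoc (f (g 0)) _ _))

  invPoch-inverse : ∀ n → invPoch n *ₚ ⟨ q ⨾q⟩ n ≈ᴹ 1ₚ
  invPoch-inverse zero    = *-identityˡ 1ₚ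
  invPoch-inverse (suc n) = begin
    invPoch n *ₚ inv (suc n) *ₚ ⟨ q ⨾q⟩ (suc n)
      ≈⟨ *-congˡ {invPoch n *ₚ inv (suc n)} (trans (∏-applyUpTo (λ i → 1ₚ -ₚ q *ₚ (q^ i)) id n) (*-congˡ {⟨ q ⨾q⟩ n} (+-congˡ {1ₚ} (-‿cong (sym (pw-+ 1 n)))))) ⟩
    invPoch n *ₚ inv (suc n) *ₚ (⟨ q ⨾q⟩ n *ₚ (1ₚ -ₚ (q^ suc n)))
      ≈⟨ solve 4 (λ a b c d → a :* b :* (c :* d) := a :* c :* (d :* b)) refl (invPoch n) _ _ _ ⟩
    invPoch n *ₚ ⟨ q ⨾q⟩ n *ₚ ((1ₚ -ₚ (q^ suc n)) *ₚ inv (suc n))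
      ≈⟨ *-cong (invPoch-inverse n) (inv-inverse n) ⟩
    1ₚ *ₚ 1ₚ
      ≈⟨ *-identityˡ 1ₚ ⟩
    1ₚ ∎

  expands-/⟨q⨾q⟩ : ∀ p n → Expands (p / ⟨ q ⨾q⟩ n ⟨ ⟨q⨾q⟩≉0 n ⟩) (p *ₚ invPoch n)
  expands-/⟨q⨾q⟩ p n = expands (begin
    p                                     ≈⟨ *-identityʳ p ⟨
    p *ₚ 1ₚ                               ≈⟨ *-congˡ {p} (invPoch-inverse n) ⟨
    p *ₚ (invPoch n *ₚ ⟨ q ⨾q⟩ n)         ≈⟨ *-assoc p (invPoch n) _ ⟨
    p *ₚ invPoch n *ₚ ⟨ q ⨾q⟩ n           ∎)

  open DyckRecurrence truncatedPowers

  -- The expansions of `factor⋆` and `factor`, with `i` one less than the position, as in the path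
  -- sums.
  stepWeight⋆ stepWeight : ℕ → ℕ → Poly
  stepWeight⋆ h i = (q^ h) *ₚ inv (2 ℕ.* h ℕ.+ 1 ℕ.∸ δ h (suc i))
  stepWeight  h i = (q^ (h ℕ.∸ δ h (suc i))) *ₚ inv (2 ℕ.* h ℕ.+ 1 ℕ.∸ δ h (suc i))

  stepWeight⋆-first : ∀ i → stepWeight⋆ (suc i) i ≡ (q^ suc i) *ₚ inv (double (suc i))
  stepWeight⋆-first i = ≡.trans (cong (λ d → (q^ suc i) *ₚ inv (2 ℕ.* suc i ℕ.+ 1 ℕ.∸ d)) (δ-refl (suc i)))
    (cong (λ e → (q^ suc i) *ₚ inv (e ℕ.∸ 1)) (2*+1≡suc-double (suc i)))

  stepWeight⋆-after : ∀ h i → h ≢ suc i → stepWeight⋆ h i ≡ (q^ h) *ₚ inv (suc (double h))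
  stepWeight⋆-after h i h≢ = ≡.trans (cong (λ d → (q^ h) *ₚ inv (2 ℕ.* h ℕ.+ 1 ℕ.∸ d)) (δ-≢ h≢))
    (cong (λ e → (q^ h) *ₚ inv e) (2*+1≡suc-double h))

  stepWeight-first : ∀ i → stepWeight (suc i) i ≡ (q^ i) *ₚ inv (double (suc i))
  stepWeight-first i = ≡.trans (cong (λ d → (q^ (suc i ℕ.∸ d)) *ₚ inv (2 ℕ.* suc i ℕ.+ 1 ℕ.∸ d)) (δ-refl (suc i)))
    (cong (λ e → (q^ i) *ₚ inv (e ℕ.∸ 1)) (2*+1≡suc-double (suc i)))

  stepWeight-after : ∀ h i → h ≢ suc i → stepWeight h i ≡ (q^ h) *ₚ inv (suc (double h))
  stepWeight-after h i h≢ = ≡.trans (cong (λ d → (q^ (h ℕ.∸ d)) *ₚ inv (2 ℕ.* h ℕ.+ 1 ℕ.∸ d)) (δ-≢ h≢))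
    (cong (λ e → (q^ h) *ₚ inv e) (2*+1≡suc-double h))

  open LinkedSums truncatedPowers
  module W⋆ = AlternatingWords truncatedPowers ℕₚ._<?_
  module W  = AlternatingWords truncatedPowers ℕₚ._≥?_

  alt≈E⋆ : ∀ n → W⋆.alt n ≈ᴹ E⋆ n *ₚ invPoch n
  alt≈E⋆ zero    = sym (*-identityˡ 1ₚ)
  alt≈E⋆ (suc m) = W⋆.alt-permutations {m} isAlternating? isAlternating⇔

  alt≈E : ∀ n → W.alt n ≈ᴹ E n *ₚ invPoch n
  alt≈E zero    = sym (*-identityˡ 1ₚ)
  alt≈E (suc m) = W.alt-permutations {m} isReverseAlternating? isReverseAlternating⇔

  dyckSum⋆ : ∀ n → ∑∈ (dyckPaths n) (λ h → foldr _*ₚ_ 1ₚ (map (λ i → stepWeight⋆ (lookup h (suc i)) (toℕ i)) (allFin (2 ℕ.* n))))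
    ≈ᴹ E⋆ (2 ℕ.* n) *ₚ invPoch (2 ℕ.* n)
  dyckSum⋆ n = begin
    _
      ≈⟨ dyckPaths-sum truncatedPowers n (λ h → (q^ h) *ₚ inv (double h)) stepWeight⋆
           (reflexive ∘ stepWeight⋆-first) (λ h i → reflexive ∘ stepWeight⋆-after h i) ⟩
    ascending (λ h → (q^ h) *ₚ inv (double h)) (2 ℕ.* n) 0
      ≡⟨ cong (λ N → ascending (λ h → (q^ h) *ₚ inv (double h)) N 0) (2*≡double n) ⟩
    ascending (λ h → (q^ h) *ₚ inv (double h)) (double n) 0
      ≈⟨ ascending-sum-< (W⋆.alt ∘ double) (W⋆.linked ∘ double) refl (linked-< ∘ double) W⋆.altConv-alt-linked n ⟩
    W⋆.alt (double n)
      ≡⟨ cong W⋆.alt (2*≡double n) ⟨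
    W⋆.alt (2 ℕ.* n)
      ≈⟨ alt≈E⋆ (2 ℕ.* n) ⟩
    E⋆ (2 ℕ.* n) *ₚ invPoch (2 ℕ.* n) ∎

  dyckSum : ∀ n → ∑∈ (dyckPaths n) (λ h → foldr _*ₚ_ 1ₚ (map (λ i → stepWeight (lookup h (suc i)) (toℕ i)) (allFin (2 ℕ.* n))))
    ≈ᴹ E (2 ℕ.* n) *ₚ invPoch (2 ℕ.* n)
  dyckSum n = begin
    _
      ≈⟨ dyckPaths-sum truncatedPowers n (λ h → (q^ ℕ.pred h) *ₚ inv (double h)) stepWeight
           (reflexive ∘ stepWeight-first) (λ h i → reflexive ∘ stepWeight-after h i) ⟩
    ascending (λ h → (q^ ℕ.pred h) *ₚ inv (double h)) (2 ℕ.* n) 0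
      ≡⟨ cong (λ N → ascending (λ h → (q^ ℕ.pred h) *ₚ inv (double h)) N 0) (2*≡double n) ⟩
    ascending (λ h → (q^ ℕ.pred h) *ₚ inv (double h)) (double n) 0
      ≈⟨ ascending-sum-≥ (W.alt ∘ double) (W.linked ∘ double) refl (linked-≥ ∘ double) W.altConv-alt-linked n ⟩
    W.alt (double n)
      ≡⟨ cong W.alt (2*≡double n) ⟨
    W.alt (2 ℕ.* n)
      ≈⟨ alt≈E (2 ℕ.* n) ⟩
    E (2 ℕ.* n) *ₚ invPoch (2 ℕ.* n) ∎

-- The coefficient of q^k is visible in the truncation with M = k + 1.
≃-by-truncation : ∀ f g →
  (∀ M → let open Truncation M in num f *ₚ den g ≈ᴹ num g *ₚ den f) → f ≃ g
≃-by-truncation f g eq k = Truncation.agree (eq (suc k)) k (ℕₚ.n<1+n k)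

theorem3p1 : (n : ℕ) →
    ( ∑ (map (λ h → ∏ (map (λ i → factor⋆ (lookup h (suc i)) (position i)) (allFin (2 * n)))) (dyckPaths n))
    ≃ E⋆ (2 * n) / ⟨ q ⨾q⟩ (2 * n) ⟨ ⟨q⨾q⟩≉0 (2 * n) ⟩ )
    ×
    ( ∑ (map (λ h → ∏ (map (λ i → factor (lookup h (suc i)) (position i)) (allFin (2 * n)))) (dyckPaths n))
    ≃ E (2 * n) / ⟨ q ⨾q⟩ (2 * n) ⟨ ⟨q⨾q⟩≉0 (2 * n) ⟩ )
theorem3p1 n =
  ≃-by-truncation lhs⋆ rhs⋆ (λ M → let open Truncation M in
    expands-unique lhs⋆ rhs⋆ _ _ (dyckSum⋆ n)
      (expands-∑ (dyckPaths n) _ _ (λ h → expands-∏ (allFin (2 * n)) _ _ (λ i →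
        expands-quotient (q^ lookup h (suc i)) _ (exponent>0 (lookup h (suc i)) (position i)))))
      (expands-/⟨q⨾q⟩ (E⋆ (2 * n)) (2 * n))) ,
  ≃-by-truncation lhs rhs (λ M → let open Truncation M in
    expands-unique lhs rhs _ _ (dyckSum n)
      (expands-∑ (dyckPaths n) _ _ (λ h → expands-∏ (allFin (2 * n)) _ _ (λ i →
        expands-quotient (q^ (lookup h (suc i) ℕ.∸ δ (lookup h (suc i)) (position i))) _ (exponent>0 (lookup h (suc i)) (position i)))))
      (expands-/⟨q⨾q⟩ (E (2 * n)) (2 * n)))
  where
  lhs⋆ rhs⋆ lhs rhs : RatFun
  lhs⋆ = ∑ (map (λ h → ∏ (map (λ i → factor⋆ (lookup h (suc i)) (position i)) (allFin (2 * n)))) (dyckPaths n))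
  rhs⋆ = E⋆ (2 * n) / ⟨ q ⨾q⟩ (2 * n) ⟨ ⟨q⨾q⟩≉0 (2 * n) ⟩
  lhs  = ∑ (map (λ h → ∏ (map (λ i → factor (lookup h (suc i)) (position i)) (allFin (2 * n)))) (dyckPaths n))
  rhs  = E (2 * n) / ⟨ q ⨾q⟩ (2 * n) ⟨ ⟨q⨾q⟩≉0 (2 * n) ⟩
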